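{- For every integer $n>0$, $$\sum_{k=0}^{n-1}(-1)^k q^{ -\binom{k}{2}}C_k^q\equiv F_n^q(q)+F_{n+2}^q(1)-2\pmod{\Phi_n(q)},$$ and, with $r(n)=\lfloor n/5+\tfrac12\rfloor$, $$F_n^q(q)+F_{n+2}^q(1)\equiv\begin{cases}(-1)^{r(n)}\left(q^{\frac{r(n)(n-1)}{2}}+q^{\frac{r(n)(n+1)}{2}}\right) & \text{if } n\equiv 0,2,3\pmod 5,\\[6pt] (-1)^{r(n)}\left(q^{\frac{r(n)(n-2)}{2}}+q^{\frac{r(n)n}{2}}+q^{\frac{r(n)(n+2)}{2}}\right) & \text{if } n\equiv 1,4\pmod 5,\end{cases}\pmod{\Phi_n(q)}.$$
   Context: The Gaussian $q$-binomial coefficient $\binom{n}{k}_q$ is the polynomial in $q$ given by $\binom{n}{k}_q=\dfrac{(q;q)_n}{(q;q)_k(q;q)_{n-k}}$ if $0\le k\le n$ and $\binom{n}{k}_q=0$ otherwise, where $(z;q)_n=\prod_{j=0}^{n-1}(1-zq^j)$. The $q$-Catalan number is the polynomial $C_n^q=\dfrac{1}{[n+1]_q}\binom{2n}{n}_q=\binom{2n}{n}_q-q\binom{2n}{n+1}_q$, where $[n+1]_q=\dfrac{1-q^{n+1}}{1-q}$. In the exponent, $\binom{k}{2}=k(k-1)/2$ is the ordinary binomial coefficient. The $q$-Fibonacci polynomials $F_n^q(t)$ are defined by $F_0^q(t)=0$, $F_1^q(t)=1$ and $F_n^q(t)=F_{n-1}^q(t)+q^{n-2}t\,F_{n-2}^q(t)$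 for $n\ge 2$; $F_n^q(q)$ and $F_{n+2}^q(1)$ denote the substitutions $t=q$ and $t=1$. $\Phi_n(q)=\prod_{0\le m<n,\ \gcd(m,n)=1}(q-e^{2\pi m i/n})$ is the $n$-th cyclotomic polynomial. Congruences modulo $\Phi_n(q)$ are in the Laurent polynomial ring $\mathbb{Z}[q,q^{ -1}]$ (equivalently, both sides agree at every primitive $n$-th root of unity $q$). -}

module Defs where

open import Algebra.Bundles.Raw using (RawRing)
import Algebra.Definitions.RawMagma as RawMagmaDefinitions
import Algebra.Definitions.RawSemiring as RawSemiringDefinitions
open import Data.Fin.Base using (Fin; toℕ)
open import Data.Fin.Properties using (toℕ<n)
open import Data.Integer.Base as ℤ using (ℤ; +_; -[1+_]; 0ℤ; 1ℤ)
open import Data.List.Base as List using (List; []; _∷_; allFin; filter; foldr; length)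
open import Data.Nat.Base as ℕ using (ℕ; zero; suc; _∸_)
open import Data.Nat.Divisibility using (_∣?_)
open import Data.Nat.Induction using (<-rec)
open import Data.Nat.Properties using (_≤?_)
import Data.Rational.Unnormalised.Base as ℚᵘ
open import Level using (0ℓ)
open import Relation.Binary.PropositionalEquality using (_≡_)
open import Relation.Nullary.Decidable using (yes; no)

module Polynomial where

  -- Coefficients are listed from the constant term upwards; trailing zeros
  -- are allowed and are disregarded by _≈_ below.
  Poly : Set
  Poly = List ℤ

  coeff : Poly → ℕ → ℤ
  coeff []      _       = 0ℤ
  coeff (a ∷ p) zero    = a
  coeff (a ∷ p) (suc i) = coeff p i

  scale : ℤ → Poly → Poly
  scale a = List.map (a ℤ.*_)

  add : Poly → Poly → Poly
  add []      g       = g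
  add (a ∷ p) []      = a ∷ p
  add (a ∷ p) (b ∷ g) = a ℤ.+ b ∷ add p g

  mul : Poly → Poly → Poly
  mul []      g = []
  mul (a ∷ p) g = add (scale a g) (0ℤ ∷ mul p g)

  ℤ[q] : RawRing 0ℓ 0ℓ
  ℤ[q] = record
    { Carrier = Poly
    ; _≈_     = λ p g → ∀ i → coeff p i ≡ coeff g i
    ; _+_     = add
    ; _*_     = mul
    ; -_      = List.map (λ a → ℤ.- a)
    ; 0#      = []
    ; 1#      = 1ℤ ∷ []
    }

  open RawRing ℤ[q] public hiding (Carrier)
  open RawSemiringDefinitions rawSemiring public using (_^_; product)

  infixl 6 _-_
  _-_ : Poly → Poly → Poly
  p - g = p + - g

  q : Poly
  q = 0ℤ ∷ 1ℤ ∷ []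

  -- Division in ascending powers of q, for a divisor with constant term
  -- c = ±1 (so that c is its own inverse).  The first `fuel` coefficients
  -- of the power series p / d are produced.
  divide : (fuel : ℕ) → Poly → Poly → Poly
  divide zero       p       d       = []
  divide (suc fuel) []      d       = []
  divide (suc fuel) (a ∷ p) []      = []
  divide (suc fuel) (a ∷ p) (c ∷ d) = b ∷ divide fuel (p - scale b d) (c ∷ d)
    where b = c ℤ.* a

  -- The exact quotient p / d, when d has constant term ±1 and divides p:
  -- the degree of the quotient is then below length p.
  infixl 7 _÷_
  _÷_ : Poly → Poly → Poly
  p ÷ d = divide (length p) p d

  -- (z ; q)ₙ
  pochhammer : Poly → ℕ → Poly
  pochhammer z n = product {n} (λ j → 1# - z * q ^ toℕ j)

  gaussian : ℕ → ℕ → Poly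
  gaussian n k with k ≤? n
  ... | yes _ = pochhammer q n ÷ (pochhammer q k * pochhammer q (n ∸ k))
  ... | no  _ = 0#

  bracket : ℕ → Poly
  bracket n = (1# - q ^ n) ÷ (1# - q)

  catalan : ℕ → Poly
  catalan n = gaussian (2 ℕ.* n) n ÷ bracket (n ℕ.+ 1)

  -- The value Fₙ(t) at an element t of ℤ[q].
  fibonacci : ℕ → Poly → Poly
  fibonacci 0             t = 0#
  fibonacci 1             t = 1#
  fibonacci (suc (suc n)) t = fibonacci (suc n) t + q ^ n * t * fibonacci n t

  -- In the absence of ℂ, the cyclotomic polynomials (n > 0) are built over ℤ:
  -- sorting the n-th roots of unity by their exact order d gives
  -- qⁿ - 1 = ∏_{d ∣ n} Φ_d, that is, Φₙ = (qⁿ - 1) / ∏_{d ∣ n, d < n} Φ_d.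
  -- All constant terms are ±1.  Note that 0 ∣ n fails for n > 0.
  Φ : ℕ → Poly
  Φ = <-rec (λ _ → Poly) λ n Φ<n →
    (q ^ n - 1#) ÷
    foldr _*_ 1#
      (List.map (λ (d : Fin n) → Φ<n (toℕ<n d))
                (filter (λ d → toℕ d ∣? n) (allFin n)))

open Polynomial public using (Poly; q; catalan; fibonacci; Φ)
private module P = Polynomial

-- ℤ[q, q⁻¹] as the localisation of ℤ[q] at q: p /q^ s is q⁻ˢ p.  As q is not
-- a zero divisor, equality of fractions is equality after cross-multiplying.
infix 5 _/q^_
record Laurent : Set where
  constructor _/q^_
  field
    numerator : Poly
    shift     : ℕ

ℤ[q,q⁻¹] : RawRing 0ℓ 0ℓ
ℤ[q,q⁻¹] = record
  { Carrier = Laurent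
  ; _≈_     = λ { (p /q^ s) (g /q^ t) → p P.* q P.^ t P.≈ g P.* q P.^ s }
  ; _+_     = λ { (p /q^ s) (g /q^ t) → p P.* q P.^ t P.+ g P.* q P.^ s /q^ s ℕ.+ t }
  ; _*_     = λ { (p /q^ s) (g /q^ t) → p P.* g /q^ s ℕ.+ t }
  ; -_      = λ { (p /q^ s) → P.- p /q^ s }
  ; 0#      = P.0# /q^ 0
  ; 1#      = P.1# /q^ 0
  }

open RawRing ℤ[q,q⁻¹] public hiding (Carrier)
open RawSemiringDefinitions rawSemiring public using (_^_; sum)
open RawMagmaDefinitions *-rawMagma public using (_∣_)

infixl 6 _-_
_-_ : Laurent → Laurent → Laurent
x - y = x + - y

ι : Poly → Laurent
ι p = p /q^ 0

q^_ : ℤ → Laurent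
q^ (+ n)    = ι (q P.^ n)
q^ -[1+ n ] = P.1# /q^ suc n

infix 4 _≡_[modΦ_]
_≡_[modΦ_] : Laurent → Laurent → ℕ → Set
x ≡ y [modΦ n ] = ι (Φ n) ∣ x - y

r : ℕ → ℕ
r n = ℤ.∣ ℚᵘ.floor ((+ n ℚᵘ./ 5) ℚᵘ.+ ℚᵘ.½) ∣

-- Modulo Φₙ the relation qⁿ = 1 turns 1 - qʲ into - qʲ (1 - qⁿ⁻ʲ), so the Gaussian coefficient
-- of n - 1 - k over k is (-1)ᵏ q^(-k² - k(k+1)/2) times that of 2k over k, and similarly for n - k
-- over k + 1.  Hence the two halves of C_k = [2k, k] - q [2k, k + 1] sum to the expansions of
-- F_n(q) and F_{n+2}(1) into powers of t; the k = n - 1 term and the constant term of F_{n+2}(1)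
-- account for the - 2.
--
-- The closed form comes from Schur's expressions of F_N(q) and F_{N+1}(1) as alternating sums
-- Σ_b [N, b] (V(N - 2b) + V(N - 2b - 1)), where V(x) = - qˣ⁻² V(x - 5): modulo Φₙ only the terms
-- b = 0 and b = N survive when N = n, and N = n + 1 reduces to this by one Pascal step.
--
-- Both arguments need only that qⁿ = 1 and that 1 - qᵏ (0 < k < n) is not a zero divisor modulo
-- Φₙ.  The latter is proved by induction on n together with qⁿ - 1 = ∏_{d ∣ n} Φ_d: if qᵏ fixes z
-- modulo Φₙ, then so does q^g for g = gcd(k, n), hence Φₙ, a divisor of (qⁿ - 1) / (q^g - 1), divides
-- (n / g) z; and the constant term of Φₙ is ±1, so the integer n / g can be cancelled.
module Submission where

open import Algebra.Bundles using (CommutativeRing)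
open import Data.Empty using (⊥-elim)
open import Data.Fin.Base using (Fin; toℕ; fromℕ; inject₁) renaming (zero to fzero; suc to fsuc)
open import Data.Fin.Properties using (toℕ<n; toℕ-inject₁; toℕ-fromℕ; toℕ-fromℕ<)
open import Data.Integer.Base as ℤ using (ℤ; +_; -[1+_]; 0ℤ; 1ℤ; -1ℤ)
import Data.Integer.DivMod as ℤ
import Data.Integer.Properties as ℤ
import Data.Integer.Tactic.RingSolver as ℤSolver
open import Data.List.Base as List using (List; []; _∷_; length; _++_; foldr; filter; allFin)
open import Data.List.Membership.Propositional using (_∈_)
open import Data.List.Membership.Propositional.Properties using (∈-map⁺; ∈-filter⁺; ∈-allFin)
open import Data.List.Properties using (map-cong; map-∘)
open import Data.List.Relation.Unary.All as All using (All; []; _∷_)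
import Data.List.Relation.Unary.All.Properties as All
open import Data.List.Relation.Unary.AllPairs using (AllPairs; []; _∷_)
import Data.List.Relation.Unary.AllPairs.Properties as AllPairs
open import Data.List.Relation.Unary.Any using (here; there)
open import Data.Nat.Base as ℕ using (ℕ; zero; suc; _<_; _≤_; _%_; z≤n; s≤s; s≤s⁻¹; NonZero)
open import Data.Nat.Combinatorics using (_C_; nC1≡n; nCk+nC[k+1]≡[n+1]C[k+1])
import Data.Nat.DivMod as ℕ
import Data.Nat.Divisibility as ℕ
import Data.Nat.GCD as ℕ
open import Data.Nat.Induction using (<-rec; <-wellFounded)
import Data.Nat.Properties as ℕ
open import Data.Nat.Tactic.RingSolver using (solve-∀)
open import Data.Product.Base using (_×_; _,_; ∃₂; ∃-syntax)
open import Data.Sum.Base using (_⊎_; inj₁; inj₂; [_,_]′)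
open import Function.Base using (_∘_)
open import Induction.WellFounded using (module FixPoint)
open import Level using (0ℓ; _⊔_)
open import Relation.Binary.PropositionalEquality as ≡ using (_≡_; _≢_)
open import Relation.Nullary.Decidable using (yes; no)

import Defs as L
open L using (Poly; Laurent; _/q^_; Φ; catalan; fibonacci; ι; q^_; _≡_[modΦ_]; r; q; module Polynomial)
open Polynomial using (coeff; scale; divide; pochhammer; gaussian; bracket)
private module P = Polynomial

-- The obstacle is division. The argument does without the irreducibility of Φ_n, so ℤ[q]/(Φ_n) is
-- not known to be a domain and quotients of q-factorials have no meaning there. Gaussian
-- coefficients are therefore defined by Pascal's rule in an arbitrary commutative ring, and product
-- formulas occur only multiplied out. The decisive cancellations are of polynomials with constant
-- term ±1 in ℤ[q], and of factors 1 - q^k with 0 < k < n modulo Φ_n. The identities are proved for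
-- an abstract ring with a marked element q. Gaussian coefficients are then used twice, in ℤ[q] to
-- identify the q-Catalan numbers and in ℤ[q]/(Φ_n) for the congruences; both rings have the same
-- carrier, so values transfer literally. Laurent polynomials enter only at the end: q has the
-- inverse q^(n-1) modulo Φ_n, so a congruence in ℤ[q, q⁻¹] follows by evaluating both sides in
-- ℤ[q]/(Φ_n).

module IntegerSolver {c ℓ} (R : CommutativeRing c ℓ) where

  open CommutativeRing R hiding (zero)
  open import Algebra.Properties.Ring ring
    using (-‿distribˡ-*; -‿distribʳ-*; -‿involutive; -0#≈0#)
  open import Algebra.Properties.AbelianGroup +-abelianGroup using (⁻¹-∙-comm)
  open import Algebra.Properties.Semiring.Mult.TCOptimised semiring
    using (×-homo-+; ×1-homo-*; 1+×) renaming (_×_ to _⋅_)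
  open import Algebra.Properties.CommutativeSemigroup +-commutativeSemigroup using (interchange)
  open import Algebra.Solver.Ring.AlmostCommutativeRing
    using (_-Raw-AlmostCommutative⟶_; fromCommutativeRing)
  open import Relation.Binary.Reasoning.Setoid setoid
  open import Data.Maybe.Base using (just; nothing)
  open import Relation.Binary.Definitions using (WeaklyDecidable)

  -- The canonical homomorphism from ℤ. Integer coefficients have decidable equality, so identities
  -- with subtraction can be normalised in every commutative ring, including a quotient whose own
  -- equality is not decided.
  ⟦_⟧ : ℤ → Carrier
  ⟦ + n ⟧      = n ⋅ 1#
  ⟦ -[1+ n ] ⟧ = - (suc n ⋅ 1#)

  ⟦⟧-homo-⊖ : ∀ m n → ⟦ m ℤ.⊖ n ⟧ ≈ m ⋅ 1# - n ⋅ 1#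
  ⟦⟧-homo-⊖ zero    zero    = sym (-‿inverseʳ _)
  ⟦⟧-homo-⊖ zero    (suc n) = sym (+-identityˡ _)
  ⟦⟧-homo-⊖ (suc m) zero    = sym (trans (+-congˡ -0#≈0#) (+-identityʳ _))
  ⟦⟧-homo-⊖ (suc m) (suc n) = begin
    ⟦ suc m ℤ.⊖ suc n ⟧                      ≡⟨ ≡.cong ⟦_⟧ (ℤ.[1+m]⊖[1+n]≡m⊖n m n) ⟩
    ⟦ m ℤ.⊖ n ⟧                              ≈⟨ ⟦⟧-homo-⊖ m n ⟩
    m ⋅ 1# - n ⋅ 1#                          ≈⟨ +-identityˡ _ ⟨
    0# + (m ⋅ 1# - n ⋅ 1#)                   ≈⟨ +-congʳ (-‿inverseʳ 1#) ⟨
    (1# - 1#) + (m ⋅ 1# - n ⋅ 1#)            ≈⟨ interchange _ _ _ _ ⟩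
    (1# + m ⋅ 1#) + (- 1# + - (n ⋅ 1#))      ≈⟨ +-congˡ (⁻¹-∙-comm _ _) ⟩
    (1# + m ⋅ 1#) - (1# + n ⋅ 1#)            ≈⟨ +-cong (1+× m 1#) (-‿cong (1+× n 1#)) ⟨
    suc m ⋅ 1# - suc n ⋅ 1#                  ∎

  ⟦⟧-homo-neg : ∀ x → ⟦ ℤ.- x ⟧ ≈ - ⟦ x ⟧
  ⟦⟧-homo-neg (+ zero)  = sym -0#≈0#
  ⟦⟧-homo-neg (+ suc n) = refl
  ⟦⟧-homo-neg -[1+ n ]  = sym (-‿involutive _)

  ⟦⟧-homo-+ : ∀ x y → ⟦ x ℤ.+ y ⟧ ≈ ⟦ x ⟧ + ⟦ y ⟧
  ⟦⟧-homo-+ (+ m)    (+ n)    = ×-homo-+ 1# m n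
  ⟦⟧-homo-+ (+ m)    -[1+ n ] = ⟦⟧-homo-⊖ m (suc n)
  ⟦⟧-homo-+ -[1+ m ] (+ n)    = trans (⟦⟧-homo-⊖ n (suc m)) (+-comm _ _)
  ⟦⟧-homo-+ -[1+ m ] -[1+ n ] = begin
    - (suc (suc (m ℕ.+ n)) ⋅ 1#)         ≡⟨ ≡.cong (λ k → - (k ⋅ 1#)) (ℕ.+-suc (suc m) n) ⟨
    - ((suc m ℕ.+ suc n) ⋅ 1#)           ≈⟨ -‿cong (×-homo-+ 1# (suc m) (suc n)) ⟩
    - (suc m ⋅ 1# + suc n ⋅ 1#)          ≈⟨ ⁻¹-∙-comm _ _ ⟨
    - (suc m ⋅ 1#) - suc n ⋅ 1#          ∎

  ⟦⟧-homo-*-pos : ∀ m y → ⟦ + m ℤ.* y ⟧ ≈ m ⋅ 1# * ⟦ y ⟧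
  ⟦⟧-homo-*-pos m (+ n)    = trans (reflexive (≡.cong ⟦_⟧ (≡.sym (ℤ.pos-* m n)))) (×1-homo-* m n)
  ⟦⟧-homo-*-pos m -[1+ n ] = begin
    ⟦ + m ℤ.* -[1+ n ] ⟧      ≡⟨ ≡.cong ⟦_⟧ (ℤ.neg-distribʳ-* (+ m) (+ suc n)) ⟨
    ⟦ ℤ.- (+ m ℤ.* + suc n) ⟧ ≈⟨ ⟦⟧-homo-neg (+ m ℤ.* + suc n) ⟩
    - ⟦ + m ℤ.* + suc n ⟧     ≈⟨ -‿cong (⟦⟧-homo-*-pos m (+ suc n)) ⟩
    - (m ⋅ 1# * suc n ⋅ 1#)   ≈⟨ -‿distribʳ-* _ _ ⟩
    m ⋅ 1# * - (suc n ⋅ 1#)   ∎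

  ⟦⟧-homo-* : ∀ x y → ⟦ x ℤ.* y ⟧ ≈ ⟦ x ⟧ * ⟦ y ⟧
  ⟦⟧-homo-* (+ m)    y = ⟦⟧-homo-*-pos m y
  ⟦⟧-homo-* -[1+ m ] y = begin
    ⟦ -[1+ m ] ℤ.* y ⟧       ≡⟨ ≡.cong ⟦_⟧ (ℤ.neg-distribˡ-* (+ suc m) y) ⟨
    ⟦ ℤ.- (+ suc m ℤ.* y) ⟧  ≈⟨ ⟦⟧-homo-neg (+ suc m ℤ.* y) ⟩
    - ⟦ + suc m ℤ.* y ⟧      ≈⟨ -‿cong (⟦⟧-homo-*-pos (suc m) y) ⟩
    - (suc m ⋅ 1# * ⟦ y ⟧)   ≈⟨ -‿distribˡ-* _ _ ⟩
    - (suc m ⋅ 1#) * ⟦ y ⟧   ∎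

  morphism : ℤ.+-*-rawRing -Raw-AlmostCommutative⟶ fromCommutativeRing R
  morphism = record
    { ⟦_⟧    = ⟦_⟧
    ; +-homo = ⟦⟧-homo-+
    ; *-homo = ⟦⟧-homo-*
    ; -‿homo = ⟦⟧-homo-neg
    ; 0-homo = refl
    ; 1-homo = refl
    }

  ⟦⟧-weaklyDecidable : WeaklyDecidable (λ x y → ⟦ x ⟧ ≈ ⟦ y ⟧)
  ⟦⟧-weaklyDecidable x y with x ℤ.≟ y
  ... | yes x≡y = just (reflexive (≡.cong ⟦_⟧ x≡y))
  ... | no  _   = nothing

  open import Algebra.Solver.Ring ℤ.+-*-rawRing (fromCommutativeRing R) morphism ⟦⟧-weaklyDecidable public
    using (solve; _:=_; _:+_; _:*_; _:-_; :-_; con)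

-- Gaussian coefficients and weighted sums along a row

module QBinomial {c ℓ} (R : CommutativeRing c ℓ) (q : CommutativeRing.Carrier R) where

  open CommutativeRing R hiding (zero)
  open import Algebra.Properties.Semiring.Exp semiring using (_^_; ^-homo-*)
  open import Relation.Binary.Reasoning.Setoid setoid
  open IntegerSolver R

  -- In Pochhammer notation (q^(a+1); q)_k; thus `rising 0 k` is (q; q)_k.
  rising : ℕ → ℕ → Carrier
  rising a zero    = 1#
  rising a (suc k) = (1# - q ^ suc a) * rising (suc a) k

  rising-last : ∀ a k → rising a (suc k) ≈ rising a k * (1# - q ^ suc (a ℕ.+ k))
  rising-last a zero    = begin
    (1# - q ^ suc a) * 1#              ≈⟨ *-comm _ _ ⟩
    1# * (1# - q ^ suc a)              ≡⟨ ≡.cong (λ i → 1# * (1# - q ^ suc i)) (ℕ.+-identityʳ a) ⟨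
    1# * (1# - q ^ suc (a ℕ.+ 0))      ∎
  rising-last a (suc k) = begin
    (1# - q ^ suc a) * rising (suc a) (suc k)                               ≈⟨ *-congˡ (rising-last (suc a) k) ⟩
    (1# - q ^ suc a) * (rising (suc a) k * (1# - q ^ suc (suc a ℕ.+ k)))    ≈⟨ *-assoc _ _ _ ⟨
    rising a (suc k) * (1# - q ^ suc (suc a ℕ.+ k))                         ≡⟨ ≡.cong (λ i → rising a (suc k) * (1# - q ^ suc i)) (ℕ.+-suc a k) ⟨
    rising a (suc k) * (1# - q ^ suc (a ℕ.+ suc k))                         ∎

  rising-+ : ∀ a k → rising 0 a * rising a k ≈ rising 0 (a ℕ.+ k)
  rising-+ a zero    = trans (*-identityʳ _) (reflexive (≡.cong (rising 0) (≡.sym (ℕ.+-identityʳ a))))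
  rising-+ a (suc k) = begin
    rising 0 a * rising a (suc k)                              ≈⟨ *-congˡ (rising-last a k) ⟩
    rising 0 a * (rising a k * (1# - q ^ suc (a ℕ.+ k)))       ≈⟨ *-assoc _ _ _ ⟨
    rising 0 a * rising a k * (1# - q ^ suc (a ℕ.+ k))         ≈⟨ *-congʳ (rising-+ a k) ⟩
    rising 0 (a ℕ.+ k) * (1# - q ^ suc (a ℕ.+ k))              ≈⟨ rising-last 0 (a ℕ.+ k) ⟨
    rising 0 (suc (a ℕ.+ k))                                   ≡⟨ ≡.cong (rising 0) (ℕ.+-suc a k) ⟨
    rising 0 (a ℕ.+ suc k)                                     ∎

  -- binom a k is the Gaussian coefficient of a + k over k.
  binom : ℕ → ℕ → Carrier
  binom a       zero    = 1#
  binom zero    (suc k) = 1#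
  binom (suc a) (suc k) = binom a (suc k) + q ^ suc a * binom (suc a) k

  -- The Gaussian coefficient of 2k over k + 1.
  nextBinom : ℕ → Carrier
  nextBinom zero    = 0#
  nextBinom (suc k) = binom k (2 ℕ.+ k)

  binom-zeroˡ : ∀ k → binom 0 k ≈ 1#
  binom-zeroˡ zero    = refl
  binom-zeroˡ (suc k) = refl

  -- The product formula is multiplied out because (q; q)_k need not be invertible. In the induction
  -- both terms of Pascal's rule become multiples of `rising (suc a) k`, with coefficients 1 - x and
  -- x (1 - y) that add up to 1 - x y, where x = q^(a+1) and y = q^(k+1).
  binom-rising : ∀ a k → binom a k * rising 0 k ≈ rising a k
  binom-rising a       zero    = *-identityʳ _
  binom-rising zero    (suc k) = *-identityˡ _
  binom-rising (suc a) (suc k) = begin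
    (binom a (suc k) + q ^ suc a * binom (suc a) k) * rising 0 (suc k)
      ≈⟨ distribʳ _ _ _ ⟩
    binom a (suc k) * rising 0 (suc k) + q ^ suc a * binom (suc a) k * rising 0 (suc k)
      ≈⟨ +-cong (binom-rising a (suc k)) (*-congˡ (rising-last 0 k)) ⟩
    (1# - q ^ suc a) * rising (suc a) k + q ^ suc a * binom (suc a) k * (rising 0 k * (1# - q ^ suc k))
      ≈⟨ solve 5 (λ x y b r s → (con (+ 1) :- x) :* s :+ x :* b :* (r :* (con (+ 1) :- y))
                             := (con (+ 1) :- x) :* s :+ x :* (con (+ 1) :- y) :* (b :* r))
               refl (q ^ suc a) (q ^ suc k) (binom (suc a) k) (rising 0 k) (rising (suc a) k) ⟩
    (1# - q ^ suc a) * rising (suc a) k + q ^ suc a * (1# - q ^ suc k) * (binom (suc a) k * rising 0 k)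
      ≈⟨ +-congˡ (*-congˡ (binom-rising (suc a) k)) ⟩
    (1# - q ^ suc a) * rising (suc a) k + q ^ suc a * (1# - q ^ suc k) * rising (suc a) k
      ≈⟨ solve 3 (λ x y s → (con (+ 1) :- x) :* s :+ x :* (con (+ 1) :- y) :* s := s :* (con (+ 1) :- x :* y))
               refl (q ^ suc a) (q ^ suc k) (rising (suc a) k) ⟩
    rising (suc a) k * (1# - q ^ suc a * q ^ suc k)
      ≈⟨ *-congˡ (+-congˡ (-‿cong (^-homo-* q (suc a) (suc k)))) ⟨
    rising (suc a) k * (1# - q ^ (suc a ℕ.+ suc k))
      ≡⟨ ≡.cong (λ i → rising (suc a) k * (1# - q ^ i)) (≡.cong suc (ℕ.+-suc a k)) ⟩
    rising (suc a) k * (1# - q ^ suc (suc a ℕ.+ k))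
      ≈⟨ rising-last (suc a) k ⟨
    rising (suc a) (suc k) ∎

  -- Formally both sides are (q; q)_N / ((q; q)_k (q; q)_a) with N = a + k + 1. Since (q; q)_k
  -- cannot be cancelled in a general ring, the proof is an induction on Pascal's rule and does not
  -- go through `binom-rising`.
  binom-absorb : ∀ a k → (1# - q ^ suc k) * binom a (suc k) ≈ (1# - q ^ suc a) * binom (suc a) k
  binom-absorb zero    zero    = refl
  binom-absorb zero    (suc k) = begin
    (1# - q * q ^ suc k) * 1#
      ≈⟨ solve 2 (λ x y → (con (+ 1) :- x :* y) :* con (+ 1) := (con (+ 1) :- x) :+ x :* ((con (+ 1) :- y) :* con (+ 1))) refl q (q ^ suc k) ⟩
    (1# - q) + q * ((1# - q ^ suc k) * 1#)
      ≈⟨ +-congˡ (*-congˡ (binom-absorb zero k)) ⟩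
    (1# - q) + q * ((1# - q ^ 1) * binom 1 k)
      ≈⟨ solve 2 (λ x b → (con (+ 1) :- x) :+ x :* ((con (+ 1) :- x :* con (+ 1)) :* b)
                       := (con (+ 1) :- x :* con (+ 1)) :* (con (+ 1) :+ x :* con (+ 1) :* b)) refl q (binom 1 k) ⟩
    (1# - q ^ 1) * (1# + q ^ 1 * binom 1 k) ∎
  binom-absorb (suc a) zero    = begin
    (1# - q ^ 1) * (binom a 1 + q ^ suc a * 1#)
      ≈⟨ distribˡ _ _ _ ⟩
    (1# - q ^ 1) * binom a 1 + (1# - q ^ 1) * (q ^ suc a * 1#)
      ≈⟨ +-congʳ (binom-absorb a zero) ⟩
    (1# - q ^ suc a) * 1# + (1# - q ^ 1) * (q ^ suc a * 1#)
      ≈⟨ solve 2 (λ x y → (con (+ 1) :- y) :* con (+ 1) :+ (con (+ 1) :- x :* con (+ 1)) :* (y :* con (+ 1))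
                       := (con (+ 1) :- x :* y) :* con (+ 1)) refl q (q ^ suc a) ⟩
    (1# - q ^ suc (suc a)) * 1# ∎
  binom-absorb (suc a) (suc k) = begin
    (1# - q * Y) * (B + X * B₂)
      ≈⟨ solve 5 (λ x y z b c → (con (+ 1) :- x :* y) :* (b :+ z :* c)
                       := (con (+ 1) :- x :* y) :* b :+ z :* (con (+ 1) :- x :* y) :* c) refl q Y X B B₂ ⟩
    (1# - q * Y) * B + X * (1# - q * Y) * B₂
      ≈⟨ +-congʳ (binom-absorb a (suc k)) ⟩
    (1# - X) * B₂ + X * (1# - q * Y) * B₂
      ≈⟨ solve 4 (λ x y z b → (con (+ 1) :- z) :* b :+ z :* (con (+ 1) :- x :* y) :* b
                         := (con (+ 1) :- x :* z) :* b :+ x :* z :* ((con (+ 1) :- y) :* b)) refl q Y X B₂ ⟩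
    (1# - q * X) * B₂ + q * X * ((1# - Y) * B₂)
      ≈⟨ +-congˡ (*-congˡ (binom-absorb (suc a) k)) ⟩
    (1# - q * X) * B₂ + q * X * ((1# - q * X) * B₃)
      ≈⟨ solve 4 (λ x z b c → (con (+ 1) :- x :* z) :* b :+ x :* z :* ((con (+ 1) :- x :* z) :* c)
                         := (con (+ 1) :- x :* z) :* (b :+ x :* z :* c)) refl q X B₂ B₃ ⟩
    (1# - q * X) * (B₂ + q * X * B₃) ∎
    where
    X  = q ^ suc a
    Y  = q ^ suc k
    B  = binom a (suc (suc k))
    B₂ = binom (suc a) (suc k)
    B₃ = binom (suc (suc a)) k

  -- The two Pascal rules differ by (1 - Y) x - (1 - X) y, which absorption makes zero.
  binom-pascal : ∀ a k → binom (suc a) (suc k) ≈ binom (suc a) k + q ^ suc k * binom a (suc k)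
  binom-pascal a k = begin
    x + X * y                              ≈⟨ solve 4 (λ x y X Y → x :+ X :* y := (con (+ 1) :- Y) :* x :+ (Y :* x :+ X :* y)) refl x y X Y ⟩
    (1# - Y) * x + (Y * x + X * y)         ≈⟨ +-congʳ (binom-absorb a k) ⟩
    (1# - X) * y + (Y * x + X * y)         ≈⟨ solve 4 (λ x y X Y → (con (+ 1) :- X) :* y :+ (Y :* x :+ X :* y) := y :+ Y :* x) refl x y X Y ⟩
    y + Y * x                              ∎
    where
    x = binom a (suc k)
    y = binom (suc a) k
    X = q ^ suc a
    Y = q ^ suc k

  binom-sym : ∀ a k → binom a k ≈ binom k a
  binom-sym zero    k       = binom-zeroˡ k
  binom-sym (suc a) zero    = refl
  binom-sym (suc a) (suc k) = begin
    binom (suc a) (suc k)                            ≈⟨ binom-pascal a k ⟩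
    binom (suc a) k + q ^ suc k * binom a (suc k)    ≈⟨ +-cong (binom-sym (suc a) k) (*-congˡ (binom-sym a (suc k))) ⟩
    binom k (suc a) + q ^ suc k * binom (suc k) a    ∎

  antidiagonal : ℕ → (ℕ → ℕ → Carrier) → Carrier
  antidiagonal zero    f = f 0 0
  antidiagonal (suc N) f = f (suc N) 0 + antidiagonal N (λ a b → f a (suc b))

  antidiagonal-cong : ∀ N {f g} → (∀ a b → a ℕ.+ b ≡ N → f a b ≈ g a b) →
                      antidiagonal N f ≈ antidiagonal N g
  antidiagonal-cong zero    f≈g = f≈g 0 0 ≡.refl
  antidiagonal-cong (suc N) f≈g = +-cong (f≈g (suc N) 0 (ℕ.+-identityʳ _))
    (antidiagonal-cong N (λ a b a+b≡N → f≈g a (suc b) (≡.trans (ℕ.+-suc a b) (≡.cong suc a+b≡N))))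

  antidiagonal-+ : ∀ N f g → antidiagonal N (λ a b → f a b + g a b) ≈ antidiagonal N f + antidiagonal N g
  antidiagonal-+ zero    f g = refl
  antidiagonal-+ (suc N) f g = trans (+-congˡ (antidiagonal-+ N _ _))
    (solve 4 (λ x y z w → x :+ y :+ (z :+ w) := x :+ z :+ (y :+ w)) refl _ _ _ _)

  antidiagonal-* : ∀ N x f → antidiagonal N (λ a b → x * f a b) ≈ x * antidiagonal N f
  antidiagonal-* zero    x f = refl
  antidiagonal-* (suc N) x f = trans (+-congˡ (antidiagonal-* N x _)) (sym (distribˡ _ _ _))

  antidiagonal-last : ∀ N f → antidiagonal (suc N) f ≈ antidiagonal N (λ a b → f (suc a) b) + f 0 (suc N)
  antidiagonal-last zero    f = refl
  antidiagonal-last (suc N) f = trans (+-congˡ (antidiagonal-last N (λ a b → f a (suc b)))) (sym (+-assoc _ _ _))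

  binomialSum : ℕ → (ℕ → ℕ → Carrier) → Carrier
  binomialSum N f = antidiagonal N (λ a b → binom a b * f a b)

  binomialSum-cong : ∀ N {f g} → (∀ a b → a ℕ.+ b ≡ N → f a b ≈ g a b) → binomialSum N f ≈ binomialSum N g
  binomialSum-cong N f≈g = antidiagonal-cong N (λ a b eq → *-congˡ (f≈g a b eq))

  binomialSum-+ : ∀ N f g → binomialSum N (λ a b → f a b + g a b) ≈ binomialSum N f + binomialSum N g
  binomialSum-+ N f g = trans (antidiagonal-cong N (λ _ _ _ → distribˡ _ _ _)) (antidiagonal-+ N _ _)

  binomialSum-* : ∀ N x f → binomialSum N (λ a b → x * f a b) ≈ x * binomialSum N f
  binomialSum-* N x f = trans
    (antidiagonal-cong N (λ _ _ _ → solve 3 (λ b x f → b :* (x :* f) := x :* (b :* f)) refl _ _ _))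
    (antidiagonal-* N x _)

  -- Both Pascal rules have this shape, with (q^a, 1) or (1, q^b) as the pair of factors. At the
  -- ends of a row the coefficient is 1 and only one of the two terms exists, whence the condition
  -- that `x` and `y` are 1 at 0.
  binomialSum-step : ∀ (x y : ℕ → Carrier) → x 0 ≈ 1# → y 0 ≈ 1# →
    (∀ a k → binom (suc a) (suc k) ≈ x (suc a) * binom (suc a) k + y (suc k) * binom a (suc k)) →
    ∀ N f → binomialSum (suc N) f ≈ binomialSum N (λ a b → x a * f a (suc b) + y b * f (suc a) b)
  binomialSum-step x y x₀ y₀ pascal N f = begin
    binomialSum (suc N) f
      ≈⟨ antidiagonal-cong (suc N) split ⟩
    antidiagonal (suc N) (λ a b → u a b + v a b)
      ≈⟨ antidiagonal-+ (suc N) u v ⟩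
    0# + antidiagonal N (λ a b → u a (suc b)) + antidiagonal (suc N) v
      ≈⟨ +-cong (+-identityˡ _) (trans (antidiagonal-last N v) (+-identityʳ _)) ⟩
    antidiagonal N (λ a b → u a (suc b)) + antidiagonal N (λ a b → v (suc a) b)
      ≈⟨ antidiagonal-+ N _ _ ⟨
    antidiagonal N (λ a b → x a * binom a b * f a (suc b) + y b * binom a b * f (suc a) b)
      ≈⟨ antidiagonal-cong N (λ _ _ _ →
           solve 5 (λ x y b f g → x :* b :* f :+ y :* b :* g := b :* (x :* f :+ y :* g)) refl _ _ _ _ _) ⟩
    binomialSum N (λ a b → x a * f a (suc b) + y b * f (suc a) b) ∎
    where
    -- The two Pascal terms of each summand; the zero clauses stand for the term that falls outside
    -- the row.
    u v : ℕ → ℕ → Carrier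
    u a zero    = 0#
    u a (suc b) = x a * binom a b * f a (suc b)
    v zero    b = 0#
    v (suc a) b = y b * binom a b * f (suc a) b
    split : ∀ a b → a ℕ.+ b ≡ suc N → binom a b * f a b ≈ u a b + v a b
    split zero    (suc b) _ = begin
      1# * f 0 (suc b)                          ≈⟨ *-congʳ (trans (*-cong x₀ (binom-zeroˡ b)) (*-identityˡ _)) ⟨
      x 0 * binom 0 b * f 0 (suc b)             ≈⟨ +-identityʳ _ ⟨
      x 0 * binom 0 b * f 0 (suc b) + 0#        ∎
    split (suc a) zero    _ = begin
      1# * f (suc a) 0                          ≈⟨ *-congʳ (trans (*-congʳ y₀) (*-identityˡ _)) ⟨
      y 0 * 1# * f (suc a) 0                    ≈⟨ +-identityˡ _ ⟨
      0# + y 0 * 1# * f (suc a) 0               ∎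
    split (suc a) (suc b) _ = trans (*-congʳ (pascal a b)) (distribʳ _ _ _)

  binomialSum-stepˡ : ∀ N f → binomialSum (suc N) f ≈ binomialSum N (λ a b → f (suc a) b + q ^ a * f a (suc b))
  binomialSum-stepˡ N f = trans
    (binomialSum-step (q ^_) (λ _ → 1#) refl refl
      (λ a k → trans (+-comm _ _) (+-congˡ (sym (*-identityˡ _)))) N f)
    (binomialSum-cong N (λ _ _ _ → trans (+-comm _ _) (+-congʳ (*-identityˡ _))))

  binomialSum-stepʳ : ∀ N f → binomialSum (suc N) f ≈ binomialSum N (λ a b → f a (suc b) + q ^ b * f (suc a) b)
  binomialSum-stepʳ N f = trans
    (binomialSum-step (λ _ → 1#) (q ^_) refl refl
      (λ a k → trans (binom-pascal a k) (+-congʳ (sym (*-identityˡ _)))) N f)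
    (binomialSum-cong N (λ _ _ _ → +-congʳ (*-identityˡ _)))

-- q-Fibonacci polynomials and Schur's alternating sums

module QFibonacci {c ℓ} (R : CommutativeRing c ℓ) (q : CommutativeRing.Carrier R) where

  open CommutativeRing R hiding (zero)
  open import Algebra.Properties.Semiring.Exp semiring using (_^_; ^-homo-*)
  open import Algebra.Properties.Semiring.Sum semiring
    using (sum; sum-cong-≋; sum-replicate-zero; ∑-distrib-+; *-distribˡ-sum)
  open import Relation.Binary.Reasoning.Setoid setoid
  open IntegerSolver R
  open QBinomial R q

  fib : ℕ → Carrier → Carrier
  fib 0             t = 0#
  fib 1             t = 1#
  fib (suc (suc n)) t = fib (suc n) t + q ^ n * t * fib n t

  fibCoeff : ℕ → ℕ → Carrier
  fibCoeff zero          k       = 0#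
  fibCoeff (suc n)       zero    = 1#
  fibCoeff 1             (suc k) = 0#
  fibCoeff (suc (suc n)) (suc k) = fibCoeff (suc n) (suc k) + q ^ n * fibCoeff n k

  -- The degree of F_n in t is at most (n - 1)/2, so K coefficients suffice once n ≤ 2K. A larger K
  -- only adds zeros, which lets the sum run over all k < n, the range of the Catalan sum.
  fib-sum : ∀ n K t → n ≤ K ℕ.+ K → fib n t ≈ sum {K} (λ k → t ^ toℕ k * fibCoeff n (toℕ k))
  fib-sum zero          K       t _ = sym (trans (sum-cong-≋ {K} (λ k → zeroʳ (t ^ toℕ k))) (sum-replicate-zero K))
  fib-sum (suc n)       zero    t ()
  fib-sum 1             (suc K) t _ = sym (begin
    1# * 1# + sum {K} (λ k → t ^ suc (toℕ k) * 0#)   ≈⟨ +-cong (*-identityˡ 1#) (sum-cong-≋ {K} (λ k → zeroʳ (t ^ suc (toℕ k)))) ⟩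
    1# + sum {K} (λ _ → 0#)                          ≈⟨ +-congˡ (sum-replicate-zero K) ⟩
    1# + 0#                                          ≈⟨ +-identityʳ 1# ⟩
    1#                                               ∎)
  fib-sum (suc (suc n)) (suc K) t n+2≤ = begin
    fib (suc n) t + q ^ n * t * fib n t
      ≈⟨ +-cong (fib-sum (suc n) (suc K) t (ℕ.≤-trans (ℕ.n≤1+n _) n+2≤)) (*-congˡ (fib-sum n K t n≤)) ⟩
    (1# * 1# + sum {K} f) + q ^ n * t * sum {K} (λ k → t ^ toℕ k * fibCoeff n (toℕ k))
      ≈⟨ +-congˡ (*-distribˡ-sum {K} _ _) ⟩
    (1# * 1# + sum {K} f) + sum {K} g
      ≈⟨ +-assoc _ _ _ ⟩
    1# * 1# + (sum {K} f + sum {K} g)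
      ≈⟨ +-congˡ (∑-distrib-+ {K} f g) ⟨
    1# * 1# + sum {K} (λ k → f k + g k)
      ≈⟨ +-congˡ (sum-cong-≋ {K} (λ k →
           solve 5 (λ Q t x a b → t :* x :* a :+ Q :* t :* (x :* b) := t :* x :* (a :+ Q :* b)) refl
             (q ^ n) t (t ^ toℕ k) (fibCoeff (suc n) (suc (toℕ k))) (fibCoeff n (toℕ k)))) ⟩
    sum {suc K} (λ k → t ^ toℕ k * fibCoeff (suc (suc n)) (toℕ k)) ∎
    where
    n≤ : n ≤ K ℕ.+ K
    n≤ = s≤s⁻¹ (s≤s⁻¹ (ℕ.≤-trans n+2≤ (ℕ.≤-reflexive (≡.cong suc (ℕ.+-suc K K)))))
    f = λ k → t ^ suc (toℕ k) * fibCoeff (suc n) (suc (toℕ k))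
    g = λ k → q ^ n * t * (t ^ toℕ k * fibCoeff n (toℕ k))

  fibCoeff-zero : ∀ n k → n ≤ k ℕ.+ k → fibCoeff n k ≈ 0#
  fibCoeff-zero zero          k       _ = refl
  fibCoeff-zero (suc n)       zero    ()
  fibCoeff-zero 1             (suc k) _ = refl
  fibCoeff-zero (suc (suc n)) (suc k) n+2≤ = begin
    fibCoeff (suc n) (suc k) + q ^ n * fibCoeff n k
      ≈⟨ +-cong (fibCoeff-zero (suc n) (suc k) (ℕ.≤-trans (ℕ.n≤1+n _) n+2≤))
                (*-congˡ (fibCoeff-zero n k (s≤s⁻¹ (s≤s⁻¹ (ℕ.≤-trans n+2≤ (ℕ.≤-reflexive (≡.cong suc (ℕ.+-suc k k)))))))) ⟩
    0# + q ^ n * 0#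
      ≈⟨ trans (+-identityˡ _) (zeroʳ _) ⟩
    0# ∎

  -- With a = n - 1 - 2k this is the expansion of F_n into q^(k²) [n - 1 - k, k] t^k. In the step to
  -- n + 2 and k + 1 the recurrence becomes Pascal's rule, because n + k² = (k + 1)² + a.
  fibCoeff-binom : ∀ n a k → n ≡ suc (a ℕ.+ (k ℕ.+ k)) → fibCoeff n k ≈ q ^ (k ℕ.* k) * binom a k
  fibCoeff-binom (suc n)       a zero    _  = sym (*-identityˡ 1#)
  fibCoeff-binom 1             a (suc k) eq with ℕ.m+n≡0⇒n≡0 a (≡.sym (ℕ.suc-injective eq))
  ... | ()
  fibCoeff-binom (suc (suc n)) a (suc k) eq = begin
    fibCoeff (suc n) (suc k) + q ^ n * fibCoeff n k
      ≈⟨ +-cong (first a n≡) (*-congˡ (fibCoeff-binom n a k n≡)) ⟩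
    q ^ (suc k ℕ.* suc k) * pred a + q ^ n * (q ^ (k ℕ.* k) * binom a k)
      ≈⟨ +-congˡ (*-assoc _ _ _) ⟨
    q ^ (suc k ℕ.* suc k) * pred a + q ^ n * q ^ (k ℕ.* k) * binom a k
      ≈⟨ +-congˡ (*-congʳ exponents) ⟩
    q ^ (suc k ℕ.* suc k) * pred a + q ^ (suc k ℕ.* suc k) * q ^ a * binom a k
      ≈⟨ +-congˡ (*-assoc _ _ _) ⟩
    q ^ (suc k ℕ.* suc k) * pred a + q ^ (suc k ℕ.* suc k) * (q ^ a * binom a k)
      ≈⟨ distribˡ _ _ _ ⟨
    q ^ (suc k ℕ.* suc k) * (pred a + q ^ a * binom a k)
      ≈⟨ *-congˡ (pascal a) ⟩
    q ^ (suc k ℕ.* suc k) * binom a (suc k) ∎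
    where
    -- This is [a + k, k + 1]. It is zero at a = 0, where the coefficient of F_(n+1) vanishes for
    -- reasons of degree.
    pred : ℕ → Carrier
    pred zero    = 0#
    pred (suc a) = binom a (suc k)
    n≡ : n ≡ suc (a ℕ.+ (k ℕ.+ k))
    n≡ = ℕ.suc-injective (ℕ.suc-injective (≡.trans eq (lemma a k)))
      where
      lemma : ∀ a k → suc (a ℕ.+ (suc k ℕ.+ suc k)) ≡ suc (suc (suc (a ℕ.+ (k ℕ.+ k))))
      lemma = solve-∀
    first : ∀ a → n ≡ suc (a ℕ.+ (k ℕ.+ k)) → fibCoeff (suc n) (suc k) ≈ q ^ (suc k ℕ.* suc k) * pred a
    first zero    ≡.refl = trans (fibCoeff-zero (suc n) (suc k) (ℕ.≤-reflexive (≡.cong suc (≡.sym (ℕ.+-suc k k))))) (sym (zeroʳ _))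
    first (suc a) ≡.refl = fibCoeff-binom (suc n) a (suc k) (lemma a k)
      where
      lemma : ∀ a k → suc (suc (suc a ℕ.+ (k ℕ.+ k))) ≡ suc (a ℕ.+ (suc k ℕ.+ suc k))
      lemma = solve-∀
    pascal : ∀ a → pred a + q ^ a * binom a k ≈ binom a (suc k)
    pascal zero    = trans (+-identityˡ _) (trans (*-identityˡ _) (binom-zeroˡ k))
    pascal (suc a) = refl
    exponents : q ^ n * q ^ (k ℕ.* k) ≈ q ^ (suc k ℕ.* suc k) * q ^ a
    exponents = begin
      q ^ n * q ^ (k ℕ.* k)             ≈⟨ ^-homo-* q n (k ℕ.* k) ⟨
      q ^ (n ℕ.+ k ℕ.* k)               ≡⟨ ≡.cong (q ^_) (≡.trans (≡.cong (ℕ._+ k ℕ.* k) n≡) (lemma a k)) ⟩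
      q ^ (suc k ℕ.* suc k ℕ.+ a)       ≈⟨ ^-homo-* q (suc k ℕ.* suc k) a ⟩
      q ^ (suc k ℕ.* suc k) * q ^ a     ∎
      where
      lemma : ∀ a k → suc (a ℕ.+ (k ℕ.+ k)) ℕ.+ k ℕ.* k ≡ suc k ℕ.* suc k ℕ.+ a
      lemma = solve-∀

  -- V a b is the value at a - b of the function on ℤ given by p at a ≥ 0 and by u at -1 - b < 0.
  twoSided : (p u : ℕ → Carrier) → ℕ → ℕ → Carrier
  twoSided p u a       zero    = p a
  twoSided p u zero    (suc b) = u b
  twoSided p u (suc a) (suc b) = twoSided p u a b

  -- Schur's alternating sums: the weights V satisfy V(x) = - qˣ⁻² V(x - 5).
  module Schur (V : ℕ → ℕ → Carrier)
    (diagonal : ∀ a b → V (suc a) (suc b) ≈ V a b)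
    (shift    : ∀ a b → q ^ b * V (2 ℕ.+ a) b + q ^ a * V a (3 ℕ.+ b) ≈ 0#) where

    -- If V lives on the multiples of 5, then each 5j equals N - 2b or N - 2b - 1 for exactly one
    -- integer b, the floor of (N - 5j)/2. With V(5j) = (-1)^j q^(j(5j+1)/2) the sum below is thus
    -- Schur's sum of (-1)^j q^(j(5j+1)/2) [N, b], without floors.
    weight : ℕ → ℕ → Carrier
    weight a b = V a b + V a (suc b)

    schurSum : ℕ → Carrier
    schurSum N = binomialSum N weight

    -- The two Pascal rules are applied to V a b and V a (b + 1) separately, once in each order.
    schurSum-step : ∀ N → schurSum (2 ℕ.+ N) ≈ schurSum (suc N) + q ^ suc N * schurSum N
    schurSum-step N = begin
      schurSum (2 ℕ.+ N)
        ≈⟨ binomialSum-+ (2 ℕ.+ N) V V′ ⟩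
      binomialSum (2 ℕ.+ N) V + binomialSum (2 ℕ.+ N) V′
        ≈⟨ +-cong (trans (binomialSum-stepʳ (suc N) V) (binomialSum-+ (suc N) V′ X))
                  (trans (binomialSum-stepˡ (suc N) V′)
                  (trans (binomialSum-cong (suc N) {g = λ a b → V a b + Y a b} (λ a b _ → +-congʳ (diagonal a b))) (binomialSum-+ (suc N) V Y))) ⟩
      (S V′ + S X) + (S V + S Y)
        ≈⟨ solve 4 (λ x y z w → (x :+ y) :+ (z :+ w) := (z :+ x) :+ (y :+ w)) refl (S V′) (S X) (S V) (S Y) ⟩
      (S V + S V′) + (S X + S Y)
        ≈⟨ +-cong (binomialSum-+ (suc N) V V′)
             (+-cong (sym (binomialSum-stepˡ N X)) (sym (binomialSum-stepʳ N Y))) ⟨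
      schurSum (suc N) + (binomialSum N (λ a b → q ^ b * V (2 ℕ.+ a) b + q ^ a * (q ^ suc b * V (suc a) (suc b)))
                        + binomialSum N (λ a b → q ^ a * V a (3 ℕ.+ b) + q ^ b * (q ^ suc a * V (suc a) (2 ℕ.+ b))))
        ≈⟨ +-congˡ (binomialSum-+ N _ _) ⟨
      schurSum (suc N) + binomialSum N (λ a b →
          (q ^ b * V (2 ℕ.+ a) b + q ^ a * (q ^ suc b * V (suc a) (suc b)))
        + (q ^ a * V a (3 ℕ.+ b) + q ^ b * (q ^ suc a * V (suc a) (2 ℕ.+ b))))
        ≈⟨ +-congˡ (binomialSum-cong N cancel) ⟩
      schurSum (suc N) + binomialSum N (λ a b → q ^ suc N * weight a b)
        ≈⟨ +-congˡ (binomialSum-* N _ weight) ⟩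
      schurSum (suc N) + q ^ suc N * schurSum N ∎
      where
      S = binomialSum (suc N)
      V′ X Y : ℕ → ℕ → Carrier
      V′ a b = V a (suc b)
      X  a b = q ^ b * V (suc a) b
      Y  a b = q ^ a * V a (2 ℕ.+ b)
      cancel : ∀ a b → a ℕ.+ b ≡ N →
        (q ^ b * V (2 ℕ.+ a) b + q ^ a * (q ^ suc b * V (suc a) (suc b)))
        + (q ^ a * V a (3 ℕ.+ b) + q ^ b * (q ^ suc a * V (suc a) (2 ℕ.+ b)))
        ≈ q ^ suc N * weight a b
      cancel a b ≡.refl = begin
        (q ^ b * V (2 ℕ.+ a) b + q ^ a * (q * q ^ b * V (suc a) (suc b)))
        + (q ^ a * V a (3 ℕ.+ b) + q ^ b * (q * q ^ a * V (suc a) (2 ℕ.+ b)))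
          ≈⟨ +-cong (+-congˡ (*-congˡ (*-congˡ (diagonal a b)))) (+-congˡ (*-congˡ (*-congˡ (diagonal a (suc b))))) ⟩
        (q ^ b * V (2 ℕ.+ a) b + q ^ a * (q * q ^ b * V a b))
        + (q ^ a * V a (3 ℕ.+ b) + q ^ b * (q * q ^ a * V a (suc b)))
          ≈⟨ solve 7 (λ q A B x y v w → (B :* x :+ A :* (q :* B :* v)) :+ (A :* y :+ B :* (q :* A :* w))
                                     := (B :* x :+ A :* y) :+ q :* (A :* B) :* (v :+ w)) refl
               q (q ^ a) (q ^ b) (V (2 ℕ.+ a) b) (V a (3 ℕ.+ b)) (V a b) (V a (suc b)) ⟩
        (q ^ b * V (2 ℕ.+ a) b + q ^ a * V a (3 ℕ.+ b)) + q * (q ^ a * q ^ b) * weight a b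
          -- The outer pair, V(a - b + 2) and V(a - b - 3), cancels by the functional equation; the
          -- inner pair leaves q^(a+b+1) times the weight.
          ≈⟨ +-cong (shift a b) (*-congʳ (*-congˡ (sym (^-homo-* q a b)))) ⟩
        0# + q ^ suc (a ℕ.+ b) * weight a b
          ≈⟨ +-identityˡ _ ⟩
        q ^ suc (a ℕ.+ b) * weight a b ∎

  -- One recursion serves both sides of zero. At y = x + 5 the relation V(y) = - q^(y-2) V(y-5) has
  -- the factor - q^(x+3); solved for V(y-5) at y = - 1 - x it has the same factor. The five
  -- arguments are the free values, one for each residue class modulo 5.
  strand : (c₀ c₁ c₂ c₃ c₄ : Carrier) → ℕ → Carrier
  strand c₀ c₁ c₂ c₃ c₄ 0 = c₀
  strand c₀ c₁ c₂ c₃ c₄ 1 = c₁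
  strand c₀ c₁ c₂ c₃ c₄ 2 = c₂
  strand c₀ c₁ c₂ c₃ c₄ 3 = c₃
  strand c₀ c₁ c₂ c₃ c₄ 4 = c₄
  strand c₀ c₁ c₂ c₃ c₄ (suc (suc (suc (suc (suc x))))) = - (q ^ (3 ℕ.+ x) * strand c₀ c₁ c₂ c₃ c₄ x)

  strandExponent : ℕ → ℕ → ℕ
  strandExponent s zero    = 0
  strandExponent s (suc m) = strandExponent s m ℕ.+ (3 ℕ.+ (s ℕ.+ m ℕ.* 5))

  -- Doubling removes the fraction from the sum of 3 + s + 5j over j < m; for s = 0 these sums are
  -- the exponents m(5m + 1)/2 of Schur's formula.
  twice-strandExponent : ∀ s m → 2 ℕ.* strandExponent s m ≡ m ℕ.* (5 ℕ.* m ℕ.+ 1 ℕ.+ 2 ℕ.* s)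
  twice-strandExponent s zero    = ≡.refl
  twice-strandExponent s (suc m) = ≡.trans (ℕ.*-distribˡ-+ 2 (strandExponent s m) _)
    (≡.trans (≡.cong (ℕ._+ 2 ℕ.* (3 ℕ.+ (s ℕ.+ m ℕ.* 5))) (twice-strandExponent s m)) (lemma s m))
    where
    lemma : ∀ s m → m ℕ.* (5 ℕ.* m ℕ.+ 1 ℕ.+ 2 ℕ.* s) ℕ.+ 2 ℕ.* (3 ℕ.+ (s ℕ.+ m ℕ.* 5))
                  ≡ suc m ℕ.* (5 ℕ.* suc m ℕ.+ 1 ℕ.+ 2 ℕ.* s)
    lemma = solve-∀

  module _ {c₀ c₁ c₂ c₃ c₄ : Carrier} where

    private x = strand c₀ c₁ c₂ c₃ c₄

    strand-value : ∀ s m → x (s ℕ.+ m ℕ.* 5) ≈ (- 1#) ^ m * (q ^ strandExponent s m * x s)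
    strand-value s zero    = begin
      x (s ℕ.+ 0)        ≡⟨ ≡.cong x (ℕ.+-identityʳ s) ⟩
      x s                ≈⟨ *-identityˡ _ ⟨
      1# * x s           ≈⟨ *-identityˡ _ ⟨
      1# * (1# * x s)    ∎
    strand-value s (suc m) = begin
      x (s ℕ.+ (5 ℕ.+ m ℕ.* 5))
        ≡⟨ ≡.cong x (lemma s m) ⟩
      - (q ^ (3 ℕ.+ (s ℕ.+ m ℕ.* 5)) * x (s ℕ.+ m ℕ.* 5))
        ≈⟨ -‿cong (*-congˡ (strand-value s m)) ⟩
      - (q ^ (3 ℕ.+ (s ℕ.+ m ℕ.* 5)) * ((- 1#) ^ m * (q ^ strandExponent s m * x s)))
        ≈⟨ solve 4 (λ A S B X → :- (A :* (S :* (B :* X))) := (:- con (+ 1)) :* S :* (B :* A :* X)) refl _ _ _ _ ⟩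
      (- 1#) * (- 1#) ^ m * (q ^ strandExponent s m * q ^ (3 ℕ.+ (s ℕ.+ m ℕ.* 5)) * x s)
        ≈⟨ *-congˡ (*-congʳ (^-homo-* q (strandExponent s m) (3 ℕ.+ (s ℕ.+ m ℕ.* 5)))) ⟨
      (- 1#) ^ suc m * (q ^ strandExponent s (suc m) * x s) ∎
      where
      lemma : ∀ s m → s ℕ.+ (5 ℕ.+ m ℕ.* 5) ≡ 5 ℕ.+ (s ℕ.+ m ℕ.* 5)
      lemma = solve-∀

    strand-zero : ∀ s m → x s ≈ 0# → x (s ℕ.+ m ℕ.* 5) ≈ 0#
    strand-zero s m x≈0 = trans (strand-value s m)
      (trans (*-congˡ (trans (*-congˡ x≈0) (zeroʳ _))) (zeroʳ _))

  -- Away from zero the relation is the recursion of `strand`. The five hypotheses are its instances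
  -- V(x) = - q^(x-2) V(x-5) for x = 2, 3, 4, 1, 0, where x and x - 5 lie on different sides,
  -- multiplied by powers of q so that no inverse occurs.
  strands-shift : ∀ {p₀ p₁ p₂ p₃ p₄ u₀ u₁ u₂ u₃ u₄} →
    p₂ + u₂ ≈ 0# → p₃ + q ^ 1 * u₁ ≈ 0# → p₄ + q ^ 2 * u₀ ≈ 0# →
    q ^ 1 * p₁ + u₃ ≈ 0# → q ^ 2 * p₀ + u₄ ≈ 0# →
    let V = twoSided (strand p₀ p₁ p₂ p₃ p₄) (strand u₀ u₁ u₂ u₃ u₄) in
    ∀ a b → q ^ b * V (2 ℕ.+ a) b + q ^ a * V a (3 ℕ.+ b) ≈ 0#
  strands-shift {p₀} {p₁} {p₂} {p₃} {p₄} {u₀} {u₁} {u₂} {u₃} {u₄} h₂ h₃ h₄ h₁ h₀ = go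
    where
    p = strand p₀ p₁ p₂ p₃ p₄
    u = strand u₀ u₁ u₂ u₃ u₄
    V = twoSided p u
    go : ∀ a b → q ^ b * V (2 ℕ.+ a) b + q ^ a * V a (3 ℕ.+ b) ≈ 0#
    go (suc a) (suc b) = begin
      q * q ^ b * V (2 ℕ.+ a) b + q * q ^ a * V a (3 ℕ.+ b)
        ≈⟨ solve 5 (λ q A B x y → q :* A :* x :+ q :* B :* y := q :* (A :* x :+ B :* y)) refl _ _ _ _ _ ⟩
      q * (q ^ b * V (2 ℕ.+ a) b + q ^ a * V a (3 ℕ.+ b))
        ≈⟨ *-congˡ (go a b) ⟩
      q * 0#
        ≈⟨ zeroʳ q ⟩
      0# ∎
    go 0 0 = trans (+-cong (*-identityˡ _) (*-identityˡ _)) h₂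
    go 1 0 = trans (+-congʳ (*-identityˡ _)) h₃
    go 2 0 = trans (+-congʳ (*-identityˡ _)) h₄
    go (suc (suc (suc a))) 0 = trans (+-congʳ (*-identityˡ _)) (-‿inverseˡ _)
    go 0 1 = trans (+-congˡ (*-identityˡ _)) h₁
    go 0 2 = trans (+-congˡ (*-identityˡ _)) h₀
    go 0 (suc (suc (suc b))) = trans (+-congˡ (*-identityˡ _)) (-‿inverseʳ _)

  private
    z+z : 0# + 0# ≈ 0#
    z+z = +-identityˡ 0#
    z+xz : ∀ x → 0# + x * 0# ≈ 0#
    z+xz x = trans (+-identityˡ _) (zeroʳ x)
    xz+z : ∀ x → x * 0# + 0# ≈ 0#
    xz+z x = trans (+-identityʳ _) (zeroʳ x)

  -- The solution supported on the multiples of 5 with V(0) = 1.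
  p₀ u₀ : ℕ → Carrier
  p₀ = strand 1# 0# 0# 0# 0#
  u₀ = strand 0# 0# 0# 0# (- (q ^ 2))

  -- The solution supported on the residue class of 1 modulo 5 with V(1) = 1.
  p₁ u₁ : ℕ → Carrier
  p₁ = strand 0# 1# 0# 0# 0#
  u₁ = strand 0# 0# 0# (- (q ^ 1)) 0#

  module Schur₀ = Schur (twoSided p₀ u₀) (λ _ _ → refl)
    (strands-shift z+z (z+xz _) (z+xz _) (xz+z _) (trans (+-congʳ (*-identityʳ _)) (-‿inverseʳ _)))

  module Schur₁ = Schur (twoSided p₁ u₁) (λ _ _ → refl)
    (strands-shift z+z (z+xz _) (z+xz _) (trans (+-congʳ (*-identityʳ _)) (-‿inverseʳ _)) (xz+z _))

  -- Putting t = 1 with the index raised by one, or t = q without a shift, turns the Fibonacci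
  -- recurrence into that of `schurSum-step`. The initial values, 1, 1 here and 0, 1 in
  -- `fib-schur₁`, decide between the solutions with V(0) = 1 and V(1) = 1.
  fib-schur₀ : ∀ n → fib (suc n) 1# ≈ Schur₀.schurSum n
  fib-schur₀ 0 = sym (trans (*-identityˡ _) (+-identityʳ 1#))
  fib-schur₀ 1 = trans (+-congˡ (zeroʳ _))
    (solve 0 (con (+ 1) :+ con (+ 0) := con (+ 1) :* (con (+ 0) :+ con (+ 1)) :+ con (+ 1) :* (con (+ 0) :+ con (+ 0))) refl)
  fib-schur₀ (suc (suc n)) = begin
    fib (2 ℕ.+ n) 1# + q ^ suc n * 1# * fib (suc n) 1#
      ≈⟨ +-cong (fib-schur₀ (suc n)) (*-cong (*-identityʳ _) (fib-schur₀ n)) ⟩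
    Schur₀.schurSum (suc n) + q ^ suc n * Schur₀.schurSum n
      ≈⟨ Schur₀.schurSum-step n ⟨
    Schur₀.schurSum (2 ℕ.+ n) ∎

  fib-schur₁ : ∀ n → fib n q ≈ Schur₁.schurSum n
  fib-schur₁ 0 = sym (trans (*-identityˡ _) (+-identityʳ 0#))
  fib-schur₁ 1 =
    solve 0 (con (+ 1) := con (+ 1) :* (con (+ 1) :+ con (+ 0)) :+ con (+ 1) :* (con (+ 0) :+ con (+ 0))) refl
  fib-schur₁ (suc (suc n)) = begin
    fib (suc n) q + q ^ n * q * fib n q
      ≈⟨ +-cong (fib-schur₁ (suc n)) (*-cong (*-comm _ _) (fib-schur₁ n)) ⟩
    Schur₁.schurSum (suc n) + q ^ suc n * Schur₁.schurSum n
      ≈⟨ Schur₁.schurSum-step n ⟨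
    Schur₁.schurSum (2 ℕ.+ n) ∎

-- The numbers k(k - 1)/2, by a recursion parallel to that of `reflectExponent`.
triangle : ℕ → ℕ
triangle zero    = 0
triangle (suc k) = triangle k ℕ.+ k

-- The Catalan sum at an abstract primitive root of unity

module RootOfUnity {c ℓ} (R : CommutativeRing c ℓ) where

  open CommutativeRing R hiding (zero)
  open import Algebra.Properties.Semiring.Exp semiring using (_^_; ^-homo-*; ^-congʳ)
  open import Algebra.Properties.Semiring.Sum semiring
    using (sum; sum-cong-≋; ∑-distrib-+; sum-init-last)
  open import Algebra.Properties.Group +-group using (x≈y⇒x∙y⁻¹≈ε; x∙y⁻¹≈ε⇒x≈y)
  open import Relation.Binary.Reasoning.Setoid setoid
  open IntegerSolver R

  module Primitive (q q⁻¹ : Carrier) (q⁻¹*q≈1 : q⁻¹ * q ≈ 1#)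
    (n : ℕ) (qⁿ≈1 : q ^ n ≈ 1#)
    (cancel : ∀ k z → 0 < k → k < n → (1# - q ^ k) * z ≈ 0# → z ≈ 0#) where

    open QBinomial R q public
    open QFibonacci R q public

    rising-cancel : ∀ k z → k < n → rising 0 k * z ≈ 0# → z ≈ 0#
    rising-cancel zero    z _   eq = trans (sym (*-identityˡ z)) eq
    rising-cancel (suc k) z k<n eq = cancel (suc k) z (s≤s z≤n) k<n
      (rising-cancel k _ (ℕ.<-trans (ℕ.n<1+n k) k<n) (begin
        rising 0 k * ((1# - q ^ suc k) * z)   ≈⟨ *-assoc _ _ _ ⟨
        rising 0 k * (1# - q ^ suc k) * z     ≈⟨ *-congʳ (rising-last 0 k) ⟨
        rising 0 (suc k) * z                  ≈⟨ eq ⟩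
        0#                                    ∎))

    rising-cancel-≈ : ∀ k x y → k < n → rising 0 k * x ≈ rising 0 k * y → x ≈ y
    rising-cancel-≈ k x y k<n eq = x∙y⁻¹≈ε⇒x≈y x y (rising-cancel k (x - y) k<n (begin
      rising 0 k * (x - y)               ≈⟨ solve 3 (λ r x y → r :* (x :- y) := r :* x :- r :* y) refl _ _ _ ⟩
      rising 0 k * x - rising 0 k * y    ≈⟨ x≈y⇒x∙y⁻¹≈ε eq ⟩
      0#                                 ∎))

    -- The factors 1 - q^j run over a < j ≤ a + k, a range that contains j = n.
    rising-zero : ∀ a k → a < n → n ≤ a ℕ.+ k → rising a k ≈ 0#
    rising-zero a zero    a<n n≤ = ⊥-elim (ℕ.<⇒≱ a<n (ℕ.≤-trans n≤ (ℕ.≤-reflexive (ℕ.+-identityʳ a))))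
    rising-zero a (suc k) a<n n≤ with suc a ℕ.≟ n
    ... | yes ≡.refl = trans (*-congʳ (trans (+-congˡ (-‿cong qⁿ≈1)) (-‿inverseʳ 1#))) (zeroˡ _)
    ... | no  a+1≢n  = trans (*-congˡ (rising-zero (suc a) k (ℕ.≤∧≢⇒< a<n a+1≢n) (ℕ.≤-trans n≤ (ℕ.≤-reflexive (ℕ.+-suc a k))))) (zeroʳ _)

    binom-zero : ∀ a k → a < n → k < n → n ≤ a ℕ.+ k → binom a k ≈ 0#
    binom-zero a k a<n k<n n≤ = rising-cancel k _ k<n (begin
      rising 0 k * binom a k   ≈⟨ *-comm _ _ ⟩
      binom a k * rising 0 k   ≈⟨ binom-rising a k ⟩
      rising a k               ≈⟨ rising-zero a k a<n n≤ ⟩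
      0#                       ∎)

    q^-cancel : ∀ i x y → q ^ i * x ≈ y → x ≈ q⁻¹ ^ i * y
    q^-cancel zero    x y eq = trans (sym (*-identityˡ x)) (trans eq (sym (*-identityˡ y)))
    q^-cancel (suc i) x y eq = begin
      x                           ≈⟨ q^-cancel i x (q⁻¹ * y) (begin
          q ^ i * x                  ≈⟨ *-identityˡ _ ⟨
          1# * (q ^ i * x)           ≈⟨ *-congʳ q⁻¹*q≈1 ⟨
          q⁻¹ * q * (q ^ i * x)      ≈⟨ solve 4 (λ p q a x → p :* q :* (a :* x) := p :* (q :* a :* x)) refl _ _ _ _ ⟩
          q⁻¹ * (q ^ suc i * x)      ≈⟨ *-congˡ eq ⟩
          q⁻¹ * y                    ∎) ⟩
      q⁻¹ ^ i * (q⁻¹ * y)         ≈⟨ solve 3 (λ a p y → a :* (p :* y) := p :* a :* y) refl _ _ _ ⟩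
      q⁻¹ ^ suc i * y             ∎

    -- The exponents m + 1, ..., m + k of the reflected factors, added up: multiplying 1 - q^j by
    -- q^(n-j) turns it into - (1 - q^(n-j)).
    reflectExponent : ℕ → ℕ → ℕ
    reflectExponent m zero    = 0
    reflectExponent m (suc k) = reflectExponent m k ℕ.+ suc (m ℕ.+ k)

    -- The reflection 1 - qʲ ≡ - qʲ (1 - qⁿ⁻ʲ) of every factor.
    rising-reflect : ∀ a k m → suc (a ℕ.+ k ℕ.+ m) ≡ n →
                     q ^ reflectExponent m k * rising a k ≈ (- 1#) ^ k * rising m k
    rising-reflect a zero    m _  = refl
    rising-reflect a (suc k) m eq = begin
      q ^ (e ℕ.+ s) * ((1# - q ^ suc a) * rising (suc a) k)
        ≈⟨ *-congʳ (^-homo-* q e s) ⟩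
      q ^ e * q ^ s * ((1# - q ^ suc a) * rising (suc a) k)
        ≈⟨ solve 4 (λ x y z r → x :* y :* ((con (+ 1) :- z) :* r) := (y :- y :* z) :* (x :* r)) refl _ _ _ _ ⟩
      (q ^ s - q ^ s * q ^ suc a) * (q ^ e * rising (suc a) k)
        ≈⟨ *-cong (+-congˡ (-‿cong (trans (sym (^-homo-* q s (suc a))) (trans (^-congʳ q (≡.trans (lemma a k m) eq)) qⁿ≈1))))
                  (rising-reflect (suc a) k m (≡.trans (≡.cong (λ i → suc (i ℕ.+ m)) (≡.sym (ℕ.+-suc a k))) eq)) ⟩
      (q ^ s - 1#) * ((- 1#) ^ k * rising m k)
        ≈⟨ solve 3 (λ y z r → (y :- con (+ 1)) :* (z :* r) := (:- con (+ 1)) :* z :* (r :* (con (+ 1) :- y))) refl _ _ _ ⟩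
      (- 1#) ^ suc k * (rising m k * (1# - q ^ s))
        ≈⟨ *-congˡ (rising-last m k) ⟨
      (- 1#) ^ suc k * rising m (suc k) ∎
      where
      e = reflectExponent m k
      s = suc (m ℕ.+ k)
      lemma : ∀ a k m → suc (m ℕ.+ k) ℕ.+ suc a ≡ suc (a ℕ.+ suc k ℕ.+ m)
      lemma = solve-∀

    -- The numerators reflect into each other, and the common denominator (q; q)_k is regular
    -- because k < n. Taking m = k leads to [2k, k]; taking k + 1 for k and m = k - 1 leads to
    -- [2k, k + 1].
    binom-reflect : ∀ a k m → suc (a ℕ.+ k ℕ.+ m) ≡ n →
                    q ^ reflectExponent m k * binom a k ≈ (- 1#) ^ k * binom m k
    binom-reflect a k m eq = rising-cancel-≈ k _ _ k<n (begin
      rising 0 k * (q ^ reflectExponent m k * binom a k)   ≈⟨ swap _ _ _ ⟩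
      q ^ reflectExponent m k * (binom a k * rising 0 k)   ≈⟨ *-congˡ (binom-rising a k) ⟩
      q ^ reflectExponent m k * rising a k                 ≈⟨ rising-reflect a k m eq ⟩
      (- 1#) ^ k * rising m k                              ≈⟨ *-congˡ (binom-rising m k) ⟨
      (- 1#) ^ k * (binom m k * rising 0 k)                ≈⟨ swap _ _ _ ⟨
      rising 0 k * ((- 1#) ^ k * binom m k)                ∎)
      where
      swap : ∀ x y z → x * (y * z) ≈ y * (z * x)
      swap = solve 3 (λ x y z → x :* (y :* z) := y :* (z :* x)) refl
      k<n : k < n
      k<n = ≡.subst (k <_) eq (s≤s (ℕ.≤-trans (ℕ.m≤n+m k a) (ℕ.m≤m+n (a ℕ.+ k) m)))

    private
      <⇒+ : ∀ k → k ℕ.+ k < n → ∃[ a ] n ≡ suc (a ℕ.+ (k ℕ.+ k))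
      <⇒+ k k+k<n with ℕ.m≤n⇒∃[o]m+o≡n k+k<n
      ... | a , eq = a , ≡.trans (≡.sym eq) (≡.cong suc (ℕ.+-comm (k ℕ.+ k) a))

      reflectExponent-closed : ∀ m k → reflectExponent m k ≡ k ℕ.* m ℕ.+ k ℕ.+ triangle k
      reflectExponent-closed m zero    = ≡.refl
      reflectExponent-closed m (suc k) = ≡.trans (≡.cong (ℕ._+ suc (m ℕ.+ k)) (reflectExponent-closed m k)) (lemma m k (triangle k))
        where
        lemma : ∀ m k t → k ℕ.* m ℕ.+ k ℕ.+ t ℕ.+ suc (m ℕ.+ k) ≡ suc k ℕ.* m ℕ.+ suc k ℕ.+ (t ℕ.+ k)
        lemma = solve-∀

      z*z : ∀ x y → x * (y * 0#) ≈ 0#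
      z*z = solve 2 (λ x y → x :* (y :* con (+ 0)) := con (+ 0)) refl

    -- For 2k < n the exponents k² from F_n, k from t = q, and k(k - 1)/2 add up to that of the
    -- reflection with m = k. For 2k ≥ n both sides vanish: the degree of F_n is too small, and the
    -- numerator of [2k, k] contains 1 - q^n.
    central-binom : ∀ k → k < n →
      q ^ k * fibCoeff n k ≈ (- 1#) ^ k * (q⁻¹ ^ triangle k * binom k k)
    central-binom k k<n with k ℕ.+ k ℕ.<? n
    ... | no k+k≮n = begin
      q ^ k * fibCoeff n k                             ≈⟨ *-congˡ (fibCoeff-zero n k (ℕ.≮⇒≥ k+k≮n)) ⟩
      q ^ k * 0#                                       ≈⟨ zeroʳ _ ⟩
      0#                                               ≈⟨ z*z _ _ ⟨
      (- 1#) ^ k * (q⁻¹ ^ triangle k * 0#)             ≈⟨ *-congˡ (*-congˡ (binom-zero k k k<n k<n (ℕ.≮⇒≥ k+k≮n))) ⟨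
      (- 1#) ^ k * (q⁻¹ ^ triangle k * binom k k)      ∎
    ... | yes k+k<n with <⇒+ k k+k<n
    ... | a , eq = begin
      q ^ k * fibCoeff n k                             ≈⟨ q^-cancel (triangle k) _ _ (begin
        q ^ triangle k * (q ^ k * fibCoeff n k)           ≈⟨ *-congˡ (*-congˡ (fibCoeff-binom n a k eq)) ⟩
        q ^ triangle k * (q ^ k * (q ^ (k ℕ.* k) * binom a k))
          ≈⟨ solve 4 (λ x y z b → x :* (y :* (z :* b)) := z :* y :* x :* b) refl _ _ _ _ ⟩
        q ^ (k ℕ.* k) * q ^ k * q ^ triangle k * binom a k
          ≈⟨ *-congʳ (trans (^-homo-* q (k ℕ.* k ℕ.+ k) (triangle k)) (*-congʳ (^-homo-* q (k ℕ.* k) k))) ⟨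
        q ^ (k ℕ.* k ℕ.+ k ℕ.+ triangle k) * binom a k    ≡⟨ ≡.cong (λ e → q ^ e * binom a k) (reflectExponent-closed k k) ⟨
        q ^ reflectExponent k k * binom a k               ≈⟨ binom-reflect a k k (≡.trans (≡.cong suc (ℕ.+-assoc a k k)) (≡.sym eq)) ⟩
        (- 1#) ^ k * binom k k                            ∎) ⟩
      q⁻¹ ^ triangle k * ((- 1#) ^ k * binom k k)      ≈⟨ solve 3 (λ x y z → x :* (y :* z) := y :* (x :* z)) refl _ _ _ ⟩
      (- 1#) ^ k * (q⁻¹ ^ triangle k * binom k k)      ∎

    -- The reflection applies to [n - k, k + 1] with m = k - 1, and (q; q)_(k+1) is regular because
    -- k + 1 < n. Having k + 1 factors instead of k produces the minus sign in front of q
    -- [2k, k + 1].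
    next-binom : ∀ k → suc k < n →
      fibCoeff (2 ℕ.+ n) (suc k) ≈ (- 1#) ^ k * (q⁻¹ ^ triangle k * - (q * nextBinom k))
    next-binom k k+1<n with k ℕ.+ k ℕ.<? n
    next-binom zero    1<n   | no 0≮n = ⊥-elim (0≮n (ℕ.<-trans (s≤s z≤n) 1<n))
    -- The reflection would require m = - 1. Instead both sides are zero: [0, 1] by definition, and
    -- [n, 1] because its numerator is 1 - q^n.
    next-binom zero    1<n   | yes 0<n with <⇒+ 0 0<n
    ... | a , eq = begin
      fibCoeff (2 ℕ.+ n) 1              ≈⟨ fibCoeff-binom (2 ℕ.+ n) a 1 (≡.trans (≡.cong (2 ℕ.+_) eq) (lemma a)) ⟩
      q ^ 1 * binom a 1                 ≈⟨ *-congˡ (binom-zero a 1 (ℕ.≤-reflexive (≡.trans (≡.cong suc (≡.sym (ℕ.+-identityʳ a))) (≡.sym eq)))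
                                                              1<n (ℕ.≤-reflexive (≡.trans eq (lemma′ a)))) ⟩
      q ^ 1 * 0#                        ≈⟨ solve 1 (λ x → x :* con (+ 1) :* con (+ 0) := con (+ 1) :* (con (+ 1) :* (:- (x :* con (+ 0))))) refl q ⟩
      1# * (1# * - (q * 0#))            ∎
      where
      lemma : ∀ a → 2 ℕ.+ suc (a ℕ.+ 0) ≡ suc (a ℕ.+ 2)
      lemma = solve-∀
      lemma′ : ∀ a → suc (a ℕ.+ 0) ≡ a ℕ.+ 1
      lemma′ = solve-∀
    next-binom (suc j) k+1<n | no k+k≮n = begin
      fibCoeff (2 ℕ.+ n) (2 ℕ.+ j)
        ≈⟨ fibCoeff-zero (2 ℕ.+ n) (2 ℕ.+ j) (ℕ.≤-trans (s≤s (s≤s (ℕ.≮⇒≥ k+k≮n))) (ℕ.≤-reflexive (lemma j))) ⟩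
      0#
        ≈⟨ solve 3 (λ x y q → con (+ 0) := x :* (y :* (:- (q :* con (+ 0))))) refl _ _ _ ⟩
      (- 1#) ^ suc j * (q⁻¹ ^ triangle (suc j) * - (q * 0#))
        ≈⟨ *-congˡ (*-congˡ (-‿cong (*-congˡ (binom-zero j (2 ℕ.+ j) (ℕ.<-trans (ℕ.n<1+n j) (ℕ.<-trans (ℕ.n<1+n _) k+1<n)) k+1<n
             (ℕ.≤-trans (ℕ.≮⇒≥ k+k≮n) (ℕ.≤-reflexive (lemma′ j))))))) ⟨
      (- 1#) ^ suc j * (q⁻¹ ^ triangle (suc j) * - (q * nextBinom (suc j))) ∎
      where
      lemma : ∀ j → 2 ℕ.+ (suc j ℕ.+ suc j) ≡ (2 ℕ.+ j) ℕ.+ (2 ℕ.+ j)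
      lemma = solve-∀
      lemma′ : ∀ j → suc j ℕ.+ suc j ≡ j ℕ.+ (2 ℕ.+ j)
      lemma′ = solve-∀
    next-binom (suc j) k+1<n | yes k+k<n with <⇒+ (suc j) k+k<n
    ... | a , eq = begin
      fibCoeff (2 ℕ.+ n) (suc k)
        ≈⟨ fibCoeff-binom (2 ℕ.+ n) a (suc k) (≡.trans (≡.cong (2 ℕ.+_) eq) (lemma a j)) ⟩
      q ^ (suc k ℕ.* suc k) * binom a (suc k)
        ≈⟨ q^-cancel (triangle k) _ _ (begin
          q ^ triangle k * (q ^ (suc k ℕ.* suc k) * binom a (suc k))
            ≈⟨ *-assoc _ _ _ ⟨
          q ^ triangle k * q ^ (suc k ℕ.* suc k) * binom a (suc k)
            ≈⟨ *-congʳ (^-homo-* q (triangle k) (suc k ℕ.* suc k)) ⟨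
          q ^ (triangle k ℕ.+ suc k ℕ.* suc k) * binom a (suc k)
            ≡⟨ ≡.cong (λ e → q ^ e * binom a (suc k)) (≡.trans (lemma′ j (triangle j))
                 (≡.cong suc (≡.sym (reflectExponent-closed j (suc k))))) ⟩
          q * q ^ reflectExponent j (suc k) * binom a (suc k)
            ≈⟨ *-assoc _ _ _ ⟩
          q * (q ^ reflectExponent j (suc k) * binom a (suc k))
            ≈⟨ *-congˡ (binom-reflect a (suc k) j (≡.trans (lemma″ a j) (≡.sym eq))) ⟩
          q * ((- 1#) * (- 1#) ^ k * nextBinom k)
            ∎) ⟩
      q⁻¹ ^ triangle k * (q * ((- 1#) * (- 1#) ^ k * nextBinom k))
        ≈⟨ solve 4 (λ x q s b → x :* (q :* ((:- con (+ 1)) :* s :* b)) := s :* (x :* (:- (q :* b)))) refl _ _ _ _ ⟩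
      (- 1#) ^ k * (q⁻¹ ^ triangle k * - (q * nextBinom k)) ∎
      where
      k = suc j
      lemma : ∀ a j → 2 ℕ.+ suc (a ℕ.+ (suc j ℕ.+ suc j)) ≡ suc (a ℕ.+ (suc (suc j) ℕ.+ suc (suc j)))
      lemma = solve-∀
      lemma′ : ∀ j t → (t ℕ.+ j) ℕ.+ suc (suc j) ℕ.* suc (suc j)
             ≡ suc (suc (suc j) ℕ.* j ℕ.+ suc (suc j) ℕ.+ (t ℕ.+ j ℕ.+ suc j))
      lemma′ = solve-∀
      lemma″ : ∀ a j → suc (a ℕ.+ suc (suc j) ℕ.+ j) ≡ suc (a ℕ.+ (suc j ℕ.+ suc j))
      lemma″ = solve-∀

    rising-periodic : ∀ a k → rising (n ℕ.+ a) k ≈ rising a k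
    rising-periodic a zero    = refl
    rising-periodic a (suc k) = *-cong (+-congˡ (-‿cong (begin
        q ^ suc (n ℕ.+ a)     ≡⟨ ≡.cong (q ^_) (ℕ.+-suc n a) ⟨
        q ^ (n ℕ.+ suc a)     ≈⟨ ^-homo-* q n (suc a) ⟩
        q ^ n * q ^ suc a     ≈⟨ *-congʳ qⁿ≈1 ⟩
        1# * q ^ suc a        ≈⟨ *-identityˡ _ ⟩
        q ^ suc a             ∎)))
      (trans (reflexive (≡.cong (λ i → rising i k) (≡.sym (ℕ.+-suc n a)))) (rising-periodic (suc a) k))

    -- Here k = n - 1. By symmetry [2n - 2, n] is [2n - 2, n - 2], and its numerator (q^(n+1);
    -- q)_(n-2) reduces to the denominator (q; q)_(n-2), so the coefficient is 1. The remaining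
    -- power of q is evaluated by q^(n(n-1)/2) = (-1)^(n-1).
    next-binom-last : ∀ j → n ≡ 2 ℕ.+ j →
      (- 1#) ^ suc j * (q⁻¹ ^ triangle (suc j) * - (q * nextBinom (suc j))) ≈ - 1#
    next-binom-last j eq = begin
      (- 1#) ^ suc j * (q⁻¹ ^ triangle (suc j) * - (q * binom j (2 ℕ.+ j)))
        ≈⟨ *-congˡ (*-congˡ (-‿cong (*-congˡ binom≈1))) ⟩
      (- 1#) ^ suc j * (q⁻¹ ^ triangle (suc j) * - (q * 1#))
        ≈⟨ solve 3 (λ s x q → s :* (x :* (:- (q :* con (+ 1)))) := :- (x :* (s :* q))) refl _ _ _ ⟩
      - (q⁻¹ ^ triangle (suc j) * ((- 1#) ^ suc j * q))
        ≈⟨ -‿cong (q^-cancel (triangle (suc j)) 1# _ (begin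
           q ^ triangle (suc j) * 1#                      ≈⟨ *-congˡ qⁿ≈1 ⟨
           q ^ triangle (suc j) * q ^ n                   ≈⟨ ^-homo-* q (triangle (suc j)) n ⟨
           q ^ (triangle (suc j) ℕ.+ n)                   ≡⟨ ≡.cong (q ^_) exponent ⟩
           q * q ^ reflectExponent 0 (suc j)              ≈⟨ *-congˡ sign ⟩
           q * (- 1#) ^ suc j                             ≈⟨ *-comm _ _ ⟩
           (- 1#) ^ suc j * q                             ∎)) ⟨
      - 1# ∎
      where
      j+1<n : suc j < n
      j+1<n = ℕ.≤-reflexive (≡.sym eq)
      j<n : j < n
      j<n = ℕ.<-trans (ℕ.n<1+n j) j+1<n
      binom≈1 : binom j (2 ℕ.+ j) ≈ 1#
      binom≈1 = rising-cancel-≈ j _ _ j<n (begin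
        rising 0 j * binom j (2 ℕ.+ j)    ≈⟨ *-congˡ (binom-sym j (2 ℕ.+ j)) ⟩
        rising 0 j * binom (2 ℕ.+ j) j    ≡⟨ ≡.cong (λ i → rising 0 j * binom i j) (≡.trans (≡.sym eq) (≡.sym (ℕ.+-identityʳ n))) ⟩
        rising 0 j * binom (n ℕ.+ 0) j    ≈⟨ *-comm _ _ ⟩
        binom (n ℕ.+ 0) j * rising 0 j    ≈⟨ binom-rising (n ℕ.+ 0) j ⟩
        rising (n ℕ.+ 0) j                ≈⟨ rising-periodic 0 j ⟩
        rising 0 j                        ≈⟨ *-identityʳ _ ⟨
        rising 0 j * 1#                   ∎)
      -- The reflection with a = m = 0 carries (q; q)_(n-1) to itself up to sign and a power of q,
      -- which settles even and odd n at once.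
      sign : q ^ reflectExponent 0 (suc j) ≈ (- 1#) ^ suc j
      sign = rising-cancel-≈ (suc j) _ _ j+1<n (begin
        rising 0 (suc j) * q ^ reflectExponent 0 (suc j)   ≈⟨ *-comm _ _ ⟩
        q ^ reflectExponent 0 (suc j) * rising 0 (suc j)   ≈⟨ rising-reflect 0 (suc j) 0 (≡.trans (≡.cong (2 ℕ.+_) (ℕ.+-identityʳ j)) (≡.sym eq)) ⟩
        (- 1#) ^ suc j * rising 0 (suc j)                  ≈⟨ *-comm _ _ ⟩
        rising 0 (suc j) * (- 1#) ^ suc j                  ∎)
      exponent : triangle (suc j) ℕ.+ n ≡ suc (reflectExponent 0 (suc j))
      exponent = ≡.trans (≡.cong (triangle (suc j) ℕ.+_) eq)
        (≡.trans (lemma j (triangle j)) (≡.cong suc (≡.sym (reflectExponent-closed 0 (suc j)))))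
        where
        lemma : ∀ j t → t ℕ.+ j ℕ.+ (2 ℕ.+ j) ≡ suc (suc j ℕ.* 0 ℕ.+ suc j ℕ.+ (t ℕ.+ j))
        lemma = solve-∀

    catalanSummand : ℕ → Carrier
    catalanSummand k = (- 1#) ^ k * q⁻¹ ^ triangle k * (binom k k - q * nextBinom k)

    -- The length N is kept apart from the module parameter n so that it can be matched on. For n =
    -- 1 the only summand is 1, and q = 1 gives F_3(1) = 2; `next-binom-last` takes care of n ≥ 2.
    catalan-sum : ∀ N → n ≡ N → 0 < N →
      sum {N} (λ k → catalanSummand (toℕ k)) ≈ fib N q + fib (N ℕ.+ 2) 1# - (1# + 1#)
    catalan-sum 1 n≡ _ = begin
      1# * 1# * (1# - q * 0#) + 0#
        ≈⟨ solve 1 (λ q → con (+ 1) :* con (+ 1) :* (con (+ 1) :- q :* con (+ 0)) :+ con (+ 0)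
                       := con (+ 1) :+ (con (+ 1) :+ con (+ 1) :* con (+ 1) :* con (+ 0) :+ con (+ 1) :* con (+ 1) :* con (+ 1)) :- (con (+ 1) :+ con (+ 1)))
                 refl q ⟩
      1# + (1# + 1# * 1# * 0# + 1# * 1# * 1#) - (1# + 1#)
        ≈⟨ +-congʳ (+-congˡ (+-congˡ (*-congʳ (*-congʳ (trans (^-congʳ q (≡.sym n≡)) qⁿ≈1))))) ⟨
      1# + (1# + 1# * 1# * 0# + q ^ 1 * 1# * 1#) - (1# + 1#) ∎
    catalan-sum (suc (suc j)) n≡ _ = begin
      sum {2 ℕ.+ j} (λ k → catalanSummand (toℕ k))
        ≈⟨ sum-cong-≋ {2 ℕ.+ j} (λ k → solve 5 (λ s x b q c → s :* x :* (b :- q :* c) := s :* (x :* b) :+ s :* (x :* (:- (q :* c)))) refl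
             ((- 1#) ^ toℕ k) (q⁻¹ ^ triangle (toℕ k)) (binom (toℕ k) (toℕ k)) q (nextBinom (toℕ k))) ⟩
      sum {2 ℕ.+ j} (λ k → f (toℕ k) + g (toℕ k))
        ≈⟨ ∑-distrib-+ {2 ℕ.+ j} (λ k → f (toℕ k)) (λ k → g (toℕ k)) ⟩
      sum {2 ℕ.+ j} (λ k → f (toℕ k)) + sum {2 ℕ.+ j} (λ k → g (toℕ k))
        ≈⟨ +-cong central next ⟩
      fib (2 ℕ.+ j) q + (sum {suc j} (λ k → fibCoeff (4 ℕ.+ j) (suc (toℕ k))) + - 1#)
        ≈⟨ solve 2 (λ a s → a :+ (s :+ (:- con (+ 1))) := a :+ (con (+ 1) :+ s) :- (con (+ 1) :+ con (+ 1))) refl _ _ ⟩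
      fib (2 ℕ.+ j) q + (1# + sum {suc j} (λ k → fibCoeff (4 ℕ.+ j) (suc (toℕ k)))) - (1# + 1#)
        ≈⟨ +-congʳ (+-congˡ total) ⟨
      fib (2 ℕ.+ j) q + fib (2 ℕ.+ j ℕ.+ 2) 1# - (1# + 1#) ∎
      where
      f g : ℕ → Carrier
      f k = (- 1#) ^ k * (q⁻¹ ^ triangle k * binom k k)
      g k = (- 1#) ^ k * (q⁻¹ ^ triangle k * - (q * nextBinom k))
      1^ : ∀ k → 1# ^ k ≈ 1#
      1^ zero    = refl
      1^ (suc k) = trans (*-identityˡ _) (1^ k)
      central : sum {2 ℕ.+ j} (λ k → f (toℕ k)) ≈ fib (2 ℕ.+ j) q
      central = begin
        sum {2 ℕ.+ j} (λ k → f (toℕ k))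
          ≈⟨ sum-cong-≋ {2 ℕ.+ j} (λ k → central-binom (toℕ k) (≡.subst (toℕ k <_) (≡.sym n≡) (toℕ<n k))) ⟨
        sum {2 ℕ.+ j} (λ k → q ^ toℕ k * fibCoeff n (toℕ k))
          ≡⟨ ≡.cong (λ m → sum {2 ℕ.+ j} (λ k → q ^ toℕ k * fibCoeff m (toℕ k))) n≡ ⟩
        sum {2 ℕ.+ j} (λ k → q ^ toℕ k * fibCoeff (2 ℕ.+ j) (toℕ k))
          ≈⟨ fib-sum (2 ℕ.+ j) (2 ℕ.+ j) q (ℕ.m≤m+n _ _) ⟨
        fib (2 ℕ.+ j) q ∎
      next : sum {2 ℕ.+ j} (λ k → g (toℕ k)) ≈ sum {suc j} (λ k → fibCoeff (4 ℕ.+ j) (suc (toℕ k))) + - 1#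
      next = begin
        sum {2 ℕ.+ j} (λ k → g (toℕ k))
          ≈⟨ sum-init-last {suc j} (λ k → g (toℕ k)) ⟩
        sum {suc j} (λ k → g (toℕ (inject₁ k))) + g (toℕ (fromℕ (suc j)))
          ≈⟨ +-cong (sum-cong-≋ {suc j} (λ k → trans (reflexive (≡.cong g (toℕ-inject₁ k)))
                (trans (sym (next-binom (toℕ k) (≡.subst (suc (toℕ k) <_) (≡.sym n≡) (s≤s (toℕ<n k)))))
                       (reflexive (≡.cong (λ m → fibCoeff (2 ℕ.+ m) (suc (toℕ k))) n≡)))))
              (trans (reflexive (≡.cong g (toℕ-fromℕ (suc j)))) (next-binom-last j n≡)) ⟩
        sum {suc j} (λ k → fibCoeff (4 ℕ.+ j) (suc (toℕ k))) + - 1# ∎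
      total : fib (2 ℕ.+ j ℕ.+ 2) 1# ≈ 1# + sum {suc j} (λ k → fibCoeff (4 ℕ.+ j) (suc (toℕ k)))
      total = begin
        fib (2 ℕ.+ j ℕ.+ 2) 1#
          ≡⟨ ≡.cong (λ m → fib m 1#) (ℕ.+-comm (2 ℕ.+ j) 2) ⟩
        fib (4 ℕ.+ j) 1#
          -- The first n coefficients of F_(n+2) suffice because n + 2 ≤ 2n for n ≥ 2.
          ≈⟨ fib-sum (4 ℕ.+ j) (2 ℕ.+ j) 1# (s≤s (s≤s (ℕ.m≤n+m (2 ℕ.+ j) j))) ⟩
        sum {2 ℕ.+ j} (λ k → 1# ^ toℕ k * fibCoeff (4 ℕ.+ j) (toℕ k))
          ≈⟨ sum-cong-≋ {2 ℕ.+ j} {y = λ k → fibCoeff (4 ℕ.+ j) (toℕ k)} (λ k → trans (*-congʳ (1^ (toℕ k))) (*-identityˡ _)) ⟩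
        1# + sum {suc j} (λ k → fibCoeff (4 ℕ.+ j) (suc (toℕ k))) ∎

    -- The closed form according to n modulo 5

    binomialSum-root : ∀ N f → n ≡ suc N → binomialSum n f ≈ f n 0 + f 0 n
    binomialSum-root zero    f ≡.refl = +-cong (*-identityˡ _) (*-identityˡ _)
    binomialSum-root (suc N) f ≡.refl = begin
      1# * f (2 ℕ.+ N) 0 + antidiagonal (suc N) (λ a b → binom a (suc b) * f a (suc b))
        ≈⟨ +-cong (*-identityˡ _) (antidiagonal-last N (λ a b → binom a (suc b) * f a (suc b))) ⟩
      f (2 ℕ.+ N) 0 + (antidiagonal N (λ a b → binom (suc a) (suc b) * f (suc a) (suc b)) + 1# * f 0 (2 ℕ.+ N))
        ≈⟨ +-congˡ (+-cong (antidiagonal-cong N {g = λ a b → 0# * f (suc a) (suc b)} (λ { a b ≡.refl →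
             *-congʳ (binom-zero (suc a) (suc b) (s≤s (s≤s (ℕ.m≤m+n a b))) (s≤s (s≤s (ℕ.m≤n+m b a)))
               (ℕ.≤-reflexive (≡.cong suc (≡.sym (ℕ.+-suc a b))))) })) (*-identityˡ _)) ⟩
      f (2 ℕ.+ N) 0 + (antidiagonal N (λ a b → 0# * f (suc a) (suc b)) + f 0 (2 ℕ.+ N))
        ≈⟨ +-congˡ (+-congʳ (trans (antidiagonal-* N 0# (λ a b → f (suc a) (suc b))) (zeroˡ _))) ⟩
      f (2 ℕ.+ N) 0 + (0# + f 0 (2 ℕ.+ N))
        ≈⟨ +-congˡ (+-identityˡ _) ⟩
      f (2 ℕ.+ N) 0 + f 0 (2 ℕ.+ N) ∎

    fib₁-strands : ∀ N → n ≡ suc N → fib n q ≈ (p₁ (suc N) + p₁ N) + (u₁ N + u₁ (suc N))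
    fib₁-strands N ≡.refl = trans (fib-schur₁ n) (binomialSum-root N Schur₁.weight ≡.refl)

    -- The arguments of V are n - 2, ..., n + 1 and - n - 2, ..., 1 - n. The values at n - 2 = N - 1
    -- and at 1 - n = - N are left as `twoSided`, since N = 0 moves the first to the negative side
    -- and the second to the other.
    fib₀-strands : ∀ N → n ≡ suc N → fib (n ℕ.+ 2) 1# ≈
      ((p₀ N + twoSided p₀ u₀ N 1) + (p₀ (2 ℕ.+ N) + p₀ (suc N)))
      + ((u₀ (suc N) + u₀ (2 ℕ.+ N)) + (twoSided p₀ u₀ 0 N + u₀ N))
    fib₀-strands N ≡.refl = begin
      fib (n ℕ.+ 2) 1#
        ≡⟨ ≡.cong (λ m → fib m 1#) (ℕ.+-comm n 2) ⟩
      fib (2 ℕ.+ n) 1#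
        ≈⟨ fib-schur₀ (suc n) ⟩
      Schur₀.schurSum (suc n)
        ≈⟨ binomialSum-stepʳ n Schur₀.weight ⟩
      binomialSum n (λ a b → Schur₀.weight a (suc b) + q ^ b * Schur₀.weight (suc a) b)
        ≈⟨ binomialSum-root N (λ a b → Schur₀.weight a (suc b) + q ^ b * Schur₀.weight (suc a) b) ≡.refl ⟩
      (Schur₀.weight n 1 + 1# * Schur₀.weight (suc n) 0) + (Schur₀.weight 0 (suc n) + q ^ n * Schur₀.weight 1 n)
        ≈⟨ +-cong (+-congˡ (*-identityˡ _)) (+-congˡ (trans (*-congʳ qⁿ≈1) (*-identityˡ _))) ⟩
      (Schur₀.weight n 1 + Schur₀.weight (suc n) 0) + (Schur₀.weight 0 (suc n) + Schur₀.weight 1 n) ∎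

    private
      p₀-value : ∀ m → p₀ (m ℕ.* 5) ≈ (- 1#) ^ m * q ^ strandExponent 0 m
      p₀-value m = trans (strand-value 0 m) (*-congˡ (*-identityʳ _))

      p₁-value : ∀ m → p₁ (1 ℕ.+ m ℕ.* 5) ≈ (- 1#) ^ m * q ^ strandExponent 1 m
      p₁-value m = trans (strand-value 1 m) (*-congˡ (*-identityʳ _))

      negative-value : ∀ s m i → (- 1#) ^ m * (q ^ strandExponent s m * - (q ^ i))
                     ≈ (- 1#) ^ suc m * q ^ (strandExponent s m ℕ.+ i)
      negative-value s m i = trans
        (solve 3 (λ s x y → s :* (x :* (:- y)) := (:- con (+ 1)) :* s :* (x :* y)) refl _ _ _)
        (*-congˡ (sym (^-homo-* q (strandExponent s m) i)))

      u₀-value : ∀ m → u₀ (4 ℕ.+ m ℕ.* 5) ≈ (- 1#) ^ suc m * q ^ (strandExponent 4 m ℕ.+ 2)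
      u₀-value m = trans (strand-value 4 m) (negative-value 4 m 2)

      u₁-value : ∀ m → u₁ (3 ℕ.+ m ℕ.* 5) ≈ (- 1#) ^ suc m * q ^ (strandExponent 3 m ℕ.+ 1)
      u₁-value m = trans (strand-value 3 m) (negative-value 3 m 1)

      zp₀ : ∀ s m → p₀ s ≈ 0# → p₀ (s ℕ.+ m ℕ.* 5) ≈ 0#
      zp₀ s m = strand-zero s m
      zu₀ : ∀ s m → u₀ s ≈ 0# → u₀ (s ℕ.+ m ℕ.* 5) ≈ 0#
      zu₀ s m = strand-zero s m
      zp₁ : ∀ s m → p₁ s ≈ 0# → p₁ (s ℕ.+ m ℕ.* 5) ≈ 0#
      zp₁ s m = strand-zero s m
      zu₁ : ∀ s m → u₁ s ≈ 0# → u₁ (s ℕ.+ m ℕ.* 5) ≈ 0#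
      zu₁ s m = strand-zero s m

    fibSum : Carrier
    fibSum = fib n q + fib (n ℕ.+ 2) 1#

    -- The halved exponents are pinned down by doubled equations in ℕ, which avoid subtraction and
    -- certify that the halves are integers.
    TwoTerms ThreeTerms : ℕ → Set _
    TwoTerms r = ∃₂ λ e₁ e₂ → 2 ℕ.* e₁ ℕ.+ r ≡ r ℕ.* n × 2 ℕ.* e₂ ≡ r ℕ.* n ℕ.+ r
      × fibSum ≈ (- 1#) ^ r * (q ^ e₁ + q ^ e₂)
    ThreeTerms r = ∃₂ λ e₁ e₂ → ∃[ e₃ ] 2 ℕ.* e₁ ℕ.+ 2 ℕ.* r ≡ r ℕ.* n × 2 ℕ.* e₂ ≡ r ℕ.* n
      × 2 ℕ.* e₃ ≡ r ℕ.* n ℕ.+ 2 ℕ.* r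
      × fibSum ≈ (- 1#) ^ r * (q ^ e₁ + q ^ e₂ + q ^ e₃)

    private
      twice-+ : ∀ s m i → 2 ℕ.* (strandExponent s m ℕ.+ i) ≡ m ℕ.* (5 ℕ.* m ℕ.+ 1 ℕ.+ 2 ℕ.* s) ℕ.+ 2 ℕ.* i
      twice-+ s m i = ≡.trans (ℕ.*-distribˡ-+ 2 (strandExponent s m) i) (≡.cong (ℕ._+ 2 ℕ.* i) (twice-strandExponent s m))

    -- F_n(q) contributes V at n, n - 1, - n and - n - 1, of which only arguments congruent to 1
    -- modulo 5 count; F_(n+2)(1) contributes V at n - 2, ..., n + 1 and - n - 2, ..., 1 - n, of
    -- which only multiples of 5 count. When 5 divides n the survivors are n and - n, both from
    -- F_(n+2)(1).
    fibSum-5m : ∀ m → n ≡ 5 ℕ.+ m ℕ.* 5 → TwoTerms (suc m)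
    fibSum-5m m ≡.refl = strandExponent 4 m ℕ.+ 2 , strandExponent 0 (suc m)
      , ≡.trans (≡.cong (ℕ._+ suc m) (twice-+ 4 m 2)) (lemma₁ m)
      , ≡.trans (twice-strandExponent 0 (suc m)) (lemma₂ m)
      , (begin
        fibSum
          ≈⟨ +-cong
               (trans (fib₁-strands N ≡.refl)
                 (+-cong (+-cong (zp₁ 0 (suc m) refl) (zp₁ 4 m refl)) (+-cong (zu₁ 4 m refl) (zu₁ 0 (suc m) refl))))
               (trans (fib₀-strands N ≡.refl)
                 (+-cong (+-cong (+-cong (zp₀ 4 m refl) (zp₀ 3 m refl)) (+-cong (zp₀ 1 (suc m) refl) (p₀-value (suc m))))
                         (+-cong (+-cong (zu₀ 0 (suc m) refl) (zu₀ 1 (suc m) refl)) (+-cong (zu₀ 3 m refl) (u₀-value m))))) ⟩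
        ((0# + 0#) + (0# + 0#)) + (((0# + 0#) + (0# + S * Y)) + ((0# + 0#) + (0# + S * X)))
          ≈⟨ solve 3 (λ s x y → let o = con (+ 0) in
               ((o :+ o) :+ (o :+ o)) :+ (((o :+ o) :+ (o :+ s :* y)) :+ ((o :+ o) :+ (o :+ s :* x)))
               := s :* (x :+ y)) refl S X Y ⟩
        S * (X + Y) ∎)
      where
      N = 4 ℕ.+ m ℕ.* 5
      S = (- 1#) ^ suc m
      X = q ^ (strandExponent 4 m ℕ.+ 2)
      Y = q ^ strandExponent 0 (suc m)
      lemma₁ : ∀ m → m ℕ.* (5 ℕ.* m ℕ.+ 1 ℕ.+ 2 ℕ.* 4) ℕ.+ 2 ℕ.* 2 ℕ.+ suc m ≡ suc m ℕ.* (5 ℕ.+ m ℕ.* 5)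
      lemma₁ = solve-∀
      lemma₂ : ∀ m → suc m ℕ.* (5 ℕ.* suc m ℕ.+ 1 ℕ.+ 2 ℕ.* 0) ≡ suc m ℕ.* (5 ℕ.+ m ℕ.* 5) ℕ.+ suc m
      lemma₂ = solve-∀

    -- The survivors are n - 1 in F_n(q) and n - 2 in F_(n+2)(1).
    fibSum-5m+2 : ∀ m → n ≡ 2 ℕ.+ m ℕ.* 5 → TwoTerms m
    fibSum-5m+2 m ≡.refl = strandExponent 0 m , strandExponent 1 m
      , ≡.trans (≡.cong (ℕ._+ m) (twice-strandExponent 0 m)) (lemma₁ m)
      , ≡.trans (twice-strandExponent 1 m) (lemma₂ m)
      , (begin
        fibSum
          ≈⟨ +-cong
               (trans (fib₁-strands N ≡.refl)
                 (+-cong (+-cong (zp₁ 2 m refl) (p₁-value m)) (+-cong (zu₁ 1 m refl) (zu₁ 2 m refl))))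
               (trans (fib₀-strands N ≡.refl)
                 (+-cong (+-cong (+-cong (zp₀ 1 m refl) (p₀-value m)) (+-cong (zp₀ 3 m refl) (zp₀ 2 m refl)))
                         (+-cong (+-cong (zu₀ 2 m refl) (zu₀ 3 m refl)) (+-cong (zu₀ 0 m refl) (zu₀ 1 m refl))))) ⟩
        ((0# + S * Y) + (0# + 0#)) + (((0# + S * X) + (0# + 0#)) + ((0# + 0#) + (0# + 0#)))
          ≈⟨ solve 3 (λ s x y → let o = con (+ 0) in
               ((o :+ s :* y) :+ (o :+ o)) :+ (((o :+ s :* x) :+ (o :+ o)) :+ ((o :+ o) :+ (o :+ o)))
               := s :* (x :+ y)) refl S X Y ⟩
        S * (X + Y) ∎)
      where
      N = 1 ℕ.+ m ℕ.* 5
      S = (- 1#) ^ m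
      X = q ^ strandExponent 0 m
      Y = q ^ strandExponent 1 m
      lemma₁ : ∀ m → m ℕ.* (5 ℕ.* m ℕ.+ 1 ℕ.+ 2 ℕ.* 0) ℕ.+ m ≡ m ℕ.* (2 ℕ.+ m ℕ.* 5)
      lemma₁ = solve-∀
      lemma₂ : ∀ m → m ℕ.* (5 ℕ.* m ℕ.+ 1 ℕ.+ 2 ℕ.* 1) ≡ m ℕ.* (2 ℕ.+ m ℕ.* 5) ℕ.+ m
      lemma₂ = solve-∀

    -- The survivors are - n - 1 in F_n(q) and - n - 2 in F_(n+2)(1). The negative strands start
    -- with a minus sign, hence the index m + 1.
    fibSum-5m+3 : ∀ m → n ≡ 3 ℕ.+ m ℕ.* 5 → TwoTerms (suc m)
    fibSum-5m+3 m ≡.refl = strandExponent 3 m ℕ.+ 1 , strandExponent 4 m ℕ.+ 2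
      , ≡.trans (≡.cong (ℕ._+ suc m) (twice-+ 3 m 1)) (lemma₁ m)
      , ≡.trans (twice-+ 4 m 2) (lemma₂ m)
      , (begin
        fibSum
          ≈⟨ +-cong
               (trans (fib₁-strands N ≡.refl)
                 (+-cong (+-cong (zp₁ 3 m refl) (zp₁ 2 m refl)) (+-cong (zu₁ 2 m refl) (u₁-value m))))
               (trans (fib₀-strands N ≡.refl)
                 (+-cong (+-cong (+-cong (zp₀ 2 m refl) (zp₀ 1 m refl)) (+-cong (zp₀ 4 m refl) (zp₀ 3 m refl)))
                         (+-cong (+-cong (zu₀ 3 m refl) (u₀-value m)) (+-cong (zu₀ 1 m refl) (zu₀ 2 m refl))))) ⟩
        ((0# + 0#) + (0# + S * X)) + (((0# + 0#) + (0# + 0#)) + ((0# + S * Y) + (0# + 0#)))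
          ≈⟨ solve 3 (λ s x y → let o = con (+ 0) in
               ((o :+ o) :+ (o :+ s :* x)) :+ (((o :+ o) :+ (o :+ o)) :+ ((o :+ s :* y) :+ (o :+ o)))
               := s :* (x :+ y)) refl S X Y ⟩
        S * (X + Y) ∎)
      where
      N = 2 ℕ.+ m ℕ.* 5
      S = (- 1#) ^ suc m
      X = q ^ (strandExponent 3 m ℕ.+ 1)
      Y = q ^ (strandExponent 4 m ℕ.+ 2)
      lemma₁ : ∀ m → m ℕ.* (5 ℕ.* m ℕ.+ 1 ℕ.+ 2 ℕ.* 3) ℕ.+ 2 ℕ.* 1 ℕ.+ suc m ≡ suc m ℕ.* (3 ℕ.+ m ℕ.* 5)
      lemma₁ = solve-∀
      lemma₂ : ∀ m → m ℕ.* (5 ℕ.* m ℕ.+ 1 ℕ.+ 2 ℕ.* 4) ℕ.+ 2 ℕ.* 2 ≡ suc m ℕ.* (3 ℕ.+ m ℕ.* 5) ℕ.+ suc m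
      lemma₂ = solve-∀

    -- The survivors are - n in F_n(q), and n + 1 and - n - 1 in F_(n+2)(1).
    fibSum-5m+4 : ∀ m → n ≡ 4 ℕ.+ m ℕ.* 5 → ThreeTerms (suc m)
    fibSum-5m+4 m ≡.refl = strandExponent 3 m ℕ.+ 1 , strandExponent 4 m ℕ.+ 2 , strandExponent 0 (suc m)
      , ≡.trans (≡.cong (ℕ._+ 2 ℕ.* suc m) (twice-+ 3 m 1)) (lemma₁ m)
      , ≡.trans (twice-+ 4 m 2) (lemma₂ m)
      , ≡.trans (twice-strandExponent 0 (suc m)) (lemma₃ m)
      , (begin
        fibSum
          ≈⟨ +-cong
               (trans (fib₁-strands N ≡.refl)
                 (+-cong (+-cong (zp₁ 4 m refl) (zp₁ 3 m refl)) (+-cong (u₁-value m) (zu₁ 4 m refl))))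
               (trans (fib₀-strands N ≡.refl)
                 (+-cong (+-cong (+-cong (zp₀ 3 m refl) (zp₀ 2 m refl)) (+-cong (p₀-value (suc m)) (zp₀ 4 m refl)))
                         (+-cong (+-cong (u₀-value m) (zu₀ 0 (suc m) refl)) (+-cong (zu₀ 2 m refl) (zu₀ 3 m refl))))) ⟩
        ((0# + 0#) + (S * X + 0#)) + (((0# + 0#) + (S * Z + 0#)) + ((S * Y + 0#) + (0# + 0#)))
          ≈⟨ solve 4 (λ s x y z → let o = con (+ 0) in
               ((o :+ o) :+ (s :* x :+ o)) :+ (((o :+ o) :+ (s :* z :+ o)) :+ ((s :* y :+ o) :+ (o :+ o)))
               := s :* (x :+ y :+ z)) refl S X Y Z ⟩
        S * (X + Y + Z) ∎)
      where
      N = 3 ℕ.+ m ℕ.* 5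
      S = (- 1#) ^ suc m
      X = q ^ (strandExponent 3 m ℕ.+ 1)
      Y = q ^ (strandExponent 4 m ℕ.+ 2)
      Z = q ^ strandExponent 0 (suc m)
      lemma₁ : ∀ m → m ℕ.* (5 ℕ.* m ℕ.+ 1 ℕ.+ 2 ℕ.* 3) ℕ.+ 2 ℕ.* 1 ℕ.+ 2 ℕ.* suc m ≡ suc m ℕ.* (4 ℕ.+ m ℕ.* 5)
      lemma₁ = solve-∀
      lemma₂ : ∀ m → m ℕ.* (5 ℕ.* m ℕ.+ 1 ℕ.+ 2 ℕ.* 4) ℕ.+ 2 ℕ.* 2 ≡ suc m ℕ.* (4 ℕ.+ m ℕ.* 5)
      lemma₂ = solve-∀
      lemma₃ : ∀ m → suc m ℕ.* (5 ℕ.* suc m ℕ.+ 1 ℕ.+ 2 ℕ.* 0) ≡ suc m ℕ.* (4 ℕ.+ m ℕ.* 5) ℕ.+ 2 ℕ.* suc m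
      lemma₃ = solve-∀

    -- The survivors are n in F_n(q), and n - 1 and 1 - n in F_(n+2)(1). For n = 1 the last two
    -- coincide at 0, off the negative strand, so this case is computed directly.
    fibSum-5m+1 : ∀ m → n ≡ 1 ℕ.+ m ℕ.* 5 → ThreeTerms m
    fibSum-5m+1 zero    ≡.refl = 0 , 0 , 0 , ≡.refl , ≡.refl , ≡.refl , (begin
      1# + (1# + 1# * 1# * 0# + q ^ 1 * 1# * 1#)
        ≈⟨ +-congˡ (+-congˡ (*-congʳ (*-congʳ qⁿ≈1))) ⟩
      1# + (1# + 1# * 1# * 0# + 1# * 1# * 1#)
        ≈⟨ solve 0 (let i = con (+ 1) in i :+ (i :+ i :* i :* con (+ 0) :+ i :* i :* i) := i :* (i :+ i :+ i)) refl ⟩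
      1# * (1# + 1# + 1#) ∎)
    fibSum-5m+1 (suc m) ≡.refl = strandExponent 4 m ℕ.+ 2 , strandExponent 0 (suc m) , strandExponent 1 (suc m)
      , ≡.trans (≡.cong (ℕ._+ 2 ℕ.* suc m) (twice-+ 4 m 2)) (lemma₁ m)
      , ≡.trans (twice-strandExponent 0 (suc m)) (lemma₂ m)
      , ≡.trans (twice-strandExponent 1 (suc m)) (lemma₃ m)
      , (begin
        fibSum
          ≈⟨ +-cong
               (trans (fib₁-strands N ≡.refl)
                 (+-cong (+-cong (p₁-value (suc m)) (zp₁ 0 (suc m) refl)) (+-cong (zu₁ 0 (suc m) refl) (zu₁ 1 (suc m) refl))))
               (trans (fib₀-strands N ≡.refl)
                 (+-cong (+-cong (+-cong (p₀-value (suc m)) (zp₀ 4 m refl)) (+-cong (zp₀ 2 (suc m) refl) (zp₀ 1 (suc m) refl)))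
                         (+-cong (+-cong (zu₀ 1 (suc m) refl) (zu₀ 2 (suc m) refl)) (+-cong (u₀-value m) (zu₀ 0 (suc m) refl))))) ⟩
        ((S * Z + 0#) + (0# + 0#)) + (((S * Y + 0#) + (0# + 0#)) + ((0# + 0#) + (S * X + 0#)))
          ≈⟨ solve 4 (λ s x y z → let o = con (+ 0) in
               ((s :* z :+ o) :+ (o :+ o)) :+ (((s :* y :+ o) :+ (o :+ o)) :+ ((o :+ o) :+ (s :* x :+ o)))
               := s :* (x :+ y :+ z)) refl S X Y Z ⟩
        S * (X + Y + Z) ∎)
      where
      N = 5 ℕ.+ m ℕ.* 5
      S = (- 1#) ^ suc m
      X = q ^ (strandExponent 4 m ℕ.+ 2)
      Y = q ^ strandExponent 0 (suc m)
      Z = q ^ strandExponent 1 (suc m)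
      lemma₁ : ∀ m → m ℕ.* (5 ℕ.* m ℕ.+ 1 ℕ.+ 2 ℕ.* 4) ℕ.+ 2 ℕ.* 2 ℕ.+ 2 ℕ.* suc m ≡ suc m ℕ.* (1 ℕ.+ suc m ℕ.* 5)
      lemma₁ = solve-∀
      lemma₂ : ∀ m → suc m ℕ.* (5 ℕ.* suc m ℕ.+ 1 ℕ.+ 2 ℕ.* 0) ≡ suc m ℕ.* (1 ℕ.+ suc m ℕ.* 5)
      lemma₂ = solve-∀
      lemma₃ : ∀ m → suc m ℕ.* (5 ℕ.* suc m ℕ.+ 1 ℕ.+ 2 ℕ.* 1) ≡ suc m ℕ.* (1 ℕ.+ suc m ℕ.* 5) ℕ.+ 2 ℕ.* suc m
      lemma₃ = solve-∀

-- Convolution of integer sequences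

module Convolution where

  open ≡.≡-Reasoning

  infixl 7 _⋆_
  _⋆_ : (ℕ → ℤ) → (ℕ → ℤ) → ℕ → ℤ
  (f ⋆ g) zero    = f 0 ℤ.* g 0
  (f ⋆ g) (suc i) = f 0 ℤ.* g (suc i) ℤ.+ (f ∘ suc ⋆ g) i

  private variable
    f g f′ g′ : ℕ → ℤ

  ⋆-cong : (∀ i → f i ≡ f′ i) → (∀ i → g i ≡ g′ i) → ∀ i → (f ⋆ g) i ≡ (f′ ⋆ g′) i
  ⋆-cong p r zero    = ≡.cong₂ ℤ._*_ (p 0) (r 0)
  ⋆-cong p r (suc i) = ≡.cong₂ ℤ._+_ (≡.cong₂ ℤ._*_ (p 0) (r (suc i))) (⋆-cong (p ∘ suc) r i)

  ⋆-zeroˡ : (∀ i → f i ≡ 0ℤ) → ∀ i → (f ⋆ g) i ≡ 0ℤ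
  ⋆-zeroˡ {f} {g} f≡0 zero    = ≡.cong (ℤ._* g 0) (f≡0 0)
  ⋆-zeroˡ {f} {g} f≡0 (suc i) = ≡.cong₂ ℤ._+_ (≡.cong (ℤ._* g (suc i)) (f≡0 0)) (⋆-zeroˡ (f≡0 ∘ suc) i)

  ⋆-distribˡ : ∀ f g h i → (f ⋆ (λ j → g j ℤ.+ h j)) i ≡ (f ⋆ g) i ℤ.+ (f ⋆ h) i
  ⋆-distribˡ f g h zero    = ℤ.*-distribˡ-+ (f 0) (g 0) (h 0)
  ⋆-distribˡ f g h (suc i) = ≡.trans
    (≡.cong (ℤ._+_ (f 0 ℤ.* (g (suc i) ℤ.+ h (suc i)))) (⋆-distribˡ (f ∘ suc) g h i))
    (lemma (f 0) (g (suc i)) (h (suc i)) _ _)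
    where
    lemma : ∀ a x y u v → a ℤ.* (x ℤ.+ y) ℤ.+ (u ℤ.+ v) ≡ a ℤ.* x ℤ.+ u ℤ.+ (a ℤ.* y ℤ.+ v)
    lemma = ℤSolver.solve-∀

  ⋆-scaleˡ : ∀ a f g i → ((λ j → a ℤ.* f j) ⋆ g) i ≡ a ℤ.* (f ⋆ g) i
  ⋆-scaleˡ a f g zero    = ℤ.*-assoc a (f 0) (g 0)
  ⋆-scaleˡ a f g (suc i) = ≡.trans (≡.cong (ℤ._+_ (a ℤ.* f 0 ℤ.* g (suc i))) (⋆-scaleˡ a (f ∘ suc) g i))
    (lemma a (f 0) (g (suc i)) _)
    where
    lemma : ∀ a x y u → a ℤ.* x ℤ.* y ℤ.+ a ℤ.* u ≡ a ℤ.* (x ℤ.* y ℤ.+ u)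
    lemma = ℤSolver.solve-∀

  -- The definition splits off the constant term of the left factor. Splitting off that of the right
  -- factor yields commutativity and the inductions on `g` below.
  ⋆-suc : ∀ f g i → (f ⋆ g) (suc i) ≡ (f ⋆ g ∘ suc) i ℤ.+ f (suc i) ℤ.* g 0
  ⋆-suc f g zero    = ≡.refl
  ⋆-suc f g (suc i) = ≡.trans (≡.cong (ℤ._+_ (f 0 ℤ.* g (suc (suc i)))) (⋆-suc (f ∘ suc) g i)) (≡.sym (ℤ.+-assoc (f 0 ℤ.* g (suc (suc i))) _ _))

  ⋆-comm : ∀ f g i → (f ⋆ g) i ≡ (g ⋆ f) i
  ⋆-comm f g zero    = ℤ.*-comm (f 0) (g 0)
  ⋆-comm f g (suc i) = begin
    f 0 ℤ.* g (suc i) ℤ.+ (f ∘ suc ⋆ g) i    ≡⟨ ≡.cong (ℤ._+_ (f 0 ℤ.* g (suc i))) (⋆-comm (f ∘ suc) g i) ⟩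
    f 0 ℤ.* g (suc i) ℤ.+ (g ⋆ f ∘ suc) i    ≡⟨ lemma (f 0) (g (suc i)) _ ⟩
    (g ⋆ f ∘ suc) i ℤ.+ g (suc i) ℤ.* f 0    ≡⟨ ⋆-suc g f i ⟨
    (g ⋆ f) (suc i)                          ∎
    where
    lemma : ∀ a b u → a ℤ.* b ℤ.+ u ≡ u ℤ.+ b ℤ.* a
    lemma = ℤSolver.solve-∀

  ⋆-distribʳ : ∀ f g h i → ((λ j → f j ℤ.+ g j) ⋆ h) i ≡ (f ⋆ h) i ℤ.+ (g ⋆ h) i
  ⋆-distribʳ f g h i = ≡.trans (⋆-comm _ h i) (≡.trans (⋆-distribˡ h f g i) (≡.cong₂ ℤ._+_ (⋆-comm h f i) (⋆-comm h g i)))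

  ⋆-assoc : ∀ f g h i → ((f ⋆ g) ⋆ h) i ≡ (f ⋆ (g ⋆ h)) i
  ⋆-assoc f g h zero    = ℤ.*-assoc (f 0) (g 0) (h 0)
  ⋆-assoc f g h (suc i) = begin
    f 0 ℤ.* g 0 ℤ.* h (suc i) ℤ.+ ((λ j → f 0 ℤ.* g (suc j) ℤ.+ (f ∘ suc ⋆ g) j) ⋆ h) i
      ≡⟨ ≡.cong (ℤ._+_ (f 0 ℤ.* g 0 ℤ.* h (suc i))) (≡.trans (⋆-distribʳ (λ j → f 0 ℤ.* g (suc j)) (f ∘ suc ⋆ g) h i)
           (≡.cong₂ ℤ._+_ (⋆-scaleˡ (f 0) (g ∘ suc) h i) (⋆-assoc (f ∘ suc) g h i))) ⟩
    f 0 ℤ.* g 0 ℤ.* h (suc i) ℤ.+ (f 0 ℤ.* (g ∘ suc ⋆ h) i ℤ.+ (f ∘ suc ⋆ (g ⋆ h)) i)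
      ≡⟨ lemma (f 0) (g 0) (h (suc i)) _ _ ⟩
    f 0 ℤ.* (g 0 ℤ.* h (suc i) ℤ.+ (g ∘ suc ⋆ h) i) ℤ.+ (f ∘ suc ⋆ (g ⋆ h)) i ∎
    where
    lemma : ∀ a b c u v → a ℤ.* b ℤ.* c ℤ.+ (a ℤ.* u ℤ.+ v) ≡ a ℤ.* (b ℤ.* c ℤ.+ u) ℤ.+ v
    lemma = ℤSolver.solve-∀

  -- The units ±1 of ℤ, described as the integers that are their own inverses. Being a record type,
  -- it determines `c`.
  record IsUnit (c : ℤ) : Set where
    constructor isUnit
    field square : c ℤ.* c ≡ 1ℤ

  unit-cancel : ∀ {c} a → IsUnit c → c ℤ.* (c ℤ.* a) ≡ a
  unit-cancel {c} a (isUnit c²≡1) = ≡.trans (≡.sym (ℤ.*-assoc c c a)) (≡.trans (≡.cong (ℤ._* a) c²≡1) (ℤ.*-identityˡ a))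

  -- The constant term of the product is `f 0` times `g 0`, so `g 0` vanishes, and then `g` can be
  -- shifted down.
  ⋆-regular : ∀ f g → IsUnit (f 0) → (∀ i → (f ⋆ g) i ≡ 0ℤ) → ∀ i → g i ≡ 0ℤ
  ⋆-regular f g unit fg≡0 zero    = ≡.trans (≡.sym (unit-cancel (g 0) unit))
    (≡.trans (≡.cong (f 0 ℤ.*_) (fg≡0 0)) (ℤ.*-zeroʳ (f 0)))
  ⋆-regular f g unit fg≡0 (suc i) = ⋆-regular f (g ∘ suc) unit shifted i
    where
    shifted : ∀ i → (f ⋆ g ∘ suc) i ≡ 0ℤ
    shifted i = begin
      (f ⋆ g ∘ suc) i                          ≡⟨ ℤ.+-identityʳ _ ⟨
      (f ⋆ g ∘ suc) i ℤ.+ 0ℤ                   ≡⟨ ≡.cong (ℤ._+_ ((f ⋆ g ∘ suc) i)) (ℤ.*-zeroʳ (f (suc i))) ⟨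
      (f ⋆ g ∘ suc) i ℤ.+ f (suc i) ℤ.* 0ℤ     ≡⟨ ≡.cong (λ x → (f ⋆ g ∘ suc) i ℤ.+ f (suc i) ℤ.* x) (⋆-regular f g unit fg≡0 0) ⟨
      (f ⋆ g ∘ suc) i ℤ.+ f (suc i) ℤ.* g 0    ≡⟨ ⋆-suc f g i ⟨
      (f ⋆ g) (suc i)                          ≡⟨ fg≡0 (suc i) ⟩
      0ℤ                                       ∎

  -- The descent of `⋆-regular` modulo m: once g 0 = m w, removing the constant term of g subtracts
  -- m w times the tail of f from the product, so its coefficients remain multiples of m.
  ⋆-divisible : ∀ (m : ℤ) (f g h : ℕ → ℤ) → IsUnit (f 0) → (∀ i → (f ⋆ g) i ≡ m ℤ.* h i) → ∀ i → ∃[ w ] g i ≡ m ℤ.* w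
  ⋆-divisible m f g h unit fg≡mh zero    = f 0 ℤ.* h 0 , (begin
    g 0                        ≡⟨ unit-cancel (g 0) unit ⟨
    f 0 ℤ.* (f 0 ℤ.* g 0)      ≡⟨ ≡.cong (f 0 ℤ.*_) (fg≡mh 0) ⟩
    f 0 ℤ.* (m ℤ.* h 0)        ≡⟨ lemma (f 0) m (h 0) ⟩
    m ℤ.* (f 0 ℤ.* h 0)        ∎)
    where
    lemma : ∀ a b c → a ℤ.* (b ℤ.* c) ≡ b ℤ.* (a ℤ.* c)
    lemma = ℤSolver.solve-∀
  ⋆-divisible m f g h unit fg≡mh (suc i) with ⋆-divisible m f g h unit fg≡mh 0
  ... | w , g0≡mw = ⋆-divisible m f (g ∘ suc) (λ j → h (suc j) ℤ.- f (suc j) ℤ.* w) unit shifted i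
    where
    lemma₁ : ∀ x y → x ≡ (x ℤ.+ y) ℤ.- y
    lemma₁ = ℤSolver.solve-∀
    lemma₂ : ∀ m x y w → m ℤ.* x ℤ.- y ℤ.* (m ℤ.* w) ≡ m ℤ.* (x ℤ.- y ℤ.* w)
    lemma₂ = ℤSolver.solve-∀
    shifted : ∀ j → (f ⋆ g ∘ suc) j ≡ m ℤ.* (h (suc j) ℤ.- f (suc j) ℤ.* w)
    shifted j = begin
      (f ⋆ g ∘ suc) j                                      ≡⟨ lemma₁ _ (f (suc j) ℤ.* g 0) ⟩
      (f ⋆ g ∘ suc) j ℤ.+ f (suc j) ℤ.* g 0 ℤ.- f (suc j) ℤ.* g 0
        ≡⟨ ≡.cong₂ (λ x y → x ℤ.- f (suc j) ℤ.* y) (≡.trans (≡.sym (⋆-suc f g j)) (fg≡mh (suc j))) g0≡mw ⟩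
      m ℤ.* h (suc j) ℤ.- f (suc j) ℤ.* (m ℤ.* w)          ≡⟨ lemma₂ m (h (suc j)) (f (suc j)) w ⟩
      m ℤ.* (h (suc j) ℤ.- f (suc j) ℤ.* w)                ∎

  ⋆-top : ∀ e l f g → (∀ j → e < j → f j ≡ 0ℤ) → (∀ j → l < j → g j ≡ 0ℤ) →
          (f ⋆ g) (e ℕ.+ l) ≡ f e ℤ.* g l
  ⋆-top zero    zero    f g f≡0 g≡0 = ≡.refl
  ⋆-top zero    (suc l) f g f≡0 g≡0 = ≡.trans
    (≡.cong (ℤ._+_ (f 0 ℤ.* g (suc l))) (⋆-zeroˡ (λ j → f≡0 (suc j) (s≤s z≤n)) l)) (ℤ.+-identityʳ _)
  ⋆-top (suc e) l       f g f≡0 g≡0 = begin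
    f 0 ℤ.* g (suc (e ℕ.+ l)) ℤ.+ (f ∘ suc ⋆ g) (e ℕ.+ l)
      ≡⟨ ≡.cong₂ ℤ._+_ (≡.trans (≡.cong (f 0 ℤ.*_) (g≡0 _ (s≤s (ℕ.m≤n+m l e)))) (ℤ.*-zeroʳ (f 0)))
           (⋆-top e l (f ∘ suc) g (λ j e<j → f≡0 (suc j) (s≤s e<j)) g≡0) ⟩
    0ℤ ℤ.+ f (suc e) ℤ.* g l
      ≡⟨ ℤ.+-identityˡ _ ⟩
    f (suc e) ℤ.* g l ∎

open Convolution

-- The commutative ring ℤ[q]

module PolynomialRing where

  open ≡.≡-Reasoning

  infix 4 _≋_
  -- The record type determines `p` and `g`, whereas the bare function type mentions them only
  -- through `coeff`.
  record _≋_ (p g : Poly) : Set where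
    constructor coeffs
    field coeff-≡ : ∀ i → coeff p i ≡ coeff g i
  open _≋_ public

  coeff-scale : ∀ a p i → coeff (scale a p) i ≡ a ℤ.* coeff p i
  coeff-scale a []      i       = ≡.sym (ℤ.*-zeroʳ a)
  coeff-scale a (b ∷ p) zero    = ≡.refl
  coeff-scale a (b ∷ p) (suc i) = coeff-scale a p i

  coeff-add : ∀ p g i → coeff (p P.+ g) i ≡ coeff p i ℤ.+ coeff g i
  coeff-add []      g       i       = ≡.sym (ℤ.+-identityˡ _)
  coeff-add (a ∷ p) []      i       = ≡.sym (ℤ.+-identityʳ _)
  coeff-add (a ∷ p) (b ∷ g) zero    = ≡.refl
  coeff-add (a ∷ p) (b ∷ g) (suc i) = coeff-add p g i

  coeff-neg : ∀ p i → coeff (P.- p) i ≡ ℤ.- coeff p i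
  coeff-neg []      i       = ≡.refl
  coeff-neg (a ∷ p) zero    = ≡.refl
  coeff-neg (a ∷ p) (suc i) = coeff-neg p i

  -- Through this the ring laws for lists are inherited from those for convolution.
  coeff-mul : ∀ p g i → coeff (p P.* g) i ≡ (coeff p ⋆ coeff g) i
  coeff-mul []      g i = ≡.sym (⋆-zeroˡ (λ _ → ≡.refl) i)
  coeff-mul (a ∷ p) g i = ≡.trans (coeff-add (scale a g) (0ℤ ∷ p P.* g) i)
                            (≡.trans (≡.cong (ℤ._+ coeff (0ℤ ∷ p P.* g) i) (coeff-scale a g i)) (lemma i))
    where
    lemma : ∀ i → a ℤ.* coeff g i ℤ.+ coeff (0ℤ ∷ p P.* g) i ≡ (coeff (a ∷ p) ⋆ coeff g) i
    lemma zero    = ℤ.+-identityʳ _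
    lemma (suc i) = ≡.cong (ℤ._+_ (a ℤ.* coeff g (suc i))) (coeff-mul p g i)

  private
    ≋-refl : ∀ {p} → p ≋ p
    ≋-refl = coeffs λ i → ≡.refl
    ≋-trans : ∀ {p g h} → p ≋ g → g ≋ h → p ≋ h
    ≋-trans (coeffs x) (coeffs y) = coeffs λ i → ≡.trans (x i) (y i)
    ≋-sym : ∀ {p g} → p ≋ g → g ≋ p
    ≋-sym (coeffs x) = coeffs λ i → ≡.sym (x i)

    coeff-add₃ : ∀ p g h i → coeff (p P.+ g P.+ h) i ≡ coeff p i ℤ.+ coeff g i ℤ.+ coeff h i
    coeff-add₃ p g h i = ≡.trans (coeff-add (p P.+ g) h i) (≡.cong (ℤ._+ coeff h i) (coeff-add p g i))

    +-assoc : ∀ p g h → p P.+ g P.+ h ≋ p P.+ (g P.+ h)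
    +-assoc p g h = coeffs λ i → begin
      coeff (p P.+ g P.+ h) i                   ≡⟨ coeff-add₃ p g h i ⟩
      coeff p i ℤ.+ coeff g i ℤ.+ coeff h i     ≡⟨ ℤ.+-assoc (coeff p i) (coeff g i) (coeff h i) ⟩
      coeff p i ℤ.+ (coeff g i ℤ.+ coeff h i)   ≡⟨ ≡.cong (ℤ._+_ (coeff p i)) (coeff-add g h i) ⟨
      coeff p i ℤ.+ coeff (g P.+ h) i           ≡⟨ coeff-add p (g P.+ h) i ⟨
      coeff (p P.+ (g P.+ h)) i                 ∎

    +-comm : ∀ p g → p P.+ g ≋ g P.+ p
    +-comm p g = coeffs λ i → ≡.trans (coeff-add p g i) (≡.trans (ℤ.+-comm (coeff p i) (coeff g i)) (≡.sym (coeff-add g p i)))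

    +-cong : ∀ {p p′ g g′} → p ≋ p′ → g ≋ g′ → p P.+ g ≋ p′ P.+ g′
    +-cong {p} {p′} {g} {g′} (coeffs x) (coeffs y) = coeffs λ i →
      ≡.trans (coeff-add p g i) (≡.trans (≡.cong₂ ℤ._+_ (x i) (y i)) (≡.sym (coeff-add p′ g′ i)))

    *-cong : ∀ {p p′ g g′} → p ≋ p′ → g ≋ g′ → p P.* g ≋ p′ P.* g′
    *-cong {p} {p′} {g} {g′} (coeffs x) (coeffs y) = coeffs λ i →
      ≡.trans (coeff-mul p g i) (≡.trans (⋆-cong x y i) (≡.sym (coeff-mul p′ g′ i)))

    *-assoc : ∀ p g h → p P.* g P.* h ≋ p P.* (g P.* h)
    *-assoc p g h = coeffs λ i → begin
      coeff (p P.* g P.* h) i                   ≡⟨ coeff-mul (p P.* g) h i ⟩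
      (coeff (p P.* g) ⋆ coeff h) i             ≡⟨ ⋆-cong (coeff-mul p g) (λ _ → ≡.refl) i ⟩
      ((coeff p ⋆ coeff g) ⋆ coeff h) i         ≡⟨ ⋆-assoc (coeff p) (coeff g) (coeff h) i ⟩
      (coeff p ⋆ (coeff g ⋆ coeff h)) i         ≡⟨ ⋆-cong (λ _ → ≡.refl) (coeff-mul g h) i ⟨
      (coeff p ⋆ coeff (g P.* h)) i             ≡⟨ coeff-mul p (g P.* h) i ⟨
      coeff (p P.* (g P.* h)) i                 ∎

    *-comm : ∀ p g → p P.* g ≋ g P.* p
    *-comm p g = coeffs λ i → ≡.trans (coeff-mul p g i) (≡.trans (⋆-comm (coeff p) (coeff g) i) (≡.sym (coeff-mul g p i)))

    *-identityˡ : ∀ p → P.1# P.* p ≋ p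
    *-identityˡ p = coeffs λ i → ≡.trans (coeff-mul P.1# p i) (lemma i)
      where
      lemma : ∀ i → (coeff P.1# ⋆ coeff p) i ≡ coeff p i
      lemma zero    = ℤ.*-identityˡ _
      lemma (suc i) = ≡.trans (≡.cong₂ ℤ._+_ (ℤ.*-identityˡ (coeff p (suc i))) (⋆-zeroˡ {λ _ → 0ℤ} {coeff p} (λ _ → ≡.refl) i)) (ℤ.+-identityʳ _)

    distribˡ : ∀ p g h → p P.* (g P.+ h) ≋ p P.* g P.+ p P.* h
    distribˡ p g h = coeffs λ i → begin
      coeff (p P.* (g P.+ h)) i                              ≡⟨ coeff-mul p (g P.+ h) i ⟩
      (coeff p ⋆ coeff (g P.+ h)) i                          ≡⟨ ⋆-cong (λ _ → ≡.refl) (coeff-add g h) i ⟩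
      (coeff p ⋆ (λ j → coeff g j ℤ.+ coeff h j)) i          ≡⟨ ⋆-distribˡ (coeff p) (coeff g) (coeff h) i ⟩
      (coeff p ⋆ coeff g) i ℤ.+ (coeff p ⋆ coeff h) i        ≡⟨ ≡.cong₂ ℤ._+_ (coeff-mul p g i) (coeff-mul p h i) ⟨
      coeff (p P.* g) i ℤ.+ coeff (p P.* h) i                ≡⟨ coeff-add (p P.* g) (p P.* h) i ⟨
      coeff (p P.* g P.+ p P.* h) i                          ∎

    -‿inverseˡ : ∀ p → (P.- p) P.+ p ≋ P.0#
    -‿inverseˡ p = coeffs λ i → ≡.trans (coeff-add (P.- p) p i)
      (≡.trans (≡.cong (ℤ._+ coeff p i) (coeff-neg p i)) (ℤ.+-inverseˡ (coeff p i)))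

  polynomialRing : CommutativeRing 0ℓ 0ℓ
  polynomialRing = record
    { Carrier = Poly
    ; _≈_ = _≋_
    ; _+_ = P._+_
    ; _*_ = P._*_
    ; -_ = P.-_
    ; 0# = P.0#
    ; 1# = P.1#
    ; isCommutativeRing = record
      { isRing = record
        { +-isAbelianGroup = record
          { isGroup = record
            { isMonoid = record
              { isSemigroup = record
                { isMagma = record
                  { isEquivalence = record { refl = ≋-refl ; sym = ≋-sym ; trans = ≋-trans }
                  ; ∙-cong = +-cong
                  }
                ; assoc = +-assoc
                }
              ; identity = (λ p → ≋-refl) , (λ p → +-comm p P.0#)
              }
            ; inverse = -‿inverseˡ , (λ p → ≋-trans (+-comm p (P.- p)) (-‿inverseˡ p))
            ; ⁻¹-cong = λ {p} {g} p≋g → coeffs λ i →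
                ≡.trans (coeff-neg p i) (≡.trans (≡.cong ℤ.-_ (coeff-≡ p≋g i)) (≡.sym (coeff-neg g i)))
            }
          ; comm = +-comm
          }
        ; *-cong = *-cong
        ; *-assoc = *-assoc
        ; *-identity = *-identityˡ , (λ p → ≋-trans (*-comm p P.1#) (*-identityˡ p))
        ; distrib = distribˡ , λ p g h → ≋-trans (*-comm (g P.+ h) p)
            (≋-trans (distribˡ p g h) (+-cong (*-comm p g) (*-comm p h)))
        }
      ; *-comm = *-comm
      }
    }

open PolynomialRing

-- Correctness of exact division

module Division where

  open ≡.≡-Reasoning

  coeff-length : ∀ p i → length p ≤ i → coeff p i ≡ 0ℤ
  coeff-length []      i       _         = ≡.refl
  coeff-length (a ∷ p) (suc i) (s≤s p≤i) = coeff-length p i p≤i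

  -- Trailing zeros are allowed, so the length does not reveal the degree and the last nonzero
  -- coefficient has to be searched for.
  leading : ∀ p → (∀ i → coeff p i ≡ 0ℤ) ⊎ (∃[ e ] coeff p e ≢ 0ℤ × (∀ j → e < j → coeff p j ≡ 0ℤ))
  leading []      = inj₁ λ _ → ≡.refl
  leading (a ∷ p) with leading p
  ... | inj₂ (e , pe≢0 , above) = inj₂ (suc e , pe≢0 , λ { (suc j) (s≤s e<j) → above j e<j })
  ... | inj₁ p≡0 with a ℤ.≟ 0ℤ
  ...   | yes a≡0 = inj₁ λ { zero → a≡0 ; (suc i) → p≡0 i }
  ...   | no  a≢0 = inj₂ (0 , a≢0 , λ { (suc j) _ → p≡0 j })

  unit⇒≢0 : ∀ {c} → IsUnit c → c ≢ 0ℤ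
  unit⇒≢0 (isUnit ()) ≡.refl

  -- ℤ has no zero divisors, so the leading coefficients of d and w multiply to a nonzero
  -- coefficient of the product. The bound matters because `_÷_` produces no coefficients beyond the
  -- length of the dividend.
  degree-bound : ∀ d w N → IsUnit (coeff d 0) → (∀ i → N ≤ i → (coeff d ⋆ coeff w) i ≡ 0ℤ) →
                 ∀ i → N ≤ i → coeff w i ≡ 0ℤ
  degree-bound d w N unit dw≡0 with leading d
  ... | inj₁ d≡0 = ⊥-elim (unit⇒≢0 unit (d≡0 0))
  ... | inj₂ (e , de≢0 , above) = descend (length w) (λ j N+w≤j → coeff-length w j (ℕ.≤-trans (ℕ.m≤n+m _ N) N+w≤j))
    where
    -- The bound N + k from which on `w` is known to vanish is lowered one step at a time; at e + (N
    -- + k) the product then has the single summand d_e w_(N+k).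
    descend : ∀ k → (∀ j → N ℕ.+ k ≤ j → coeff w j ≡ 0ℤ) → ∀ j → N ≤ j → coeff w j ≡ 0ℤ
    descend zero    w≡0 j N≤j = w≡0 j (ℕ.≤-trans (ℕ.≤-reflexive (ℕ.+-identityʳ N)) N≤j)
    descend (suc k) w≡0 = descend k λ j N+k≤j → [ (λ N+k<j → beyond j N+k<j) , (λ { ≡.refl → top }) ]′ (ℕ.m≤n⇒m<n∨m≡n N+k≤j)
      where
      beyond : ∀ j → N ℕ.+ k < j → coeff w j ≡ 0ℤ
      beyond j N+k<j = w≡0 j (ℕ.≤-trans (ℕ.≤-reflexive (ℕ.+-suc N k)) N+k<j)
      top : coeff w (N ℕ.+ k) ≡ 0ℤ
      top with ℤ.i*j≡0⇒i≡0∨j≡0 (coeff d e) (≡.trans (≡.sym (⋆-top e (N ℕ.+ k) (coeff d) (coeff w) above beyond))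
                 (dw≡0 _ (ℕ.≤-trans (ℕ.m≤m+n N k) (ℕ.m≤n+m _ e))))
      ... | inj₁ de≡0 = ⊥-elim (de≢0 de≡0)
      ... | inj₂ w≡0  = w≡0

  -- The algorithm computes the power series u with d u = p: subtracting u_0 d from p and dropping
  -- the constant term leaves the dividend for the shifted series.
  divide-correct : ∀ fuel p d u → IsUnit (coeff d 0) → (∀ i → (coeff d ⋆ u) i ≡ coeff p i) →
                   ∀ i → i < fuel → coeff (divide fuel p d) i ≡ u i
  divide-correct (suc fuel) []      d       u unit du≡p i       _ = ≡.sym (⋆-regular (coeff d) u unit du≡p i)
  divide-correct (suc fuel) (a ∷ p) []      u (isUnit ()) du≡p i _
  divide-correct (suc fuel) (a ∷ p) (c ∷ d) u unit du≡p zero    _ =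
    ≡.trans (≡.cong (c ℤ.*_) (≡.sym (du≡p 0))) (unit-cancel (u 0) unit)
  divide-correct (suc fuel) (a ∷ p) (c ∷ d) u unit du≡p (suc i) (s≤s i<fuel) =
    divide-correct fuel (p P.- scale (c ℤ.* a) d) (c ∷ d) (u ∘ suc) unit remainder i i<fuel
    where
    lemma : ∀ x y → x ≡ x ℤ.+ y ℤ.- y
    lemma = ℤSolver.solve-∀
    remainder : ∀ j → (coeff (c ∷ d) ⋆ u ∘ suc) j ≡ coeff (p P.- scale (c ℤ.* a) d) j
    remainder j = begin
      (coeff (c ∷ d) ⋆ u ∘ suc) j
        ≡⟨ lemma _ (coeff d j ℤ.* u 0) ⟩
      (coeff (c ∷ d) ⋆ u ∘ suc) j ℤ.+ coeff d j ℤ.* u 0 ℤ.- coeff d j ℤ.* u 0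
        ≡⟨ ≡.cong (ℤ._- coeff d j ℤ.* u 0) (≡.trans (≡.sym (⋆-suc (coeff (c ∷ d)) u j)) (du≡p (suc j))) ⟩
      coeff p j ℤ.- coeff d j ℤ.* u 0
        ≡⟨ ≡.cong (λ x → coeff p j ℤ.- x) (≡.trans (ℤ.*-comm (coeff d j) (u 0))
             (≡.cong (ℤ._* coeff d j) (≡.trans (≡.sym (unit-cancel (u 0) unit)) (≡.cong (c ℤ.*_) (du≡p 0))))) ⟩
      coeff p j ℤ.- c ℤ.* a ℤ.* coeff d j
        ≡⟨ ≡.cong (λ x → coeff p j ℤ.- x) (coeff-scale (c ℤ.* a) d j) ⟨
      coeff p j ℤ.- coeff (scale (c ℤ.* a) d) j
        ≡⟨ ≡.cong (λ x → coeff p j ℤ.+ x) (coeff-neg (scale (c ℤ.* a) d) j) ⟨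
      coeff p j ℤ.+ coeff (P.- scale (c ℤ.* a) d) j
        ≡⟨ coeff-add p (P.- scale (c ℤ.* a) d) j ⟨
      coeff (p P.- scale (c ℤ.* a) d) j ∎

  divide-beyond : ∀ fuel p d i → fuel ≤ i → coeff (divide fuel p d) i ≡ 0ℤ
  divide-beyond zero       p       d       i       _ = ≡.refl
  divide-beyond (suc fuel) []      d       i       _ = ≡.refl
  divide-beyond (suc fuel) (a ∷ p) []      i       _ = ≡.refl
  divide-beyond (suc fuel) (a ∷ p) (c ∷ d) (suc i) (s≤s fuel≤i) = divide-beyond fuel _ (c ∷ d) i fuel≤i

  -- Every quotient in the definitions, from Gaussian coefficients to Φ, is identified by this
  -- lemma. Below the length of p the power series decide; above it the degree bound does.
  ÷-correct : ∀ p d w → IsUnit (coeff d 0) → d P.* w ≋ p → p P.÷ d ≋ w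
  ÷-correct p d w unit dw≋p = coeffs λ i → [ below i , above i ]′ (ℕ.<-≤-connex i (length p))
    where
    dw≡p : ∀ i → (coeff d ⋆ coeff w) i ≡ coeff p i
    dw≡p i = ≡.trans (≡.sym (coeff-mul d w i)) (coeff-≡ dw≋p i)
    below : ∀ i → i < length p → coeff (p P.÷ d) i ≡ coeff w i
    below i = divide-correct (length p) p d (coeff w) unit dw≡p i
    above : ∀ i → length p ≤ i → coeff (p P.÷ d) i ≡ coeff w i
    above i p≤i = ≡.trans (divide-beyond (length p) p d i p≤i)
      (≡.sym (degree-bound d w (length p) unit (λ j p≤j → ≡.trans (dw≡p j) (coeff-length p j p≤j)) i p≤i))

open Division

-- Divisibility and elements that fix a residue class

module Divisibility {c ℓ} (R : CommutativeRing c ℓ) where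

  open CommutativeRing R hiding (zero)
  open import Algebra.Properties.CommutativeSemigroup.Divisibility *-commutativeSemigroup public
    using (_∣_; _,_; ∣-respʳ-≈; x∣ʳy⇒x∣ʳzy; ∣ʳ-trans)
  open import Algebra.Properties.Semiring.Exp semiring using (_^_)
  open import Algebra.Properties.Semiring.Mult semiring using () renaming (_×_ to _⋅_)
  open import Relation.Binary.Reasoning.Setoid setoid
  open IntegerSolver R

  ∣-+ : ∀ {d x y} → d ∣ x → d ∣ y → d ∣ x + y
  ∣-+ (a , ad≈x) (b , bd≈y) = a + b , trans (distribʳ _ _ _) (+-cong ad≈x bd≈y)

  ∣-neg : ∀ {d x} → d ∣ x → d ∣ - x
  ∣-neg (a , ad≈x) = - a , trans (sym (-‿distribˡ-* a _)) (-‿cong ad≈x)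
    where open import Algebra.Properties.Ring ring using (-‿distribˡ-*)

  ∣-0 : ∀ d → d ∣ 0#
  ∣-0 d = 0# , zeroˡ d

  geometric : Carrier → ℕ → Carrier
  geometric x zero    = 0#
  geometric x (suc t) = x ^ t + geometric x t

  geometric-sum : ∀ x t → (x - 1#) * geometric x t ≈ x ^ t - 1#
  geometric-sum x zero    = trans (zeroʳ _) (sym (-‿inverseʳ 1#))
  geometric-sum x (suc t) = begin
    (x - 1#) * (x ^ t + geometric x t)             ≈⟨ solve 3 (λ x y g → (x :- con (+ 1)) :* (y :+ g) := (x :- con (+ 1)) :* y :+ (x :- con (+ 1)) :* g) refl _ _ _ ⟩
    (x - 1#) * x ^ t + (x - 1#) * geometric x t    ≈⟨ +-congˡ (geometric-sum x t) ⟩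
    (x - 1#) * x ^ t + (x ^ t - 1#)                ≈⟨ solve 2 (λ x y → (x :- con (+ 1)) :* y :+ (y :- con (+ 1)) := x :* y :- con (+ 1)) refl _ _ ⟩
    x ^ suc t - 1#                                 ∎

  x-1∣xᵗ-1 : ∀ x t → x - 1# ∣ x ^ t - 1#
  x-1∣xᵗ-1 x t = geometric x t , trans (*-comm _ _) (geometric-sum x t)

  module _ {d z : Carrier} where

    -- d ∣ (x - 1) z says that x fixes the class of z modulo d.
    fixes-* : ∀ {x y} → d ∣ (x - 1#) * z → d ∣ (y - 1#) * z → d ∣ (x * y - 1#) * z
    fixes-* {x} {y} d∣x d∣y = ∣-respʳ-≈
      (solve 3 (λ x y z → x :* ((y :- con (+ 1)) :* z) :+ (x :- con (+ 1)) :* z := (x :* y :- con (+ 1)) :* z) refl x y z)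
      (∣-+ (x∣ʳy⇒x∣ʳzy x d∣y) d∣x)

    fixes-^ : ∀ {x} k → d ∣ (x - 1#) * z → d ∣ (x ^ k - 1#) * z
    fixes-^ zero    d∣x = ∣-respʳ-≈ (sym (trans (*-congʳ (-‿inverseʳ 1#)) (zeroˡ z))) (∣-0 d)
    fixes-^ (suc k) d∣x = fixes-* d∣x (fixes-^ k d∣x)

    -- It takes the place of dividing by y, and later subtracts exponents in Bézout's identity.
    fixes-cancel : ∀ {x y} → d ∣ (x * y - 1#) * z → d ∣ (y - 1#) * z → d ∣ (x - 1#) * z
    fixes-cancel {x} {y} d∣xy d∣y = ∣-respʳ-≈
      (solve 3 (λ x y z → (x :* y :- con (+ 1)) :* z :+ (:- (x :* ((y :- con (+ 1)) :* z))) := (x :- con (+ 1)) :* z) refl x y z)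
      (∣-+ d∣xy (∣-neg (x∣ʳy⇒x∣ʳzy x d∣y)))

    -- Each of the t powers of x fixes z, so their sum acts on z as the integer t.
    fixes-geometric : ∀ {x} t → d ∣ (x - 1#) * z → d ∣ geometric x t * z - t ⋅ z
    fixes-geometric zero    d∣x = ∣-respʳ-≈
      (solve 1 (λ z → con (+ 0) := con (+ 0) :* z :- con (+ 0)) refl z) (∣-0 d)
    fixes-geometric {x} (suc t) d∣x = ∣-respʳ-≈
      (solve 4 (λ y z g s → (y :- con (+ 1)) :* z :+ (g :* z :- s) := (y :+ g) :* z :- (z :+ s)) refl
        (x ^ t) z (geometric x t) (t ⋅ z))
      (∣-+ (fixes-^ t d∣x) (fixes-geometric t d∣x))

-- Cyclotomic polynomials

module Cyclotomic where

  open CommutativeRing polynomialRing hiding (zero)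
  open Divisibility polynomialRing
  open import Algebra.Properties.Semiring.Exp semiring using (_^_; ^-homo-*; ^-assocʳ; ^-congʳ)
  open import Algebra.Properties.Semiring.Mult semiring using () renaming (_×_ to _⋅_)
  open import Relation.Binary.Reasoning.Setoid setoid
  open IntegerSolver polynomialRing

  ^-agrees : ∀ x n → x P.^ n ≡ x ^ n
  ^-agrees x zero    = ≡.refl
  ^-agrees x (suc n) = ≡.cong (x P.*_) (^-agrees x n)

  coeff₀-mul : ∀ p g → coeff (p * g) 0 ≡ coeff p 0 ℤ.* coeff g 0
  coeff₀-mul p g = coeff-mul p g 0

  unit-regular : ∀ d x y → IsUnit (coeff d 0) → d * x ≈ d * y → x ≈ y
  unit-regular d x y unit dx≈dy = x∙y⁻¹≈ε⇒x≈y x y (coeffs (⋆-regular (coeff d) (coeff (x - y)) unit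
    λ i → ≡.trans (≡.sym (coeff-mul d (x - y) i)) (coeff-≡ d[x-y]≈0 i)))
    where
    open import Algebra.Properties.Group +-group using (x∙y⁻¹≈ε⇒x≈y; x≈y⇒x∙y⁻¹≈ε)
    d[x-y]≈0 : d * (x - y) ≈ 0#
    d[x-y]≈0 = trans (solve 3 (λ d x y → d :* (x :- y) := d :* x :- d :* y) refl d x y) (x≈y⇒x∙y⁻¹≈ε dx≈dy)

  coeff-multiple : ∀ t z i → coeff (t ⋅ z) i ≡ + t ℤ.* coeff z i
  coeff-multiple zero    z i = ≡.refl
  coeff-multiple (suc t) z i = ≡.trans (coeff-add z (t ⋅ z) i)
    (≡.trans (≡.cong (ℤ._+_ (coeff z i)) (coeff-multiple t z i)) (lemma (+ t) (coeff z i)))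
    where
    lemma : ∀ t a → a ℤ.+ t ℤ.* a ≡ (1ℤ ℤ.+ t) ℤ.* a
    lemma = ℤSolver.solve-∀

  scalar-quotient : ∀ m z → (∀ i → ∃[ w ] coeff z i ≡ m ℤ.* w) → ∃[ g ] (∀ i → coeff z i ≡ m ℤ.* coeff g i)
  scalar-quotient m []      m∣z = [] , λ i → ≡.sym (ℤ.*-zeroʳ m)
  scalar-quotient m (a ∷ z) m∣z with m∣z 0 | scalar-quotient m z (m∣z ∘ suc)
  ... | w , a≡mw | g , z≡mg = w ∷ g , λ { zero → a≡mw ; (suc i) → z≡mg i }

  -- In x d = t z the factor d has constant term ±1 and is invertible modulo t as a power series.
  -- Hence t divides every coefficient of x and can be cancelled.
  multiple-regular : ∀ t .{{_ : NonZero t}} d z → IsUnit (coeff d 0) → d ∣ t ⋅ z → d ∣ z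
  multiple-regular t d z unit (x , xd≈tz) with scalar-quotient (+ t) x
      (⋆-divisible (+ t) (coeff d) (coeff x) (coeff z) unit dx≡tz)
    where
    dx≡tz : ∀ i → (coeff d ⋆ coeff x) i ≡ + t ℤ.* coeff z i
    dx≡tz i = ≡.trans (≡.sym (coeff-mul d x i)) (≡.trans (coeff-≡ (trans (*-comm d x) xd≈tz) i) (coeff-multiple t z i))
  ... | g , x≡tg = g , coeffs λ i → ℤ.*-cancelˡ-≡ (+ t) _ _ (step i)
    where
    step : ∀ i → + t ℤ.* coeff (g * d) i ≡ + t ℤ.* coeff z i
    step i = ≡.trans (≡.cong (ℤ._*_ (+ t)) (coeff-mul g d i))
      (≡.trans (≡.sym (⋆-scaleˡ (+ t) (coeff g) (coeff d) i))
      (≡.trans (≡.sym (⋆-cong x≡tg (λ _ → ≡.refl) i))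
      (≡.trans (≡.sym (coeff-mul x d i))
      (≡.trans (coeff-≡ xd≈tz i) (coeff-multiple t z i)))))

  properDivisors : ℕ → List ℕ
  properDivisors n = List.map toℕ (filter (λ d → toℕ d ℕ.∣? n) (allFin n))

  Φ-product : List ℕ → Poly
  Φ-product ds = foldr _*_ 1# (List.map Φ ds)

  -- Well-founded recursion unfolds once its body is seen to depend only on the values of the
  -- recursive argument, which is the role of `map-cong`.
  Φ-unfold : ∀ n → Φ n ≡ (q P.^ n P.- P.1#) P.÷ Φ-product (properDivisors n)
  Φ-unfold n = ≡.trans
    (FixPoint.unfold-wfRec <-wellFounded (λ _ → Poly) step
      (λ n eq → ≡.cong (quotient n) (map-cong (λ d → eq (toℕ<n d)) (divisors n))) {n})
    (≡.cong (quotient n) (map-∘ (divisors n)))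
    where
    divisors : ∀ n → List (Fin n)
    divisors n = filter (λ d → toℕ d ℕ.∣? n) (allFin n)
    quotient : ℕ → List Poly → Poly
    quotient n ps = (q P.^ n P.- P.1#) P.÷ foldr P._*_ P.1# ps
    step : ∀ n → (∀ {m} → m < n → Poly) → Poly
    step n Φ<n = quotient n (List.map (λ d → Φ<n (toℕ<n d)) (divisors n))

  -- The three facts support one another in a strong induction: regularity modulo the smaller Φ_d
  -- lets their product divide q^n - 1, the constant term of Φ_n follows from the factorisation, and
  -- both enter the regularity modulo Φ_n.
  record Factorisation (n : ℕ) : Set where
    field
      Φ-unit    : IsUnit (coeff (Φ n) 0)
      Φ-factor  : Φ n * Φ-product (properDivisors n) ≈ q ^ n - 1#
      Φ-regular : ∀ k z → 0 < k → k < n → Φ n ∣ (q ^ k - 1#) * z → Φ n ∣ z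

  open Factorisation

  Φ∣qⁿ-1 : ∀ {n} → Factorisation n → Φ n ∣ q ^ n - 1#
  Φ∣qⁿ-1 {n} F = Φ-product (properDivisors n) , trans (*-comm (Φ-product (properDivisors n)) (Φ n)) (Φ-factor F)

  Φ-product-unit : ∀ {ds} → All (λ d → 0 < d × Factorisation d) ds → IsUnit (coeff (Φ-product ds) 0)
  Φ-product-unit []                          = isUnit ≡.refl
  Φ-product-unit {d ∷ ds} ((_ , F) ∷ Fs) with Φ-unit F | Φ-product-unit Fs
  ... | isUnit a²≡1 | isUnit b²≡1 = isUnit (≡.trans (≡.cong (λ x → x ℤ.* x) (coeff₀-mul (Φ d) (Φ-product ds)))
    (≡.trans (lemma (coeff (Φ d) 0) (coeff (Φ-product ds) 0)) (≡.cong₂ ℤ._*_ a²≡1 b²≡1)))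
    where
    lemma : ∀ a b → a ℤ.* b ℤ.* (a ℤ.* b) ≡ a ℤ.* a ℤ.* (b ℤ.* b)
    lemma = ℤSolver.solve-∀

  -- Each factor Φ_d can be cancelled modulo a later Φ_e, because it divides q^d - 1 with d < e.
  Φ-product-∣ : ∀ {ds} x → AllPairs _<_ ds → All (λ d → 0 < d × Factorisation d) ds →
                All (λ d → Φ d ∣ x) ds → Φ-product ds ∣ x
  Φ-product-∣ x []            []             []                  = x , *-identityʳ x
  Φ-product-∣ {d ∷ ds} x (d<ds ∷ sorted) ((0<d , F) ∷ Fs) ((y , yΦ≈x) ∷ Φs∣x) with
    Φ-product-∣ y sorted Fs (All.zipWith cancel (d<ds , All.zip (Fs , Φs∣x)))
    where
    cancel : ∀ {e} → d < e × (0 < e × Factorisation e) × Φ e ∣ x → Φ e ∣ y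
    cancel {e} (d<e , (_ , G) , Φe∣x) = Φ-regular G d y 0<d d<e (∣-respʳ-≈
      (trans (sym (*-assoc (Φ-product (properDivisors d)) (Φ d) y)) (*-congʳ {y} Φ-factor-comm))
      (x∣ʳy⇒x∣ʳzy (Φ-product (properDivisors d)) (∣-respʳ-≈ (trans (sym yΦ≈x) (*-comm y (Φ d))) Φe∣x)))
      where
      Φ-factor-comm : Φ-product (properDivisors d) * Φ d ≈ q ^ d - 1#
      Φ-factor-comm = trans (*-comm (Φ-product (properDivisors d)) (Φ d)) (Φ-factor F)
  ... | w , wΠ≈y = w , (begin
    w * (Φ d * Φ-product ds)      ≈⟨ solve 3 (λ w a b → w :* (a :* b) := w :* b :* a) refl w (Φ d) (Φ-product ds) ⟩
    w * Φ-product ds * Φ d        ≈⟨ *-congʳ wΠ≈y ⟩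
    y * Φ d                       ≈⟨ yΦ≈x ⟩
    x                             ∎)

  Φ-product-snoc : ∀ ds e → Φ-product (ds ++ e ∷ []) ≈ Φ-product ds * Φ e
  Φ-product-snoc []       e = *-comm (Φ e) 1#
  Φ-product-snoc (d ∷ ds) e = trans (*-congˡ {Φ d} (Φ-product-snoc ds e)) (sym (*-assoc (Φ d) (Φ-product ds) (Φ e)))

  properDivisors-sorted : ∀ n → AllPairs _<_ (properDivisors n)
  properDivisors-sorted n = AllPairs.map⁺ (AllPairs.filter⁺ _ (AllPairs.tabulate⁺-< (λ i<j → i<j)))

  properDivisors-sound : ∀ n → All (λ d → d < n × d ℕ.∣ n) (properDivisors n)
  properDivisors-sound n = All.map⁺ (All.map (λ {d} d∣n → toℕ<n d , d∣n) (All.all-filter _ (allFin n)))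

  positive : ∀ {d n} → 0 < n → d ℕ.∣ n → 0 < d
  positive {zero}  0<n 0∣n with ℕ.0∣⇒≡0 0∣n
  positive {zero}  ()  0∣n | ≡.refl
  positive {suc d} _   _   = s≤s z≤n

  qᵈ-1∣qⁿ-1 : ∀ {d n} → d ℕ.∣ n → q ^ d - 1# ∣ q ^ n - 1#
  qᵈ-1∣qⁿ-1 {d} {n} (ℕ.divides t n≡td) = ∣-respʳ-≈
    (+-congʳ (trans (^-assocʳ q d t) (^-congʳ q (≡.trans (ℕ.*-comm d t) (≡.sym n≡td)))))
    (x-1∣xᵗ-1 (q ^ d) t)

  ∈⇒Φ∣Φ-product : ∀ {ds e} → e ∈ ds → Φ e ∣ Φ-product ds
  ∈⇒Φ∣Φ-product {d ∷ ds} (here ≡.refl) = Φ-product ds , *-comm (Φ-product ds) (Φ d)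
  ∈⇒Φ∣Φ-product {d ∷ ds} (there e∈ds)  = x∣ʳy⇒x∣ʳzy (Φ d) (∈⇒Φ∣Φ-product e∈ds)

  properDivisors-complete : ∀ {d n} → d < n → d ℕ.∣ n → d ∈ properDivisors n
  properDivisors-complete {d} {n} d<n d∣n = ≡.subst (_∈ properDivisors n) (toℕ-fromℕ< d<n)
    (∈-map⁺ toℕ (∈-filter⁺ (λ d → toℕ d ℕ.∣? n) (∈-allFin _) (≡.subst (ℕ._∣ n) (≡.sym (toℕ-fromℕ< d<n)) d∣n)))

  private module Step (n : ℕ) (0<n : 0 < n) (IH : ∀ {d} → d < n → 0 < d → Factorisation d) where

    Π : Poly
    Π = Φ-product (properDivisors n)

    Fs : All (λ d → 0 < d × Factorisation d) (properDivisors n)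
    Fs = All.map (λ { (d<n , d∣n) → let 0<d = positive 0<n d∣n in 0<d , IH d<n 0<d }) (properDivisors-sound n)

    Π-unit : IsUnit (coeff Π 0)
    Π-unit = Φ-product-unit Fs

    Π∣qⁿ-1 : Π ∣ q ^ n - 1#
    Π∣qⁿ-1 = Φ-product-∣ (q ^ n - 1#) (properDivisors-sorted n) Fs
      (All.map (λ { (d<n , d∣n) → ∣ʳ-trans (Φ∣qⁿ-1 (IH d<n (positive 0<n d∣n))) (qᵈ-1∣qⁿ-1 d∣n) }) (properDivisors-sound n))

    factor : Φ n * Π ≈ q ^ n - 1#
    factor with Π∣qⁿ-1
    ... | w , wΠ≈qⁿ-1 = trans (*-congʳ {Π} Φ≈w) wΠ≈qⁿ-1
      where
      Φ≈w : Φ n ≈ w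
      Φ≈w = trans (reflexive (Φ-unfold n)) (÷-correct (q P.^ n P.- P.1#) Π w Π-unit
        (trans (*-comm Π w) (trans wΠ≈qⁿ-1 (reflexive (≡.cong (λ x → x - 1#) (≡.sym (^-agrees q n)))))))

    constant : ∀ {m} → 0 < m → coeff (q ^ m - 1#) 0 ≡ -1ℤ
    constant {suc m} _ = ≡.trans (coeff-add (q * q ^ m) (- 1#) 0) (≡.cong (λ x → x ℤ.+ -1ℤ) (coeff₀-mul q (q ^ m)))

    unit : IsUnit (coeff (Φ n) 0)
    unit with Π-unit
    ... | isUnit b²≡1 = isUnit (≡.trans (≡.sym (ℤ.*-identityʳ (a ℤ.* a))) (≡.trans (≡.cong (ℤ._*_ (a ℤ.* a)) (≡.sym b²≡1))
      (≡.trans (lemma a b) (≡.cong (λ x → x ℤ.* x) ab≡-1))))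
      where
      a = coeff (Φ n) 0
      b = coeff Π 0
      ab≡-1 : a ℤ.* b ≡ -1ℤ
      ab≡-1 = ≡.trans (≡.sym (coeff₀-mul (Φ n) Π)) (≡.trans (coeff-≡ factor 0) (constant 0<n))
      lemma : ∀ a b → a ℤ.* a ℤ.* (b ℤ.* b) ≡ a ℤ.* b ℤ.* (a ℤ.* b)
      lemma = ℤSolver.solve-∀

    -- All divisors of g are proper divisors of n. The product of Φ_d over them is q^g - 1, each of
    -- these Φ_d divides `Π`, and `Φ-product-∣` passes from the factors to their product.
    qᵍ-1∣Π : ∀ {g} → g < n → g ℕ.∣ n → q ^ g - 1# ∣ Π
    qᵍ-1∣Π {g} g<n g∣n with Φ-product-∣ Π sorted factorisations divides
      where
      0<g = positive 0<n g∣n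
      ds = properDivisors g ++ g ∷ []
      sorted : AllPairs _<_ ds
      sorted = AllPairs.++⁺ (properDivisors-sorted g) ([] ∷ [])
        (All.map (λ { (d<g , _) → d<g ∷ [] }) (properDivisors-sound g))
      factorisations : All (λ d → 0 < d × Factorisation d) ds
      factorisations = All.++⁺
        (All.map (λ { (d<g , d∣g) → let 0<d = positive 0<g d∣g in 0<d , IH (ℕ.<-trans d<g g<n) 0<d }) (properDivisors-sound g))
        ((0<g , IH g<n 0<g) ∷ [])
      divides : All (λ d → Φ d ∣ Π) ds
      divides = All.++⁺
        (All.map (λ { (d<g , d∣g) → ∈⇒Φ∣Φ-product (properDivisors-complete (ℕ.<-trans d<g g<n) (ℕ.∣-trans d∣g g∣n)) }) (properDivisors-sound g))
        (∈⇒Φ∣Φ-product (properDivisors-complete g<n g∣n) ∷ [])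
    ... | x , xΠ≈Π = x , trans (*-congˡ {x} (sym (trans (Φ-product-snoc (properDivisors g) g)
        (trans (*-comm (Φ-product (properDivisors g)) (Φ g)) (Φ-factor (IH g<n (positive 0<n g∣n))))))) xΠ≈Π

    -- The class of z is fixed by q^g with g = gcd k n, so (q^n - 1) / (q^g - 1), a multiple
    -- of Φ_n, acts on it as the integer n / g.
    regular : ∀ k z → 0 < k → k < n → Φ n ∣ (q ^ k - 1#) * z → Φ n ∣ z
    regular k z 0<k k<n fixed with ℕ.gcd[m,n]∣n k n
    ... | ℕ.divides t n≡tg = multiple-regular t {{t≢0}} (Φ n) z unit
      (∣-respʳ-≈ (solve 2 (λ x y → x :+ (:- (x :- y)) := y) refl (geometric (q ^ g) t * z) (t ⋅ z))
        (∣-+ Φ∣geometric (∣-neg (fixes-geometric t fixed-gcd))))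
      where
      g = ℕ.gcd k n
      g∣n : g ℕ.∣ n
      g∣n = ℕ.gcd[m,n]∣n k n
      g<n : g < n
      g<n = ℕ.≤-<-trans (ℕ.∣⇒≤ {{ℕ.>-nonZero 0<k}} (ℕ.gcd[m,n]∣m k n)) k<n
      t≢0 : NonZero t
      t≢0 = ℕ.≢-nonZero λ { ≡.refl → ℕ.<⇒≢ 0<n (≡.sym n≡tg) }
      fixed-n : Φ n ∣ (q ^ n - 1#) * z
      fixed-n = ∣-respʳ-≈ (trans (sym (*-assoc Π (Φ n) z)) (*-congʳ {z} (trans (*-comm Π (Φ n)) factor)))
        (x∣ʳy⇒x∣ʳzy Π (z , *-comm z (Φ n)))
      power : ∀ m x → Φ n ∣ ((q ^ m) ^ x - 1#) * z → Φ n ∣ (q ^ (x ℕ.* m) - 1#) * z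
      power m x = ∣-respʳ-≈ (*-congʳ {z} (+-congʳ (trans (^-assocʳ q m x) (^-congʳ q (ℕ.*-comm m x)))))
      -- Bézout's identity in ℕ has two forms, with k and n exchanged. Both read g + y j = x i, so
      -- one argument treats them together.
      combine : ∀ i j x y → g ℕ.+ y ℕ.* j ≡ x ℕ.* i → Φ n ∣ (q ^ i - 1#) * z → Φ n ∣ (q ^ j - 1#) * z →
                Φ n ∣ (q ^ g - 1#) * z
      combine i j x y eq fixed-i fixed-j = fixes-cancel {x = q ^ g} {y = q ^ (y ℕ.* j)}
        (∣-respʳ-≈ (*-congʳ {z} (+-congʳ (trans (^-congʳ q (≡.sym eq)) (^-homo-* q g (y ℕ.* j))))) (power i x (fixes-^ x fixed-i)))
        (power j y (fixes-^ y fixed-j))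
      fixed-gcd : Φ n ∣ (q ^ g - 1#) * z
      fixed-gcd with ℕ.Bézout.identity (ℕ.gcd-GCD k n)
      ... | ℕ.Bézout.+- x y eq = combine k n x y eq fixed fixed-n
      ... | ℕ.Bézout.-+ x y eq = combine n k y x eq fixed-n fixed
      -- Two factorisations of q^n - 1 are compared, and q^g - 1, with constant term - 1, is
      -- cancelled; this exhibits the geometric sum as a multiple of Φ_n.
      Φ∣geometric : Φ n ∣ geometric (q ^ g) t * z
      Φ∣geometric with qᵍ-1∣Π g<n g∣n
      ... | x , xqᵍ-1≈Π = ∣-respʳ-≈ (*-congʳ {z} (sym (unit-regular (q ^ g - 1#) (geometric (q ^ g) t) (x * Φ n)
              (isUnit (≡.cong (λ x → x ℤ.* x) (constant (positive 0<n g∣n))))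
              (begin
                (q ^ g - 1#) * geometric (q ^ g) t   ≈⟨ geometric-sum (q ^ g) t ⟩
                (q ^ g) ^ t - 1#                     ≈⟨ +-congʳ (trans (^-assocʳ q g t) (^-congʳ q (≡.trans (ℕ.*-comm g t) (≡.sym n≡tg)))) ⟩
                q ^ n - 1#                           ≈⟨ factor ⟨
                Φ n * Π                              ≈⟨ *-congˡ {Φ n} xqᵍ-1≈Π ⟨
                Φ n * (x * (q ^ g - 1#))             ≈⟨ solve 3 (λ a x y → a :* (x :* y) := y :* (x :* a)) refl (Φ n) x (q ^ g - 1#) ⟩
                (q ^ g - 1#) * (x * Φ n)             ∎))))
            (∣-respʳ-≈ (solve 3 (λ z x a → z :* (x :* a) := x :* a :* z) refl z x (Φ n)) (x∣ʳy⇒x∣ʳzy z (x , refl)))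

    factorisation : Factorisation n
    factorisation = record { Φ-unit = unit ; Φ-factor = factor ; Φ-regular = regular }

  Φ-factorisation : ∀ n → 0 < n → Factorisation n
  Φ-factorisation = <-rec (λ n → 0 < n → Factorisation n) λ n IH 0<n → Step.factorisation n 0<n IH

-- The q-Catalan numbers in ℤ[q]

module CatalanPolynomial where

  open CommutativeRing polynomialRing hiding (zero)
  open Divisibility polynomialRing using (geometric; geometric-sum)
  open Cyclotomic using (^-agrees; coeff₀-mul; unit-regular)
  open import Algebra.Properties.Semiring.Exp semiring using (_^_)
  open import Relation.Binary.Reasoning.Setoid setoid
  open IntegerSolver polynomialRing
  open QBinomial polynomialRing q

  pochhammer-rising : ∀ n → pochhammer q n ≈ rising 0 n
  pochhammer-rising n = go n 0 _ (λ j → reflexive (≡.cong (λ x → 1# - q * x) (^-agrees q (toℕ j))))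
    where
    go : ∀ n a (f : Fin n → Poly) → (∀ j → f j ≈ 1# - q ^ suc (a ℕ.+ toℕ j)) → P.product {n} f ≈ rising a n
    go zero    a f f≈ = refl
    go (suc n) a f f≈ = *-cong {f fzero} {1# - q ^ suc a}
      (trans (f≈ fzero) (reflexive (≡.cong (λ i → 1# - q ^ suc i) (ℕ.+-identityʳ a))))
      (go n (suc a) (f ∘ fsuc) (λ j → trans (f≈ (fsuc j)) (reflexive (≡.cong (λ i → 1# - q ^ suc i) (ℕ.+-suc a (toℕ j))))))

  constant-1-qⁿ : ∀ n → coeff (1# - q ^ suc n) 0 ≡ 1ℤ
  constant-1-qⁿ n = ≡.trans (coeff-add 1# (- (q ^ suc n)) 0) (≡.trans (≡.cong (ℤ._+_ 1ℤ) (coeff-neg (q ^ suc n) 0))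
    (≡.cong (λ x → 1ℤ ℤ.- x) (coeff₀-mul q (q ^ n))))

  constant-rising : ∀ a k → coeff (rising a k) 0 ≡ 1ℤ
  constant-rising a zero    = ≡.refl
  constant-rising a (suc k) = ≡.trans (coeff₀-mul (1# - q ^ suc a) (rising (suc a) k))
    (≡.cong₂ ℤ._*_ (constant-1-qⁿ a) (constant-rising (suc a) k))

  1-unit : ∀ {x} → x ≡ 1ℤ → IsUnit x
  1-unit ≡.refl = isUnit ≡.refl

  gaussian-binom : ∀ a k → gaussian (k ℕ.+ a) k ≈ binom a k
  gaussian-binom a k with k ℕ.≤? k ℕ.+ a
  ... | no  k≰k+a = ⊥-elim (k≰k+a (ℕ.m≤m+n k a))
  ... | yes _ = ÷-correct (pochhammer q (k ℕ.+ a)) (pochhammer q k * pochhammer q (k ℕ.+ a ℕ.∸ k)) (binom a k)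
      (1-unit (≡.trans (coeff-≡ denominator 0) (≡.trans (coeff₀-mul (rising 0 k) (rising 0 a))
        (≡.cong₂ ℤ._*_ (constant-rising 0 k) (constant-rising 0 a)))))
      (begin
        pochhammer q k * pochhammer q (k ℕ.+ a ℕ.∸ k) * binom a k   ≈⟨ *-congʳ {binom a k} denominator ⟩
        rising 0 k * rising 0 a * binom a k                         ≈⟨ solve 3 (λ x y z → x :* y :* z := y :* (z :* x)) refl (rising 0 k) (rising 0 a) (binom a k) ⟩
        rising 0 a * (binom a k * rising 0 k)                       ≈⟨ *-congˡ {rising 0 a} (binom-rising a k) ⟩
        rising 0 a * rising a k                                     ≈⟨ rising-+ a k ⟩
        rising 0 (a ℕ.+ k)                                          ≡⟨ ≡.cong (rising 0) (ℕ.+-comm a k) ⟩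
        rising 0 (k ℕ.+ a)                                          ≈⟨ pochhammer-rising (k ℕ.+ a) ⟨
        pochhammer q (k ℕ.+ a)                                      ∎)
    where
    denominator : pochhammer q k * pochhammer q (k ℕ.+ a ℕ.∸ k) ≈ rising 0 k * rising 0 a
    denominator = *-cong {pochhammer q k} {rising 0 k} (pochhammer-rising k)
      (trans (pochhammer-rising (k ℕ.+ a ℕ.∸ k)) (reflexive (≡.cong (rising 0) (ℕ.m+n∸m≡n k a))))

  geometric-1-q : ∀ n → (1# - q) * geometric q n ≈ 1# - q ^ n
  geometric-1-q n = begin
    (1# - q) * geometric q n        ≈⟨ solve 2 (λ x g → (con (+ 1) :- x) :* g := :- ((x :- con (+ 1)) :* g)) refl q (geometric q n) ⟩
    - ((q - 1#) * geometric q n)    ≈⟨ -‿cong (geometric-sum q n) ⟩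
    - (q ^ n - 1#)                  ≈⟨ solve 1 (λ x → :- (x :- con (+ 1)) := con (+ 1) :- x) refl (q ^ n) ⟩
    1# - q ^ n                      ∎

  bracket-geometric : ∀ n → bracket n ≈ geometric q n
  bracket-geometric n = ÷-correct (1# - q P.^ n) (1# - q) (geometric q n) (isUnit ≡.refl)
    (trans (geometric-1-q n) (reflexive (≡.cong (λ x → 1# - x) (≡.sym (^-agrees q n)))))

  nextBinom-absorb : ∀ k → (1# - q ^ suc k) * nextBinom k ≈ (1# - q ^ k) * binom k k
  nextBinom-absorb zero    = solve 1 (λ x → (con (+ 1) :- x) :* con (+ 0) := (con (+ 1) :- con (+ 1)) :* con (+ 1)) refl (q ^ 1)
  nextBinom-absorb (suc k) = binom-absorb k (suc k)

  -- By absorption, 1 - q^(k+1) times the right-hand side is ((1 - q^(k+1)) - q (1 - q^k)) [2k, k] =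
  -- (1 - q) [2k, k]. The factor 1 - q, which turns the geometric sum into 1 - q^(k+1), is cancelled
  -- by its constant term 1.
  catalan-binom : ∀ k → catalan k ≈ binom k k - q * nextBinom k
  catalan-binom k = ÷-correct (gaussian (2 ℕ.* k) k) (bracket (k ℕ.+ 1)) w
      (1-unit (≡.trans (coeff-≡ bracket≈ 0) constant-geometric)) (begin
        bracket (k ℕ.+ 1) * w            ≈⟨ *-congʳ {w} bracket≈ ⟩
        geometric q (suc k) * w          ≈⟨ unit-regular (1# - q) (geometric q (suc k) * w) (binom k k) (isUnit ≡.refl) cleared ⟩
        binom k k                        ≈⟨ gaussian-binom k k ⟨
        gaussian (k ℕ.+ k) k             ≡⟨ ≡.cong (λ i → gaussian (k ℕ.+ i) k) (ℕ.+-identityʳ k) ⟨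
        gaussian (2 ℕ.* k) k             ∎)
    where
    w = binom k k - q * nextBinom k
    bracket≈ : bracket (k ℕ.+ 1) ≈ geometric q (suc k)
    bracket≈ = trans (bracket-geometric (k ℕ.+ 1)) (reflexive (≡.cong (geometric q) (ℕ.+-comm k 1)))
    constant-geometric : coeff (geometric q (suc k)) 0 ≡ 1ℤ
    constant-geometric = ≡.trans (≡.sym (ℤ.*-identityˡ _)) (≡.trans (≡.sym (coeff₀-mul (1# - q) (geometric q (suc k))))
      (≡.trans (coeff-≡ (geometric-1-q (suc k)) 0) (constant-1-qⁿ k)))
    cleared : (1# - q) * (geometric q (suc k) * w) ≈ (1# - q) * binom k k
    cleared = begin
      (1# - q) * (geometric q (suc k) * w)
        ≈⟨ *-assoc (1# - q) (geometric q (suc k)) w ⟨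
      (1# - q) * geometric q (suc k) * w
        ≈⟨ *-congʳ {w} (geometric-1-q (suc k)) ⟩
      (1# - q ^ suc k) * (binom k k - q * nextBinom k)
        ≈⟨ solve 4 (λ y b x c → y :* (b :- x :* c) := y :* b :- x :* (y :* c)) refl (1# - q ^ suc k) (binom k k) q (nextBinom k) ⟩
      (1# - q ^ suc k) * binom k k - q * ((1# - q ^ suc k) * nextBinom k)
        ≈⟨ +-congˡ {(1# - q ^ suc k) * binom k k} (-‿cong (*-congˡ {q} (nextBinom-absorb k))) ⟩
      (1# - q * q ^ k) * binom k k - q * ((1# - q ^ k) * binom k k)
        ≈⟨ solve 3 (λ x y b → (con (+ 1) :- x :* y) :* b :- x :* ((con (+ 1) :- y) :* b) := (con (+ 1) :- x) :* b) refl q (q ^ k) (binom k k) ⟩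
      (1# - q) * binom k k ∎

-- Quotient of a commutative ring by a principal ideal

module Quotient {c ℓ} (R : CommutativeRing c ℓ) (d : CommutativeRing.Carrier R) where

  open CommutativeRing R hiding (zero)
  open Divisibility R
  open IntegerSolver R

  infix 4 _~_
  record _~_ (x y : Carrier) : Set (c ⊔ ℓ) where
    constructor congruent
    field difference : d ∣ x - y
  open _~_ public

  ≈⇒~ : ∀ {x y} → x ≈ y → x ~ y
  ≈⇒~ {x} {y} x≈y = congruent (∣-respʳ-≈ (sym (trans (+-congʳ x≈y) (-‿inverseʳ y))) (∣-0 d))

  private
    via : ∀ {x y z} → d ∣ z → z ≈ x - y → x ~ y
    via d∣z z≈ = congruent (∣-respʳ-≈ z≈ d∣z)

    ~-sym : ∀ {x y} → x ~ y → y ~ x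
    ~-sym {x} {y} (congruent p) = via (∣-neg p) (solve 2 (λ x y → :- (x :- y) := y :- x) refl x y)

    ~-trans : ∀ {x y z} → x ~ y → y ~ z → x ~ z
    ~-trans {x} {y} {z} (congruent p) (congruent r) = via (∣-+ p r)
      (solve 3 (λ x y z → x :- y :+ (y :- z) := x :- z) refl x y z)

    ~-+-cong : ∀ {x x′ y y′} → x ~ x′ → y ~ y′ → x + y ~ x′ + y′
    ~-+-cong {x} {x′} {y} {y′} (congruent p) (congruent r) = via (∣-+ p r)
      (solve 4 (λ x x′ y y′ → x :- x′ :+ (y :- y′) := x :+ y :- (x′ :+ y′)) refl x x′ y y′)

    ~-*-cong : ∀ {x x′ y y′} → x ~ x′ → y ~ y′ → x * y ~ x′ * y′
    ~-*-cong {x} {x′} {y} {y′} (congruent p) (congruent r) = via (∣-+ (x∣ʳy⇒x∣ʳzy y p) (x∣ʳy⇒x∣ʳzy x′ r))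
      (solve 4 (λ x x′ y y′ → y :* (x :- x′) :+ x′ :* (y :- y′) := x :* y :- x′ :* y′) refl x x′ y y′)

    ~-neg-cong : ∀ {x y} → x ~ y → - x ~ - y
    ~-neg-cong {x} {y} (congruent p) = via (∣-neg p) (solve 2 (λ x y → :- (x :- y) := :- x :- (:- y)) refl x y)

  -- The carrier stays and only the equality is coarsened. The projection is the identity, and
  -- Gaussian coefficients formed before and after it agree up to `≡`.
  quotientRing : CommutativeRing c (c ⊔ ℓ)
  quotientRing = record
    { Carrier = Carrier
    ; _≈_ = _~_
    ; _+_ = _+_
    ; _*_ = _*_
    ; -_ = -_
    ; 0# = 0#
    ; 1# = 1#
    ; isCommutativeRing = record
      { isRing = record
        { +-isAbelianGroup = record
          { isGroup = record
            { isMonoid = record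
              { isSemigroup = record
                { isMagma = record
                  { isEquivalence = record { refl = ≈⇒~ refl ; sym = ~-sym ; trans = ~-trans }
                  ; ∙-cong = ~-+-cong
                  }
                ; assoc = λ x y z → ≈⇒~ (+-assoc x y z)
                }
              ; identity = (λ x → ≈⇒~ (+-identityˡ x)) , (λ x → ≈⇒~ (+-identityʳ x))
              }
            ; inverse = (λ x → ≈⇒~ (-‿inverseˡ x)) , (λ x → ≈⇒~ (-‿inverseʳ x))
            ; ⁻¹-cong = ~-neg-cong
            }
          ; comm = λ x y → ≈⇒~ (+-comm x y)
          }
        ; *-cong = ~-*-cong
        ; *-assoc = λ x y z → ≈⇒~ (*-assoc x y z)
        ; *-identity = (λ x → ≈⇒~ (*-identityˡ x)) , (λ x → ≈⇒~ (*-identityʳ x))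
        ; distrib = (λ x y z → ≈⇒~ (distribˡ x y z)) , (λ x y z → ≈⇒~ (distribʳ x y z))
        }
      ; *-comm = λ x y → ≈⇒~ (*-comm x y)
      }
    }

import Algebra.Definitions.RawMagma L.*-rawMagma as L∣

-- Laurent polynomials modulo Φ_n

module Evaluation (n : ℕ) (0<n : 0 < n) where

  open Cyclotomic using (Φ-factorisation; Φ∣qⁿ-1)
  open Cyclotomic.Factorisation (Φ-factorisation n 0<n) using (Φ-regular)
  open Quotient polynomialRing (Φ n)
  open Divisibility polynomialRing using (_∣_; ∣-neg; ∣-respʳ-≈; _,_)
  private
    module ℤ[q] = CommutativeRing polynomialRing

  open import Algebra.Properties.Semiring.Exp ℤ[q].semiring using () renaming (_^_ to _^ᴾ_)

  open CommutativeRing quotientRing hiding (zero)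
  open import Algebra.Properties.Semiring.Exp semiring using (_^_; ^-homo-*; ^-congʳ; ^-congˡ)
  open import Algebra.Properties.Semiring.Sum semiring using (sum)
  open import Relation.Binary.Reasoning.Setoid setoid
  open IntegerSolver quotientRing
  open IntegerSolver polynomialRing using ()
    renaming (solve to solveᴾ; _:=_ to _:=ᴾ_; _:*_ to _:*ᴾ_; _:-_ to _:-ᴾ_; :-_ to :-ᴾ_; con to conᴾ)

  ^-quotient : ∀ x k → x ^ᴾ k ≡ x ^ k
  ^-quotient x zero    = ≡.refl
  ^-quotient x (suc k) = ≡.cong (x *_) (^-quotient x k)

  ^-raw : ∀ x k → x P.^ k ≡ x ^ k
  ^-raw x zero    = ≡.refl
  ^-raw x (suc k) = ≡.cong (x *_) (^-raw x k)

  ∣⇒≈0 : ∀ {x} → Φ n ∣ x → x ≈ 0#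
  ∣⇒≈0 {x} Φ∣x = congruent (∣-respʳ-≈ (solveᴾ 1 (λ x → x :=ᴾ x :-ᴾ conᴾ (+ 0)) ℤ[q].refl x) Φ∣x)

  ≈0⇒∣ : ∀ {x} → x ≈ 0# → Φ n ∣ x
  ≈0⇒∣ {x} (congruent Φ∣x) = ∣-respʳ-≈ (solveᴾ 1 (λ x → x :-ᴾ conᴾ (+ 0) :=ᴾ x) ℤ[q].refl x) Φ∣x

  qⁿ≈1 : q ^ n ≈ 1#
  qⁿ≈1 = ≡.subst (_≈ 1#) (^-quotient q n) (congruent (Φ∣qⁿ-1 (Φ-factorisation n 0<n)))

  q⁻¹ : Poly
  q⁻¹ = q ^ ℕ.pred n

  q⁻¹*q≈1 : q⁻¹ * q ≈ 1#
  q⁻¹*q≈1 = trans (*-comm q⁻¹ q) (trans (^-congʳ q (ℕ.suc-pred n {{ℕ.>-nonZero 0<n}})) qⁿ≈1)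

  cancel : ∀ k z → 0 < k → k < n → (1# - q ^ k) * z ≈ 0# → z ≈ 0#
  cancel k z 0<k k<n eq = ∣⇒≈0 (Φ-regular k z 0<k k<n (≡.subst (λ x → Φ n ∣ (x - 1#) * z) (≡.sym (^-quotient q k))
    (∣-respʳ-≈ (solveᴾ 2 (λ x z → :-ᴾ ((conᴾ (+ 1) :-ᴾ x) :*ᴾ z) :=ᴾ (x :-ᴾ conᴾ (+ 1)) :*ᴾ z) ℤ[q].refl (q ^ k) z)
      (∣-neg (≈0⇒∣ eq)))))

  open RootOfUnity.Primitive quotientRing q q⁻¹ q⁻¹*q≈1 n qⁿ≈1 cancel public

  private module QP = QBinomial polynomialRing q

  binom-quotient : ∀ a k → QP.binom a k ≡ binom a k
  binom-quotient a       zero    = ≡.refl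
  binom-quotient zero    (suc k) = ≡.refl
  binom-quotient (suc a) (suc k) = ≡.cong₂ _+_ (binom-quotient a (suc k))
    (≡.cong₂ _*_ (^-quotient q (suc a)) (binom-quotient (suc a) k))

  nextBinom-quotient : ∀ k → QP.nextBinom k ≡ nextBinom k
  nextBinom-quotient zero    = ≡.refl
  nextBinom-quotient (suc k) = binom-quotient k (2 ℕ.+ k)

  fib-raw : ∀ m t → fibonacci m t ≡ fib m t
  fib-raw 0             t = ≡.refl
  fib-raw 1             t = ≡.refl
  fib-raw (suc (suc m)) t = ≡.cong₂ _+_ (fib-raw (suc m) t)
    (≡.cong₂ (λ x y → x * t * y) (^-raw q m) (fib-raw m t))

  catalan-quotient : ∀ k → catalan k ≈ binom k k - q * nextBinom k
  catalan-quotient k = trans (≈⇒~ (CatalanPolynomial.catalan-binom k))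
    (reflexive (≡.cong₂ (λ x y → x - q * y) (binom-quotient k k) (nextBinom-quotient k)))

  qᵗ*q⁻ᵗ≈1 : ∀ t → q ^ t * q⁻¹ ^ t ≈ 1#
  qᵗ*q⁻ᵗ≈1 zero    = *-identityˡ 1#
  qᵗ*q⁻ᵗ≈1 (suc t) = begin
    q * q ^ t * (q⁻¹ * q⁻¹ ^ t)      ≈⟨ solve 4 (λ x a y b → x :* a :* (y :* b) := y :* x :* (a :* b)) refl q (q ^ t) q⁻¹ (q⁻¹ ^ t) ⟩
    q⁻¹ * q * (q ^ t * q⁻¹ ^ t)      ≈⟨ *-cong q⁻¹*q≈1 (qᵗ*q⁻ᵗ≈1 t) ⟩
    1# * 1#                          ≈⟨ *-identityˡ 1# ⟩
    1#                               ∎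

  -- Evaluation of Laurent polynomials in ℤ[q]/(Φₙ), where q⁻¹ = qⁿ⁻¹.
  evaluate : Laurent → Poly
  evaluate (p /q^ s) = p * q⁻¹ ^ s

  evaluate-ι : ∀ p → evaluate (ι p) ≈ p
  evaluate-ι p = *-identityʳ p

  evaluate-+ : ∀ x y → evaluate (x L.+ y) ≈ evaluate x + evaluate y
  evaluate-+ (p /q^ s) (g /q^ t) = begin
    (p * q P.^ t + g * q P.^ s) * q⁻¹ ^ (s ℕ.+ t)
      ≈⟨ *-cong {p * q P.^ t + g * q P.^ s} (reflexive (≡.cong₂ (λ a b → p * a + g * b) (^-raw q t) (^-raw q s))) (^-homo-* q⁻¹ s t) ⟩
    (p * q ^ t + g * q ^ s) * (q⁻¹ ^ s * q⁻¹ ^ t)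
      ≈⟨ solve 6 (λ p g a b u v → (p :* a :+ g :* b) :* (u :* v) := p :* u :* (a :* v) :+ g :* v :* (b :* u)) refl
           p g (q ^ t) (q ^ s) (q⁻¹ ^ s) (q⁻¹ ^ t) ⟩
    p * q⁻¹ ^ s * (q ^ t * q⁻¹ ^ t) + g * q⁻¹ ^ t * (q ^ s * q⁻¹ ^ s)
      ≈⟨ +-cong (*-congˡ {p * q⁻¹ ^ s} (qᵗ*q⁻ᵗ≈1 t)) (*-congˡ {g * q⁻¹ ^ t} (qᵗ*q⁻ᵗ≈1 s)) ⟩
    p * q⁻¹ ^ s * 1# + g * q⁻¹ ^ t * 1#
      ≈⟨ +-cong (*-identityʳ (p * q⁻¹ ^ s)) (*-identityʳ (g * q⁻¹ ^ t)) ⟩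
    p * q⁻¹ ^ s + g * q⁻¹ ^ t ∎

  evaluate-* : ∀ x y → evaluate (x L.* y) ≈ evaluate x * evaluate y
  evaluate-* (p /q^ s) (g /q^ t) = begin
    p * g * q⁻¹ ^ (s ℕ.+ t)              ≈⟨ *-congˡ {p * g} (^-homo-* q⁻¹ s t) ⟩
    p * g * (q⁻¹ ^ s * q⁻¹ ^ t)          ≈⟨ solve 4 (λ p g u v → p :* g :* (u :* v) := p :* u :* (g :* v)) refl p g (q⁻¹ ^ s) (q⁻¹ ^ t) ⟩
    p * q⁻¹ ^ s * (g * q⁻¹ ^ t)          ∎

  evaluate-neg : ∀ x → evaluate (L.- x) ≈ - evaluate x
  evaluate-neg (p /q^ s) = solve 2 (λ p u → (:- p) :* u := :- (p :* u)) refl p (q⁻¹ ^ s)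

  evaluate-- : ∀ x y → evaluate (x L.- y) ≈ evaluate x - evaluate y
  evaluate-- x y = trans (evaluate-+ x (L.- y)) (+-congˡ {evaluate x} (evaluate-neg y))

  evaluate-1 : evaluate L.1# ≈ 1#
  evaluate-1 = *-identityʳ 1#

  evaluate-^ : ∀ x k → evaluate (x L.^ k) ≈ evaluate x ^ k
  evaluate-^ x zero    = evaluate-1
  evaluate-^ x (suc k) = trans (evaluate-* x (x L.^ k)) (*-congˡ {evaluate x} (evaluate-^ x k))

  evaluate-sign : ∀ k → evaluate ((L.- L.1#) L.^ k) ≈ (- 1#) ^ k
  evaluate-sign k = trans (evaluate-^ (L.- L.1#) k) (^-congˡ k (trans (evaluate-neg L.1#) (-‿cong evaluate-1)))

  evaluate-sum : ∀ {m} (f : Fin m → Laurent) → evaluate (L.sum f) ≈ sum (evaluate ∘ f)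
  evaluate-sum {zero}  f = solve 1 (λ x → con (+ 0) :* x := con (+ 0)) refl 1#
  evaluate-sum {suc m} f = trans (evaluate-+ (f fzero) (L.sum (f ∘ fsuc))) (+-congˡ {evaluate (f fzero)} (evaluate-sum (f ∘ fsuc)))

  evaluate-q^ : ∀ k → evaluate (q^ (+ k)) ≈ q ^ k
  evaluate-q^ k = trans (evaluate-ι (q P.^ k)) (reflexive (^-raw q k))

  evaluate-q^- : ∀ k → evaluate (q^ (ℤ.- + k)) ≈ q⁻¹ ^ k
  evaluate-q^- zero    = *-identityʳ 1#
  evaluate-q^- (suc k) = *-identityˡ (q⁻¹ ^ suc k)

  ∣-ι : ∀ g t → Φ n ∣ g → ι (Φ n) L.∣ (g /q^ t)
  ∣-ι g t (c , cΦ≈g) = (c /q^ t) L∣., λ i → coeff-≡ equation i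
    where
    equation : c * Φ n * q P.^ t ≋ g * q P.^ (t ℕ.+ 0)
    equation = ℤ[q].trans (ℤ[q].*-congʳ {q P.^ t} cΦ≈g)
      (ℤ[q].reflexive (≡.cong (λ i → g P.* q P.^ i) (≡.sym (ℕ.+-identityʳ t))))

  -- Since q^t is invertible modulo Φ_n, a fraction evaluates to zero only if Φ_n divides its
  -- numerator; the cofactor over the same power of q is then the Laurent quotient.
  evaluate-zero : ∀ z → evaluate z ≈ 0# → ι (Φ n) L.∣ z
  evaluate-zero (g /q^ t) gq⁻ᵗ≈0 = ∣-ι g t (≈0⇒∣ {g} (begin
    g                          ≈⟨ *-identityʳ g ⟨
    g * 1#                     ≈⟨ *-congˡ {g} (qᵗ*q⁻ᵗ≈1 t) ⟨
    g * (q ^ t * q⁻¹ ^ t)      ≈⟨ solve 3 (λ g a b → g :* (a :* b) := a :* (g :* b)) refl g (q ^ t) (q⁻¹ ^ t) ⟩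
    q ^ t * (g * q⁻¹ ^ t)      ≈⟨ *-congˡ {q ^ t} gq⁻ᵗ≈0 ⟩
    q ^ t * 0#                 ≈⟨ zeroʳ (q ^ t) ⟩
    0#                         ∎))

  evaluate-reflects : ∀ x y → evaluate x ≈ evaluate y → x ≡ y [modΦ n ]
  evaluate-reflects x y eq = evaluate-zero (x L.- y) (trans (evaluate-- x y) (x≈y⇒x∙y⁻¹≈ε eq))
    where open import Algebra.Properties.Group +-group using (x≈y⇒x∙y⁻¹≈ε)

-- The number r(n) and the halved exponents

nC2≡triangle : ∀ k → k C 2 ≡ triangle k
nC2≡triangle zero    = ≡.refl
nC2≡triangle (suc k) = ≡.trans (≡.sym (nCk+nC[k+1]≡[n+1]C[k+1] k 1))
  (≡.trans (≡.cong₂ ℕ._+_ (nC1≡n k) (nC2≡triangle k)) (ℕ.+-comm k (triangle k)))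

-- As unnormalised fractions n/5 + 1/2 is (2n + 5)/10 without any reduction, so the floor is a
-- division of natural numbers.
r-value : ∀ n → r n ≡ (n ℕ.* 2 ℕ.+ 5) ℕ./ 10
r-value n = ≡.cong ℤ.∣_∣ (≡.trans (ℤ.div-pos-is-/ℕ (+ n ℤ.* + 2 ℤ.+ + 5) 10)
  (≡.cong (λ x → (x ℤ.+ + 5) ℤ./ℕ 10) (≡.sym (ℤ.pos-* n 2))))

-- Each 5 in n adds 10 to 2n + 5, so only the residue s matters: 2s + 5 has tens digit i = 0 for s ≤
-- 2 and i = 1 for s = 3, 4.
r-residue : ∀ s m i c → s ℕ.* 2 ℕ.+ 5 ≡ i ℕ.* 10 ℕ.+ c → c < 10 → r (s ℕ.+ m ℕ.* 5) ≡ i ℕ.+ m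
r-residue s m i c eq c<10 = ≡.trans (r-value (s ℕ.+ m ℕ.* 5)) (≡.trans (≡.cong (ℕ._/ 10) numerator)
  (≡.trans (ℕ.+-distrib-/-∣ʳ c (ℕ.n∣m*n (i ℕ.+ m)))
    (≡.cong₂ ℕ._+_ (ℕ.m<n⇒m/n≡0 c<10) (ℕ.m*n/n≡m (i ℕ.+ m) 10))))
  where
  expand : ∀ s m → (s ℕ.+ m ℕ.* 5) ℕ.* 2 ℕ.+ 5 ≡ s ℕ.* 2 ℕ.+ 5 ℕ.+ m ℕ.* 10
  expand = solve-∀
  collect : ∀ i m c → i ℕ.* 10 ℕ.+ c ℕ.+ m ℕ.* 10 ≡ c ℕ.+ (i ℕ.+ m) ℕ.* 10
  collect = solve-∀
  numerator : (s ℕ.+ m ℕ.* 5) ℕ.* 2 ℕ.+ 5 ≡ c ℕ.+ (i ℕ.+ m) ℕ.* 10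
  numerator = ≡.trans (expand s m) (≡.trans (≡.cong (ℕ._+ m ℕ.* 10) eq) (collect i m c))

half : ∀ z e → z ≡ + (2 ℕ.* e) → z ℤ./ + 2 ≡ + e
half z e ≡.refl = ≡.trans (ℤ.div-pos-is-/ℕ (+ (2 ℕ.* e)) 2)
  (≡.cong +_ (≡.trans (≡.cong (ℕ._/ 2) (ℕ.*-comm 2 e)) (ℕ.m*n/n≡m e 2)))

-- The difference is taken in ℤ: in the use with n = 1 and i = 2 it is negative, but r(1) = 0 makes
-- the product zero.
half-minus : ∀ r n i e → 2 ℕ.* e ℕ.+ i ℕ.* r ≡ r ℕ.* n → (+ r ℤ.* (+ n ℤ.- + i)) ℤ./ + 2 ≡ + e
half-minus r n i e eq = half _ e (begin
  + r ℤ.* (+ n ℤ.- + i)                            ≡⟨ expand (+ r) (+ n) (+ i) ⟩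
  + r ℤ.* + n ℤ.- + i ℤ.* + r                      ≡⟨ ≡.cong₂ ℤ._-_ (ℤ.pos-* r n) (ℤ.pos-* i r) ⟨
  + (r ℕ.* n) ℤ.- + (i ℕ.* r)                      ≡⟨ ≡.cong (λ x → + x ℤ.- + (i ℕ.* r)) eq ⟨
  + (2 ℕ.* e) ℤ.+ + (i ℕ.* r) ℤ.- + (i ℕ.* r)      ≡⟨ cancel (+ (2 ℕ.* e)) (+ (i ℕ.* r)) ⟩
  + (2 ℕ.* e)                                      ∎)
  where
  open ≡.≡-Reasoning
  expand : ∀ a b c → a ℤ.* (b ℤ.- c) ≡ a ℤ.* b ℤ.- c ℤ.* a
  expand = ℤSolver.solve-∀
  cancel : ∀ a b → a ℤ.+ b ℤ.- b ≡ a
  cancel = ℤSolver.solve-∀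

half-plus : ∀ r n i e → 2 ℕ.* e ≡ r ℕ.* n ℕ.+ i ℕ.* r → (+ r ℤ.* (+ n ℤ.+ + i)) ℤ./ + 2 ≡ + e
half-plus r n i e eq = half _ e (begin
  + r ℤ.* + (n ℕ.+ i)          ≡⟨ ℤ.pos-* r (n ℕ.+ i) ⟨
  + (r ℕ.* (n ℕ.+ i))          ≡⟨ ≡.cong +_ (≡.trans (ℕ.*-distribˡ-+ r n i) (≡.cong (r ℕ.* n ℕ.+_) (ℕ.*-comm r i))) ⟩
  + (r ℕ.* n ℕ.+ i ℕ.* r)      ≡⟨ ≡.cong +_ eq ⟨
  + (2 ℕ.* e)                  ∎)
  where open ≡.≡-Reasoning

-- The congruences in ℤ[q, q⁻¹]

module Theorem (n : ℕ) (0<n : 0 < n) where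

  open Evaluation n 0<n
  open CommutativeRing (Quotient.quotientRing polynomialRing (Φ n)) hiding (zero)
  open import Algebra.Properties.Semiring.Exp semiring using (_^_; ^-congʳ)
  open import Algebra.Properties.Semiring.Sum semiring using (sum; sum-cong-≋)
  open import Relation.Binary.Reasoning.Setoid setoid

  fibonacciSum : Laurent
  fibonacciSum = ι (fibonacci n q) L.+ ι (fibonacci (n ℕ.+ 2) P.1#)

  evaluate-fibonacciSum : evaluate fibonacciSum ≈ fibSum
  evaluate-fibonacciSum = trans (evaluate-+ (ι (fibonacci n q)) (ι (fibonacci (n ℕ.+ 2) P.1#)))
    (+-cong (trans (evaluate-ι (fibonacci n q)) (reflexive (fib-raw n q)))
            (trans (evaluate-ι (fibonacci (n ℕ.+ 2) P.1#)) (reflexive (fib-raw (n ℕ.+ 2) P.1#))))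

  summand : ℕ → Laurent
  summand k = (L.- L.1#) L.^ k L.* q^ (ℤ.- (+ (k C 2))) L.* ι (catalan k)

  evaluate-summand : ∀ k → evaluate (summand k) ≈ catalanSummand k
  evaluate-summand k = begin
    evaluate (summand k)
      ≈⟨ evaluate-* ((L.- L.1#) L.^ k L.* q^ (ℤ.- (+ (k C 2)))) (ι (catalan k)) ⟩
    evaluate ((L.- L.1#) L.^ k L.* q^ (ℤ.- (+ (k C 2)))) * evaluate (ι (catalan k))
      ≈⟨ *-cong (trans (evaluate-* ((L.- L.1#) L.^ k) (q^ (ℤ.- (+ (k C 2)))))
                  (*-cong (evaluate-sign k) (trans (evaluate-q^- (k C 2)) (^-congʳ q⁻¹ (nC2≡triangle k)))))
                (trans (evaluate-ι (catalan k)) (catalan-quotient k)) ⟩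
    catalanSummand k ∎

  catalan-congruence : L.sum {n} (λ k → summand (toℕ k)) ≡ fibonacciSum L.- (L.1# L.+ L.1#) [modΦ n ]
  catalan-congruence = evaluate-reflects (L.sum {n} (λ k → summand (toℕ k))) (fibonacciSum L.- (L.1# L.+ L.1#)) (begin
    evaluate (L.sum {n} (λ k → summand (toℕ k)))
      ≈⟨ evaluate-sum {n} (λ k → summand (toℕ k)) ⟩
    sum {n} (λ k → evaluate (summand (toℕ k)))
      ≈⟨ sum-cong-≋ {n} (λ k → evaluate-summand (toℕ k)) ⟩
    sum {n} (λ k → catalanSummand (toℕ k))
      ≈⟨ catalan-sum n ≡.refl 0<n ⟩
    fibSum - (1# + 1#)
      ≈⟨ +-cong evaluate-fibonacciSum (-‿cong (trans (evaluate-+ L.1# L.1#) (+-cong evaluate-1 evaluate-1))) ⟨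
    evaluate fibonacciSum - evaluate (L.1# L.+ L.1#)
      ≈⟨ evaluate-- fibonacciSum (L.1# L.+ L.1#) ⟨
    evaluate (fibonacciSum L.- (L.1# L.+ L.1#)) ∎)

  evaluate-term : ∀ {z e} → z ≡ + e → evaluate (q^ z) ≈ q ^ e
  evaluate-term {e = e} ≡.refl = evaluate-q^ e

  twoTerms threeTerms : ℕ → Laurent
  twoTerms m = (L.- L.1#) L.^ m L.* (q^ ((+ m ℤ.* (+ n ℤ.- + 1)) ℤ./ + 2) L.+ q^ ((+ m ℤ.* (+ n ℤ.+ + 1)) ℤ./ + 2))
  threeTerms m = (L.- L.1#) L.^ m L.* (q^ ((+ m ℤ.* (+ n ℤ.- + 2)) ℤ./ + 2) L.+ q^ ((+ m ℤ.* + n) ℤ./ + 2)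
                                      L.+ q^ ((+ m ℤ.* (+ n ℤ.+ + 2)) ℤ./ + 2))

  twoTerms-congruence : ∀ m → TwoTerms m → fibonacciSum ≡ twoTerms m [modΦ n ]
  twoTerms-congruence m (e₁ , e₂ , h₁ , h₂ , eq) = evaluate-reflects fibonacciSum (twoTerms m) (begin
    evaluate fibonacciSum                    ≈⟨ evaluate-fibonacciSum ⟩
    fibSum                                   ≈⟨ eq ⟩
    (- 1#) ^ m * (q ^ e₁ + q ^ e₂)           ≈⟨ *-cong (evaluate-sign m) (+-cong (evaluate-term {x₁} t₁) (evaluate-term {x₂} t₂)) ⟨
    evaluate s * (evaluate (q^ x₁) + evaluate (q^ x₂))
      ≈⟨ *-congˡ {evaluate s} (evaluate-+ (q^ x₁) (q^ x₂)) ⟨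
    evaluate s * evaluate (q^ x₁ L.+ q^ x₂)  ≈⟨ evaluate-* s (q^ x₁ L.+ q^ x₂) ⟨
    evaluate (twoTerms m)                    ∎)
    where
    s = (L.- L.1#) L.^ m
    x₁ = (+ m ℤ.* (+ n ℤ.- + 1)) ℤ./ + 2
    x₂ = (+ m ℤ.* (+ n ℤ.+ + 1)) ℤ./ + 2
    t₁ : x₁ ≡ + e₁
    t₁ = half-minus m n 1 e₁ (≡.trans (≡.cong (2 ℕ.* e₁ ℕ.+_) (ℕ.*-identityˡ m)) h₁)
    t₂ : x₂ ≡ + e₂
    t₂ = half-plus m n 1 e₂ (≡.trans h₂ (≡.cong (m ℕ.* n ℕ.+_) (≡.sym (ℕ.*-identityˡ m))))

  threeTerms-congruence : ∀ m → ThreeTerms m → fibonacciSum ≡ threeTerms m [modΦ n ]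
  threeTerms-congruence m (e₁ , e₂ , e₃ , h₁ , h₂ , h₃ , eq) = evaluate-reflects fibonacciSum (threeTerms m) (begin
    evaluate fibonacciSum                    ≈⟨ evaluate-fibonacciSum ⟩
    fibSum                                   ≈⟨ eq ⟩
    (- 1#) ^ m * (q ^ e₁ + q ^ e₂ + q ^ e₃)
      ≈⟨ *-cong (evaluate-sign m) (+-cong (+-cong (evaluate-term {x₁} t₁) (evaluate-term {x₂} t₂)) (evaluate-term {x₃} t₃)) ⟨
    evaluate s * (evaluate (q^ x₁) + evaluate (q^ x₂) + evaluate (q^ x₃))
      ≈⟨ *-congˡ {evaluate s} (trans (evaluate-+ (q^ x₁ L.+ q^ x₂) (q^ x₃))
                                 (+-congʳ {evaluate (q^ x₃)} (evaluate-+ (q^ x₁) (q^ x₂)))) ⟨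
    evaluate s * evaluate (q^ x₁ L.+ q^ x₂ L.+ q^ x₃)
      ≈⟨ evaluate-* s (q^ x₁ L.+ q^ x₂ L.+ q^ x₃) ⟨
    evaluate (threeTerms m)                  ∎)
    where
    s = (L.- L.1#) L.^ m
    x₁ = (+ m ℤ.* (+ n ℤ.- + 2)) ℤ./ + 2
    x₂ = (+ m ℤ.* + n) ℤ./ + 2
    x₃ = (+ m ℤ.* (+ n ℤ.+ + 2)) ℤ./ + 2
    t₁ : x₁ ≡ + e₁
    t₁ = half-minus m n 2 e₁ h₁
    t₂ : x₂ ≡ + e₂
    t₂ = half _ e₂ (≡.trans (≡.sym (ℤ.pos-* m n)) (≡.cong +_ (≡.sym h₂)))
    t₃ : x₃ ≡ + e₃
    t₃ = half-plus m n 2 e₃ h₃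

  residue : ∀ {s} → n % 5 ≡ s → n ≡ s ℕ.+ n ℕ./ 5 ℕ.* 5
  residue n%5≡s = ≡.trans (ℕ.m≡m%n+[m/n]*n n 5) (≡.cong (ℕ._+ n ℕ./ 5 ℕ.* 5) n%5≡s)

  r-at : ∀ s m i c → n ≡ s ℕ.+ m ℕ.* 5 → s ℕ.* 2 ℕ.+ 5 ≡ i ℕ.* 10 ℕ.+ c → c < 10 → r n ≡ i ℕ.+ m
  r-at s m i c n≡ eq c<10 = ≡.trans (≡.cong r n≡) (r-residue s m i c eq c<10)

  fibonacci-two : n % 5 ≡ 0 ⊎ n % 5 ≡ 2 ⊎ n % 5 ≡ 3 → fibonacciSum ≡ twoTerms (r n) [modΦ n ]
  fibonacci-two = λ n%5 → twoTerms-congruence (r n) (terms n%5)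
    where
    multiple : ∀ k → n ≡ k ℕ.* 5 → TwoTerms (r n)
    multiple zero    n≡0 = ⊥-elim (ℕ.<⇒≢ 0<n (≡.sym n≡0))
    -- The numbers 0 and 5 are the tens and units digits of 2s + 5 at s = 0, and similarly for the
    -- other residues. Here n/5 is m + 1, because `fibSum-5m` counts from n = 5.
    multiple (suc m) n≡  = ≡.subst TwoTerms (≡.sym (r-at 0 (suc m) 0 5 n≡ ≡.refl (ℕ.m≤m+n 6 4))) (fibSum-5m m n≡)
    terms : n % 5 ≡ 0 ⊎ n % 5 ≡ 2 ⊎ n % 5 ≡ 3 → TwoTerms (r n)
    terms (inj₁ n%5≡0)        = multiple (n ℕ./ 5) (residue n%5≡0)
    terms (inj₂ (inj₁ n%5≡2)) = ≡.subst TwoTerms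
      (≡.sym (r-at 2 (n ℕ./ 5) 0 9 (residue n%5≡2) ≡.refl (ℕ.m≤m+n 10 0))) (fibSum-5m+2 (n ℕ./ 5) (residue n%5≡2))
    terms (inj₂ (inj₂ n%5≡3)) = ≡.subst TwoTerms
      (≡.sym (r-at 3 (n ℕ./ 5) 1 1 (residue n%5≡3) ≡.refl (ℕ.m≤m+n 2 8))) (fibSum-5m+3 (n ℕ./ 5) (residue n%5≡3))

  fibonacci-three : n % 5 ≡ 1 ⊎ n % 5 ≡ 4 → fibonacciSum ≡ threeTerms (r n) [modΦ n ]
  fibonacci-three = λ n%5 → threeTerms-congruence (r n) (terms n%5)
    where
    terms : n % 5 ≡ 1 ⊎ n % 5 ≡ 4 → ThreeTerms (r n)
    terms (inj₁ n%5≡1) = ≡.subst ThreeTerms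
      (≡.sym (r-at 1 (n ℕ./ 5) 0 7 (residue n%5≡1) ≡.refl (ℕ.m≤m+n 8 2))) (fibSum-5m+1 (n ℕ./ 5) (residue n%5≡1))
    terms (inj₂ n%5≡4) = ≡.subst ThreeTerms
      (≡.sym (r-at 4 (n ℕ./ 5) 1 3 (residue n%5≡4) ≡.refl (ℕ.m≤m+n 4 6))) (fibSum-5m+4 (n ℕ./ 5) (residue n%5≡4))

open import Defs

theorem6p3 : ∀ (n : ℕ) → 0 < n →
  (sum {n} (λ k → (- 1#) ^ toℕ k * q^ (ℤ.- (+ (toℕ k C 2))) * ι (catalan (toℕ k)))
    ≡ ι (fibonacci n q) + ι (fibonacci (n ℕ.+ 2) (Polynomial.1#)) - (1# + 1#) [modΦ n ])
  × (n % 5 ≡ 0 ⊎ n % 5 ≡ 2 ⊎ n % 5 ≡ 3 →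
     ι (fibonacci n q) + ι (fibonacci (n ℕ.+ 2) (Polynomial.1#))
       ≡ (- 1#) ^ r n * (q^ ((+ r n ℤ.* (+ n ℤ.- + 1)) ℤ./ + 2)
                       + q^ ((+ r n ℤ.* (+ n ℤ.+ + 1)) ℤ./ + 2)) [modΦ n ])
  × (n % 5 ≡ 1 ⊎ n % 5 ≡ 4 →
     ι (fibonacci n q) + ι (fibonacci (n ℕ.+ 2) (Polynomial.1#))
       ≡ (- 1#) ^ r n * (q^ ((+ r n ℤ.* (+ n ℤ.- + 2)) ℤ./ + 2)
                       + q^ ((+ r n ℤ.* + n) ℤ./ + 2)
                       + q^ ((+ r n ℤ.* (+ n ℤ.+ + 2)) ℤ./ + 2)) [modΦ n ])
theorem6p3 n 0<n = catalan-congruence , fibonacci-two , fibonacci-three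
  where open Theorem n 0<n
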